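{- Let $\Delta$ be an odd positive integer. Let $\xi$ be a root of any basic primitive irreducible polynomial of degree $\Delta$ over $\mathbb{Z}_4$, and let $\mathcal{R}=\mathrm{GR}(4^\Delta)=\mathbb{Z}_4[\xi]$. Consider a partition of $\mathcal{R}\setminus\{0\}$ into the $2^\Delta-1$ triples $\{\xi^i,2\xi^i,3\xi^i\}$, $0\le i\le 2^\Delta-2$, and $\frac{(2^\Delta-1)(2^\Delta-2)}{6}$ six-element sets (sixtuples) of the form $\{\pm a,\pm b,\pm(a+b)\}$, such that the partition is invariant under multiplication by $\xi$ and, if $\Delta\not\equiv 0\bmod 3$, under the action of the automorphisms of the ring $\mathrm{GR}(4^\Delta)$ (such a partition exists for every odd $\Delta$). Let $H$ be the $\Delta\times\frac{2^{2\Delta}-1}{3}$ matrix over $\mathbb{Z}_4$ consisting of $(2^\Delta-1)\frac{2^\Delta-2}{6}$ pairs of columns $(a,b)$, one pair for each sixtuple $\{\pm a,\pm b,\pm(a+b)\}$ of the partition, in the left part, and the $2^\Delta-1$ columns $\xi^i$, $0\le i\le 2^\Delta-2$, in the right part. The following holds: - the code $C$ defined by the check matrix $H$ is a $1$-perfect code in $D\big((2^\Delta-1)\frac{2^\Delta-2}{6},\,2^\Delta-1\big)$; - the coordinate permutation that corresponds to multiplying each column of $H$ by $\xi$ (the pairs $(a,b)$ being chosen so that this multiplication maps the set of columns of $H$ onto itself) is an automorphism of the code $C$; - if $\Delta$ is not divisible by $3$, then the coordinate permutation that corresponds to a ring automorphism of $\mathrm{GR}(4^\Delta)$ (the pairs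 $(a,b)$ being chosen so that this automorphism maps the set of columns of $H$ onto itself) is an automorphism of the code $C$.
   Context: A basic primitive polynomial of degree $\Delta$ over $\mathbb{Z}_4$ is a monic polynomial $h(x)\in\mathbb{Z}_4[x]$ of degree $\Delta$ whose reduction modulo $2$ is a primitive polynomial over $\mathbb{F}_2$ and whose root $\xi$ has multiplicative order $2^\Delta-1$. The Galois ring is $\mathrm{GR}(4^\Delta)=\mathbb{Z}_4[x]/(h(x))$, and an element $h_0+h_1\xi+\cdots+h_{\Delta-1}\xi^{\Delta-1}$ is identified with the column $(h_0,\ldots,h_{\Delta-1})^T$ over $\mathbb{Z}_4$. The Shrikhande graph $\mathrm{Sh}$ is the Cayley graph on $\mathbb{Z}_4^2$ with connecting set $\{\pm(0,1),\pm(1,0),\pm(1,1)\}$. The graph $D(m,n)$ is the Cartesian product of $m$ copies of $\mathrm{Sh}$ and $n$ copies of the complete graph $K_4$ (with vertex set $\mathbb{Z}_4$); its vertex set is $\mathbb{Z}_4^{2m}\times\mathbb{Z}_4^n$, where coordinates $2i-1,2i$ ($1\le i\le m$) form the $i$-th $\mathrm{Sh}$ factor and the last $n$ coordinates are the $K_4$ factors. (It is called a Doob graph if $m>0$.) A $1$-perfect code in a graph is a set of vertices such that every vertex of the graph is at distance at most $1$ from exactly one code vertex. With $m=(2^\Delta-1)\frac{2^\Delta-2}{6}$ and $n=2^\Delta-1$, each pair of columns $(a,b)$ of $H$ occupies positions $2i-1,2i$ for some $i\in\{1,\ldots,m\}$, and the code with check matrix $H$ is $C=\{c\in\mathbb{Z}_4^{2m}\times\mathbb{Z}_4^{n}: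 Hc^T=0\}$. The columns $h_1,\ldots,h_{2m+n}$ of $H$ are pairwise distinct. For a bijection $\varphi$ of $\mathcal{R}$ that maps the set of columns of $H$ onto itself, the corresponding coordinate permutation $\pi$ of $\{1,\ldots,2m+n\}$ is defined by $h_{\pi(i)}=\varphi(h_i)$. It is an automorphism of $C$ if moving the coordinate in position $i$ to position $\pi(i)$, for all $i$, maps $C$ onto $C$. -}

module Defs where

open import Algebra.Bundles using (RawRing)
import Algebra.Definitions.RawSemiring as RawSemiringDefinitions
open import Algebra.Morphism.Structures using (module RingMorphisms)
open import Data.Fin.Base using (Fin; zero; suc; toℕ; remQuot; combine; splitAt; _↑ˡ_; _↑ʳ_)
open import Data.Fin.Permutation as Perm using (Permutation′; _⟨$⟩ʳ_; _⟨$⟩ˡ_)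
open import Data.List.Base using (List; []; _∷_; map)
open import Data.List.Membership.Propositional using (_∈_)
open import Data.List.Relation.Unary.Unique.Propositional using (Unique)
open import Data.Nat.Base as ℕ using (ℕ; NonZero; _∸_; _<_; _≤_)
open import Data.Nat.Divisibility using (_∤_)
open import Data.Nat.DivMod using (_/_; _mod_)
open import Data.Product using (∃; ∃₂; ∃!; _×_; _,_; proj₁; proj₂)
open import Data.Sum.Base using (_⊎_; inj₁; inj₂; [_,_]′)
open import Data.Vec.Base as Vec using (Vec; lookup; tabulate)
open import Function.Base using (_∘_)
open import Level using (0ℓ)
open import Relation.Binary.PropositionalEquality using (_≡_; _≢_)
open import Relation.Unary using (Pred; _≐_)

Image : {A B : Set} → (A → B) → Pred A 0ℓ → Pred B 0ℓ
Image f P y = ∃ λ x → P x × f x ≡ y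

ℤ/ : (q : ℕ) .{{_ : NonZero q}} → RawRing 0ℓ 0ℓ
ℤ/ q = record
  { Carrier = Fin q
  ; _≈_     = _≡_
  ; _+_     = λ a b → (toℕ a ℕ.+ toℕ b) mod q
  ; _*_     = λ a b → (toℕ a ℕ.* toℕ b) mod q
  ; -_      = λ a → (q ∸ toℕ a) mod q
  ; 0#      = 0 mod q
  ; 1#      = 1 mod q
  }

-- Lists of coefficients, constant term first.
-- Trailing zeros are allowed, so equality is equality of all coefficients.

Poly : ℕ → Set
Poly q = List (Fin q)

module Polynomial (q : ℕ) .{{_ : NonZero q}} where

  private module A = RawRing (ℤ/ q)

  coeff : Poly q → ℕ → Fin q
  coeff []      _         = A.0#
  coeff (a ∷ p) ℕ.zero    = a
  coeff (a ∷ p) (ℕ.suc k) = coeff p k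

  addP : Poly q → Poly q → Poly q
  addP []      r       = r
  addP (a ∷ p) []      = a ∷ p
  addP (a ∷ p) (b ∷ r) = (a A.+ b) ∷ addP p r

  mulP : Poly q → Poly q → Poly q
  mulP []      r = []
  mulP (a ∷ p) r = addP (map (a A.*_) r) (A.0# ∷ mulP p r)

  polyRing : RawRing 0ℓ 0ℓ
  polyRing = record
    { Carrier = Poly q
    ; _≈_     = λ p r → ∀ k → coeff p k ≡ coeff r k
    ; _+_     = addP
    ; _*_     = mulP
    ; -_      = map A.-_
    ; 0#      = []
    ; 1#      = A.1# ∷ []
    }

  IsMonicOfDegree : ℕ → Poly q → Set
  IsMonicOfDegree d p = coeff p d ≡ A.1# × (∀ k → d < k → coeff p k ≡ A.0#)

  Irreducible : Poly q → Set
  Irreducible = RawSemiringDefinitions.Irreducible (RawRing.rawSemiring polyRing)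

-- The ring (ℤ/q)[x]/(h) for h monic of degree Δ.  The class of
-- h₀ + h₁ x + ⋯ is represented by the column (h₀, …, h_{Δ-1}) of its
-- reduced representative.

module Quotient (q : ℕ) .{{_ : NonZero q}} (Δ : ℕ) (h : Poly q) where

  open Polynomial q
  private module A = RawRing (ℤ/ q)

  Column : Set
  Column = Vec (Fin q) Δ

  infixl 6 _⊕_
  _⊕_ : Column → Column → Column
  _⊕_ = Vec.zipWith A._+_

  -- Multiplication by x: from x v(x), which has degree at most Δ, subtract
  -- the multiple of h that cancels its coefficient c at x^Δ.
  x·_ : Column → Column
  x· v = tabulate λ i → coeff xv (toℕ i) A.+ (A.- (c A.* coeff h (toℕ i)))
    where
    xv : Poly q
    xv = A.0# ∷ Vec.toList v

    c : Fin q
    c = coeff xv Δ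

  constant : Fin q → Column
  constant a = tabulate (λ i → coeff (a ∷ []) (toℕ i))

  -- Remainder of a polynomial modulo h, by Horner's scheme.
  rem : Poly q → Column
  rem []      = Vec.replicate Δ A.0#
  rem (a ∷ p) = constant a ⊕ (x· rem p)

  quotientRing : RawRing 0ℓ 0ℓ
  quotientRing = record
    { Carrier = Column
    ; _≈_     = _≡_
    ; _+_     = _⊕_
    ; _*_     = λ u v → rem (mulP (Vec.toList u) (Vec.toList v))
    ; -_      = Vec.map A.-_
    ; 0#      = rem []
    ; 1#      = rem (A.1# ∷ [])
    }

  ξ : Column
  ξ = rem (A.0# ∷ A.1# ∷ [])

  open RawRing quotientRing using (rawSemiring; 1#)
  open RawSemiringDefinitions rawSemiring using (_^_)

  HasMultiplicativeOrder : Column → ℕ → Set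
  HasMultiplicativeOrder r d =
    0 < d × r ^ d ≡ 1# × (∀ k → 0 < k → k < d → r ^ k ≢ 1#)

record IsPrimitive (Δ : ℕ) (p : Poly 2) : Set where
  open Polynomial 2
  open Quotient 2 Δ p
  field
    monic       : IsMonicOfDegree Δ p
    irreducible : Irreducible p
    order       : HasMultiplicativeOrder ξ (2 ℕ.^ Δ ∸ 1)

reduceMod2 : Poly 4 → Poly 2
reduceMod2 = map (λ a → toℕ a mod 2)

record IsBasicPrimitive (Δ : ℕ) (h : Poly 4) : Set where
  open Polynomial 4
  open Quotient 4 Δ h
  field
    monic            : IsMonicOfDegree Δ h
    primitive-modulo : IsPrimitive Δ (reduceMod2 h)
    order            : HasMultiplicativeOrder ξ (2 ℕ.^ Δ ∸ 1)

record Graph : Set₁ where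
  field
    Vertex : Set
    Adj    : Vertex → Vertex → Set

module _ (G : Graph) where
  open Graph G

  data Walk : ℕ → Vertex → Vertex → Set where
    stop : ∀ {u} → Walk 0 u u
    step : ∀ {l u v w} → Adj u v → Walk l v w → Walk (ℕ.suc l) u w

  DistanceAtMost : ℕ → Vertex → Vertex → Set
  DistanceAtMost d u v = ∃ λ l → l ≤ d × Walk l u v

  IsPerfect₁ : Pred Vertex 0ℓ → Set
  IsPerfect₁ C = ∀ v → ∃! _≡_ λ c → C c × DistanceAtMost 1 v c

ℤ₄ : Set
ℤ₄ = Fin 4

private
  module ℤ₄ where
    open RawRing (ℤ/ 4) public
    open RawSemiringDefinitions rawSemiring public using (sum)

Sh : Graph
Sh = record
  { Vertex = ℤ₄ × ℤ₄
  ; Adj    = λ (u₁ , u₂) (v₁ , v₂) →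
      (v₁ ℤ₄.+ (ℤ₄.- u₁) , v₂ ℤ₄.+ (ℤ₄.- u₂)) ∈ connectingSet
  }
  where
  neg : ℤ₄ × ℤ₄ → ℤ₄ × ℤ₄
  neg (a , b) = ℤ₄.- a , ℤ₄.- b

  e₀₁ e₁₀ e₁₁ : ℤ₄ × ℤ₄
  e₀₁ = ℤ₄.0# , ℤ₄.1#
  e₁₀ = ℤ₄.1# , ℤ₄.0#
  e₁₁ = ℤ₄.1# , ℤ₄.1#

  connectingSet : List (ℤ₄ × ℤ₄)
  connectingSet = e₀₁ ∷ neg e₀₁ ∷ e₁₀ ∷ neg e₁₀ ∷ e₁₁ ∷ neg e₁₁ ∷ []

K₄ : Graph
K₄ = record { Vertex = ℤ₄ ; Adj = _≢_ }

-- Words of ℤ₄^{2m} × ℤ₄^n.  Counting from 0, the i-th Sh factor occupies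
-- positions 2i and 2i + 1.
Word : ℕ → ℕ → Set
Word m n = Vec ℤ₄ (m ℕ.* 2 ℕ.+ n)

module _ (m n : ℕ) where

  factor : Fin m ⊎ Fin n → Graph
  factor (inj₁ _) = Sh
  factor (inj₂ _) = K₄

  component : (f : Fin m ⊎ Fin n) → Word m n → Graph.Vertex (factor f)
  component (inj₁ i) u = lookup u (combine {m} {2} i zero ↑ˡ n) ,
                         lookup u (combine {m} {2} i (suc zero) ↑ˡ n)
  component (inj₂ j) u = lookup u ((m ℕ.* 2) ↑ʳ j)

  D : Graph
  D = record
    { Vertex = Word m n
    ; Adj    = λ u v → ∃ λ f →
        Graph.Adj (factor f) (component f u) (component f v)
        × (∀ g → g ≢ f → component g u ≡ component g v)
    }

Matrix : ℕ → ℕ → Set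
Matrix r N = Fin r → Fin N → ℤ₄

Code : ∀ {r N} → Matrix r N → Pred (Vec ℤ₄ N) 0ℓ
Code H c = ∀ k → ℤ₄.sum (λ i → H k i ℤ₄.* lookup c i) ≡ ℤ₄.0#

-- Coordinate i is moved to position π(i).
permute : ∀ {N} → Permutation′ N → Vec ℤ₄ N → Vec ℤ₄ N
permute π c = tabulate (λ k → lookup c (π ⟨$⟩ˡ k))

IsAutomorphism : ∀ {N} → Pred (Vec ℤ₄ N) 0ℓ → Permutation′ N → Set
IsAutomorphism C π = Image (permute π) C ≐ C

#triples #sixtuples : ℕ → ℕ
#triples Δ   = 2 ℕ.^ Δ ∸ 1
#sixtuples Δ = ((2 ℕ.^ Δ ∸ 1) ℕ.* (2 ℕ.^ Δ ∸ 2)) / 6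

module Galois (Δ : ℕ) (h : Poly 4) where

  open Quotient 4 Δ h public using (ξ) renaming (quotientRing to GR; Column to R)
  open RawRing GR using (_+_; _*_; -_; 0#; rawSemiring)
  open RawSemiringDefinitions rawSemiring using (_^_) renaming (_×_ to _·_)

  IsRingAutomorphism : (R → R) → Set
  IsRingAutomorphism = RingMorphisms.IsRingIsomorphism GR GR

  mulξ : R → R
  mulξ r = ξ * r

  triple : ℕ → List R
  triple i = ξ ^ i ∷ 2 · (ξ ^ i) ∷ 3 · (ξ ^ i) ∷ []

  sixtuple : R → R → List R
  sixtuple a b = a ∷ - a ∷ b ∷ - b ∷ (a + b) ∷ - (a + b) ∷ []

  m n : ℕ
  m = #sixtuples Δ
  n = #triples Δ

  -- The triples are fixed, so a partition is given by its sixtuples.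
  Sixtuples : Set₁
  Sixtuples = Fin m → Pred R 0ℓ

  block : Sixtuples → Fin n ⊎ Fin m → Pred R 0ℓ
  block S (inj₁ i) r = r ∈ triple (toℕ i)
  block S (inj₂ j) r = S j r

  IsInvariant : Sixtuples → (R → R) → Set
  IsInvariant S φ = ∀ k → ∃ λ l → Image φ (block S k) ≐ block S l

  record IsPartition (S : Sixtuples) : Set where
    field
      sixtuples   : ∀ j → ∃₂ λ a b → Unique (sixtuple a b) × S j ≐ (_∈ sixtuple a b)
      nonzero     : ∀ k r → block S k r → r ≢ 0#
      covers-once : ∀ r → r ≢ 0# → ∃! _≡_ λ k → block S k r
      ξ-invariant : IsInvariant S mulξ
      automorphism-invariant :
        3 ∤ Δ → ∀ φ → IsRingAutomorphism φ → IsInvariant S φ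

  Pairs : Set
  Pairs = Fin m → R × R

  IsChoice : Sixtuples → Pairs → Set
  IsChoice S P = ∀ j → S j ≐ (_∈ sixtuple (proj₁ (P j)) (proj₂ (P j)))

  column : Pairs → Fin (m ℕ.* 2 ℕ.+ n) → R
  column P = [ (λ k → entry (remQuot {m} 2 k)) , (λ i → ξ ^ toℕ i) ]′ ∘ splitAt (m ℕ.* 2)
    where
    entry : Fin m × Fin 2 → R
    entry (j , zero)     = proj₁ (P j)
    entry (j , suc zero) = proj₂ (P j)

  checkMatrix : Pairs → Matrix Δ (m ℕ.* 2 ℕ.+ n)
  checkMatrix P k i = lookup (column P i) k

  IsColumn : Pairs → Pred R 0ℓ
  IsColumn P r = ∃ λ i → column P i ≡ r

  MapsColumnsOntoColumns : Pairs → (R → R) → Set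
  MapsColumnsOntoColumns P φ = Image φ (IsColumn P) ≐ IsColumn P

  Corresponds : Pairs → (R → R) → Permutation′ (m ℕ.* 2 ℕ.+ n) → Set
  Corresponds P φ π = ∀ i → column P (π ⟨$⟩ʳ i) ≡ φ (column P i)

  -- φ determines exactly one coordinate permutation, and that permutation
  -- is an automorphism of the code.
  InducesAutomorphism : Pairs → (R → R) → Set
  InducesAutomorphism P φ =
    ∃! Perm._≈_ (Corresponds P φ)
    × (∀ π → Corresponds P φ π → IsAutomorphism (Code (checkMatrix P)) π)

  -- The pairs can be chosen so that φ permutes the columns, and for every
  -- such choice φ induces an automorphism of the code.
  ActsOnCode : Sixtuples → (R → R) → Set
  ActsOnCode S φ =
    (∃ λ P → IsChoice S P × MapsColumnsOntoColumns P φ)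
    × (∀ P → IsChoice S P → MapsColumnsOntoColumns P φ → InducesAutomorphism P φ)

{-# OPTIONS --safe #-}

-- Write R = GR(4^Δ), n = 2^Δ − 1.  The square of an element of R depends only on its
-- class modulo 2, so squares are the Teichmüller elements 0, ξ^i.  From
-- p² − q² = (p + q)² + 2q(p + q) it follows that every unit other than ±ξ^i is p² − q²
-- for exactly one pair (p, q) of classes modulo 2, and p, q, p + q are then nonzero.
-- A sixtuple is therefore attached to every line {p, q, p + q} of the residue field 𝔽:
-- the six differences of p², q², (p + q)².  Multiplication by ξ and ring automorphisms
-- map lines to lines, and counting the pairs (p, q) gives n(n − 1)/6 lines.
--
-- The code is 1-perfect because the blocks of the partition are exactly the syndromes
-- of the errors confined to one factor of D(m, n).
--
-- A symmetry φ of the partition permutes the sixtuples.  If a power of φ stabilises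
-- {±a, ±b, ±(a + b)}, it acts there with order dividing 12; since φ has order prime
-- to 6 (its order divides n for multiplication by ξ, and Δ for a ring automorphism) it
-- acts trivially.  Hence pairs chosen in one sixtuple of each orbit propagate
-- consistently along the orbits.  A ring automorphism has order dividing Δ because it
-- sends ξ to a root of the polynomial of ξ over 𝔽₂, whose roots are the ξ^(2^i).
module Submission where

open import Defs
open import Data.Nat.Base using (ℕ)
open import Data.Nat.Divisibility using (_∤_)
open import Data.Product.Base using (∃; _×_)

open import Algebra.Bundles using (CommutativeRing; RawRing)
import Algebra.Definitions.RawSemiring as RawSemiringDefinitions
open import Algebra.Morphism.Structures using (module RingMorphisms)
import Algebra.Properties.AbelianGroup as AbelianGroupProperties
import Algebra.Properties.CommutativeMonoid.Sum as SumProperties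
import Algebra.Properties.CommutativeSemigroup as CommutativeSemigroupProperties
import Algebra.Properties.CommutativeSemiring.Exp as ExpProperties
import Algebra.Properties.Group as GroupProperties
import Algebra.Properties.Monoid.Mult as MultProperties
import Algebra.Properties.Ring as RingProperties
import Algebra.Solver.Ring.NaturalCoefficients.Default as Solver
open import Algebra.Structures using (IsCommutativeRing)
open import Data.Fin.Base as Fin
  using (Fin; zero; suc; toℕ; fromℕ<; remQuot; splitAt; punchIn; punchOut; _↑ˡ_; _↑ʳ_)
open import Data.Fin.Patterns using (0F; 1F; 2F; 3F; 4F; 5F)
open import Data.Fin.Permutation as Perm using (Permutation′; _⟨$⟩ʳ_; _⟨$⟩ˡ_)
open import Data.Fin.Properties as Fin using (all?)
open import Data.List.Base as List using (List; []; _∷_; _++_; length; concat; map; filter; head; allFin)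
open import Data.List.Properties using (length-++; length-map; length-tabulate; filter-≐)
import Data.List.Membership.DecPropositional as DecMembership
open import Data.List.Membership.Propositional using (_∈_; _∉_; find)
open import Data.List.Membership.Propositional.Properties
  using (∈-∃++; ∈-lookup; ∈-filter⁺; ∈-filter⁻; ∈-allFin; ∈-map⁺; ∈-map⁻; ∈-concat⁺; ∈-concat⁻)
open import Data.List.Relation.Binary.Disjoint.Propositional using (Disjoint)
open import Data.List.Relation.Binary.Permutation.Propositional.Properties using (shift; ∈-resp-↭; ↭-length)
open import Data.List.Relation.Binary.Subset.Propositional using (_⊆_)
open import Data.List.Relation.Unary.All as All using (All; []; _∷_)
open import Data.List.Relation.Unary.All.Properties as All using (¬Any⇒All¬; All¬⇒¬Any)
open import Data.List.Relation.Unary.AllPairs as AllPairs using (AllPairs; []; _∷_)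
import Data.List.Relation.Unary.AllPairs.Properties as AllPairs
open import Data.List.Relation.Unary.Any as Any using (Any; here; there)
import Data.List.Relation.Unary.Any.Properties as Any
import Data.List.Relation.Unary.Unique.DecPropositional as DecUnique
open import Data.List.Relation.Unary.Unique.Propositional using (Unique)
import Data.List.Relation.Unary.Unique.Propositional.Properties as Unique
open import Data.Maybe.Base using (just)
open import Data.Maybe.Properties using (just-injective)
open import Data.Nat.Base as ℕ using (zero; suc; _∸_; _<_; _≤_; z≤n; s≤s)
open import Data.Nat.Divisibility using (divides)
open import Data.Nat.DivMod using (_%_; _/_; _mod_; m≡m%n+[m/n]*n; m%n<n; m*n/n≡m)
open import Data.Nat.GeneralisedArithmetic using (fold; fold-+)
import Data.Nat.Properties as ℕ
open import Data.Nat.Solver using (module +-*-Solver)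
open import Data.Product using (∃₂; ∃!; _,_; proj₁; proj₂; swap; uncurry)
open import Data.Product.Properties as Product using ()
open import Data.Sum.Base using (_⊎_; inj₁; inj₂)
open import Data.Sum.Properties as Sum using ()
open import Data.Vec.Base as Vec using (Vec; []; _∷_; toList; _[_]≔_)
import Data.Vec.Properties as Vec
open import Function.Base using (_∘_)
open import Function.Definitions using (Injective)
open import Level using (0ℓ)
open import Relation.Binary.Definitions using (DecidableEquality; Tri; tri<; tri≈; tri>)
open import Relation.Binary.PropositionalEquality
  using (_≡_; _≢_; refl; sym; trans; cong; cong₂; subst; isEquivalence; module ≡-Reasoning)
open import Relation.Nullary.Decidable using (Dec; yes; no; ¬?; toWitness; _→-dec_)
open import Relation.Nullary.Negation using (contradiction; ¬_)
open import Relation.Unary as Unary using (Pred; _≐_)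

-- The residue field is never constructed. Congruence modulo 2 is an equality of doubles in R, and
-- invertibility of the non-zero classes comes from counting: 0 and the n powers of `ξ` already
-- exhaust the 2^Δ classes. A line is not an object either, only an independent pair of points up to
-- equality of the attached sixtuples; so the number of lines is obtained by comparing the lengths
-- of two lists. Multiplication by `ξ` is meant to act on squares, so on the points of lines it acts
-- as multiplication by a square root of `ξ`, which exists because n is odd. The obstacle for the
-- symmetries is that a sixtuple has several generating pairs, and a symmetry coming back to a
-- sixtuple might bring back another pair. For odd Δ the number n = 2^Δ - 1 is prime to 6; with 3 ∤
-- Δ so is Δ itself. This is used in the form φ^(1 + 12k) = id, available because the square of a
-- number prime to 6 is 1 modulo 12. The constant 12 is the least common multiple of 2, 4, 6, the
-- doubles of the possible times 1, 2, 3 after which two iterates of an element of a sixtuple agree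
-- up to sign.

-- Lists without repetitions and finite sets.

module _ {A : Set} where

  ⊆-removal : ∀ {x : A} {xs} as bs → x ∉ xs → xs ⊆ as ++ x ∷ bs → xs ⊆ as ++ bs
  ⊆-removal {x} as bs x∉xs xs⊆ y∈xs with ∈-resp-↭ (shift x as bs) (xs⊆ y∈xs)
  ... | here refl = contradiction y∈xs x∉xs
  ... | there y∈  = y∈

  unique-⊆⇒length≤ : ∀ {xs ys : List A} → Unique xs → xs ⊆ ys → length xs ≤ length ys
  unique-⊆⇒length≤ []           _     = z≤n
  unique-⊆⇒length≤ {x ∷ xs} (x∉xs ∷ xs!) xs⊆ys with ∈-∃++ (xs⊆ys (here refl))
  ... | as , bs , refl = subst (suc (length xs) ≤_) (sym (↭-length (shift x as bs)))
    (s≤s (unique-⊆⇒length≤ xs! (⊆-removal as bs (All¬⇒¬Any x∉xs) (xs⊆ys ∘ there))))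

  -- A repeated entry of `ys` could be deleted without losing any of `xs`, leaving a list too short
  -- to contain them. This carries distinctness from one description of a sixtuple to every other
  -- pair generating the same set.
  unique-⊆⇒unique : DecidableEquality A → ∀ {xs ys : List A} →
                    Unique xs → xs ⊆ ys → length ys ≤ length xs → Unique ys
  unique-⊆⇒unique _≟_ {xs} {[]}     xs! xs⊆ys _     = []
  unique-⊆⇒unique _≟_ {xs} {y ∷ ys} xs! xs⊆ys ys<xs =
    ¬Any⇒All¬ ys y∉ys ∷ unique-⊆⇒unique _≟_ (Unique.filter⁺ y≢? xs!) rest⊆ys
      (ℕ.≤-pred (ℕ.≤-trans ys<xs (unique-⊆⇒length≤ xs! xs⊆y∷rest)))
    where
    y≢? : ∀ z → Dec (y ≢ z)
    y≢? z = ¬? (y ≟ z)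

    y∉ys : y ∉ ys
    y∉ys y∈ys = ℕ.<-irrefl refl (ℕ.≤-trans ys<xs (unique-⊆⇒length≤ xs! λ z∈xs → absorb (xs⊆ys z∈xs)))
      where
      absorb : ∀ {z} → z ∈ y ∷ ys → z ∈ ys
      absorb (here refl) = y∈ys
      absorb (there z∈)  = z∈

    rest⊆ys : filter y≢? xs ⊆ ys
    rest⊆ys z∈rest with ∈-filter⁻ y≢? {xs = xs} z∈rest
    ... | z∈xs , y≢z with xs⊆ys z∈xs
    ...   | here refl = contradiction refl y≢z
    ...   | there z∈  = z∈

    xs⊆y∷rest : xs ⊆ y ∷ filter y≢? xs
    xs⊆y∷rest {z} z∈xs with y ≟ z
    ... | yes refl = here refl
    ... | no y≢z   = there (∈-filter⁺ y≢? z∈xs y≢z)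

  length-concat-constant : ∀ {I : Set} (B : I → List A) k → (∀ i → length (B i) ≡ k) →
                           ∀ is → length (concat (map B is)) ≡ length is ℕ.* k
  length-concat-constant B k B≡k []       = refl
  length-concat-constant B k B≡k (i ∷ is) = trans (length-++ (B i))
    (cong₂ ℕ._+_ (B≡k i) (length-concat-constant B k B≡k is))

  allPairs-lookup : ∀ {R : A → A → Set} → (∀ {x y} → R x y → R y x) → ∀ {xs} → AllPairs R xs →
                    ∀ i j → i ≢ j → R (List.lookup xs i) (List.lookup xs j)
  allPairs-lookup _    (_ ∷ _)    zero    zero    0≢0 = contradiction refl 0≢0
  allPairs-lookup _    (xRs ∷ _)  zero    (suc j) _   = All.lookup xRs (∈-lookup j)
  allPairs-lookup symR (xRs ∷ _)  (suc i) zero    _   = symR (All.lookup xRs (∈-lookup i))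
  allPairs-lookup symR (_ ∷ Rxs)  (suc i) (suc j) i≢j = allPairs-lookup symR Rxs i j (i≢j ∘ cong suc)

  unique-lookup-injective : ∀ {xs : List A} → Unique xs → ∀ i j → List.lookup xs i ≡ List.lookup xs j →
      i ≡ j
  unique-lookup-injective xs! i j eq with i Fin.≟ j
  ... | yes i≡j = i≡j
  ... | no i≢j  = contradiction eq (allPairs-lookup (_∘ sym) xs! i j i≢j)

  -- Greedy selection: an index is kept if its block is disjoint from all blocks kept so far;
  -- otherwise its block equals one of them. It replaces a quotient by the relation of having the
  -- same block.
  disjointRepresentatives : {I : Set} (B : I → List A) →
    (∀ i j → Disjoint (B i) (B j) ⊎ (B i ⊆ B j × B j ⊆ B i)) →
    (is : List I) → ∃ λ reps →
      AllPairs (λ i j → Disjoint (B i) (B j)) reps ×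
      All (λ i → Any (λ j → B i ⊆ B j × B j ⊆ B i) reps) is
  disjointRepresentatives B compare []       = [] , [] , []
  disjointRepresentatives B compare (i ∷ is) with disjointRepresentatives B compare is
  ... | reps , disjoint , covered with All.decide (compare i) reps
  ...   | inj₁ new = i ∷ reps , new ∷ disjoint , here ((λ x → x) , λ x → x) ∷ All.map there covered
  ...   | inj₂ old = reps , disjoint , old ∷ covered

-- If `y` were missed, punching it out would inject `Fin (suc n)` into `Fin n`.
injective⇒surjective : ∀ {n} {f : Fin n → Fin n} → Injective _≡_ _≡_ f → ∀ y → ∃ λ x → f x ≡ y
injective⇒surjective {suc n} {f} inj y with Fin.any? (λ x → f x Fin.≟ y)
... | yes hit = hit
... | no miss = contradiction (Fin.injective⇒≤ punched-injective) ℕ.1+n≰n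
  where
  y≢f : ∀ x → y ≢ f x
  y≢f x y≡fx = miss (x , sym y≡fx)

  punched-injective : Injective _≡_ _≡_ (λ x → punchOut (y≢f x))
  punched-injective {i} {j} eq = inj (Fin.punchOut-injective (y≢f i) (y≢f j) eq)

-- punchIn for an n that is not known to be a successor.
others : ∀ {n} → Fin n → Fin (n ∸ 1) → Fin n
others {suc n} = punchIn

others≢ : ∀ {n} (i : Fin n) j → others i j ≢ i
others≢ {suc n} = Fin.punchInᵢ≢i

others-injective : ∀ {n} (i : Fin n) j k → others i j ≡ others i k → j ≡ k
others-injective {suc n} = Fin.punchIn-injective

others-surjective : ∀ {n} {i j : Fin n} → i ≢ j → ∃ λ k → others i k ≡ j
others-surjective {suc n} i≢j = punchOut i≢j , Fin.punchIn-punchOut i≢j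

module _ {m : ℕ} where

  -- The witness is pinned down as the head of a filtered list so that it depends only on the set of
  -- indices satisfying `P`. Equivalent predicates then give the same witness, as needed for a
  -- canonical point of an orbit.
  firstWitness : ∀ {P : Pred (Fin m) 0ℓ} (P? : Unary.Decidable P) → ∃ P →
                 ∃ λ i → P i × head (filter P? (allFin m)) ≡ just i
  firstWitness {P} P? (i , Pi) = go (filter P? (allFin m)) refl (∈-filter⁺ P? (∈-allFin i) Pi)
    where
    go : ∀ is → filter P? (allFin m) ≡ is → i ∈ is → ∃ λ i → P i × head is ≡ just i
    go (j ∷ is) eq _ = j , proj₂ (∈-filter⁻ P? {xs = allFin m} (subst (j ∈_) (sym eq) (here refl))) , refl

image-list : ∀ {A B : Set} (f : A → B) {xs ys} → map f xs ≡ ys → Image f (_∈ xs) ≐ (_∈ ys)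
image-list f refl = (λ { (x , x∈ , refl) → ∈-map⁺ f x∈ }) , λ y∈ → preimage (∈-map⁻ f y∈)
  where
  preimage : ∀ {xs y} → (∃ λ x → x ∈ xs × y ≡ f x) → Image f (_∈ xs) y
  preimage (x , x∈ , y≡) = x , x∈ , sym y≡

Image-cong : ∀ {A B : Set} (f : A → B) {P P′ : Pred A 0ℓ} {Q Q′ : Pred B 0ℓ} →
             P ≐ P′ → Q ≐ Q′ → Image f P ≐ Q → Image f P′ ≐ Q′
Image-cong f {P} {P′} (P⊆P′ , P′⊆P) (Q⊆Q′ , Q′⊆Q) (image⊆ , image⊇) =
  (λ { (x , x∈ , eq) → Q⊆Q′ (image⊆ (x , P′⊆P x∈ , eq)) }) , λ y∈ → weaken (image⊇ (Q′⊆Q y∈))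
  where
  weaken : ∀ {y} → Image f P y → Image f P′ y
  weaken (x , x∈ , eq) = x , P⊆P′ x∈ , eq

image-unique : ∀ {A B : Set} {f : A → B} {P : Pred A 0ℓ} {Q Q′ : Pred B 0ℓ} →
               Image f P ≐ Q → Image f P ≐ Q′ → Q ≐ Q′
image-unique (image⊆ , image⊇) (image⊆′ , image⊇′) =
    (λ u∈ → image⊆′ (image⊇ u∈)) , λ u∈ → image⊆ (image⊇′ u∈)

-- The ring ℤ₄, with axioms decided by enumeration.

ℤ₄-commutativeRing : CommutativeRing 0ℓ 0ℓ
ℤ₄-commutativeRing = record
  { RawRing (ℤ/ 4)
  ; isCommutativeRing = record
    { isRing = record
      { +-isAbelianGroup = record
        { isGroup = record
          { isMonoid = record
            { isSemigroup = record
              { isMagma = record { isEquivalence = isEquivalence ; ∙-cong = cong₂ _+_ }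
              ; assoc = toWitness {a? = all? λ a → all? λ b → all? λ c → ((a + b) + c) ≟ (a + (b + c))} _
              }
            ; identity = toWitness {a? = all? λ a → (0# + a) ≟ a} _
                       , toWitness {a? = all? λ a → (a + 0#) ≟ a} _
            }
          ; inverse = toWitness {a? = all? λ a → (- a + a) ≟ 0#} _
                    , toWitness {a? = all? λ a → (a + - a) ≟ 0#} _
          ; ⁻¹-cong = cong -_
          }
        ; comm = toWitness {a? = all? λ a → all? λ b → (a + b) ≟ (b + a)} _
        }
      ; *-cong = cong₂ _*_
      ; *-assoc = toWitness {a? = all? λ a → all? λ b → all? λ c → ((a * b) * c) ≟ (a * (b * c))} _
      ; *-identity = toWitness {a? = all? λ a → (1# * a) ≟ a} _
                   , toWitness {a? = all? λ a → (a * 1#) ≟ a} _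
      ; distrib = toWitness {a? = all? λ a → all? λ b → all? λ c → (a * (b + c)) ≟ (a * b + a * c)} _
                , toWitness {a? = all? λ a → all? λ b → all? λ c → ((b + c) * a) ≟ (b * a + c * a)} _
      }
    ; *-comm = toWitness {a? = all? λ a → all? λ b → (a * b) ≟ (b * a)} _
    }
  }
  where
  open RawRing (ℤ/ 4)
  _≟_ = Fin._≟_

private
  module ℤ₄ where
    open CommutativeRing ℤ₄-commutativeRing public hiding (_-_)
    open import Algebra.Properties.Ring ring public using (-‿+-comm; -‿distribʳ-*)
    open import Algebra.Properties.CommutativeSemigroup +-commutativeSemigroup public using (interchange)

-- The quotient of ℤ₄[x] by `h` as a commutative ring, and its reduction modulo 2.

module QuotientRing (Δ : ℕ) (h : Poly 4) where

  open Polynomial 4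
  open Quotient 4 Δ h
  open ≡-Reasoning
  open import Data.Vec.Base using (lookup)

  infixr 7 _•_
  _•_ : ℤ₄ → Column → Column
  a • v = Vec.map (a ℤ₄.*_) v

  neg : Column → Column
  neg = Vec.map ℤ₄.-_

  𝟎 𝟏 : Column
  𝟎 = rem []
  𝟏 = rem (ℤ₄.1# ∷ [])

  lookup-ext : {u v : Column} → (∀ i → lookup u i ≡ lookup v i) → u ≡ v
  lookup-ext {u} {v} eq =
    trans (sym (Vec.tabulate∘lookup u)) (trans (Vec.tabulate-cong eq) (Vec.tabulate∘lookup v))

  lookup-⊕ : ∀ u v i → lookup (u ⊕ v) i ≡ lookup u i ℤ₄.+ lookup v i
  lookup-⊕ u v i = Vec.lookup-zipWith ℤ₄._+_ i u v

  lookup-• : ∀ a v i → lookup (a • v) i ≡ a ℤ₄.* lookup v i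
  lookup-• a v i = Vec.lookup-map i (a ℤ₄.*_) v

  lookup-𝟎 : ∀ i → lookup 𝟎 i ≡ ℤ₄.0#
  lookup-𝟎 i = Vec.lookup-replicate i ℤ₄.0#

  ⊕-assoc : ∀ u v w → (u ⊕ v) ⊕ w ≡ u ⊕ (v ⊕ w)
  ⊕-assoc = Vec.zipWith-assoc ℤ₄.+-assoc

  ⊕-comm : ∀ u v → u ⊕ v ≡ v ⊕ u
  ⊕-comm = Vec.zipWith-comm ℤ₄.+-comm

  ⊕-identityˡ : ∀ v → 𝟎 ⊕ v ≡ v
  ⊕-identityˡ = Vec.zipWith-identityˡ ℤ₄.+-identityˡ

  ⊕-identityʳ : ∀ v → v ⊕ 𝟎 ≡ v
  ⊕-identityʳ = Vec.zipWith-identityʳ ℤ₄.+-identityʳ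

  ⊕-inverseˡ : ∀ v → neg v ⊕ v ≡ 𝟎
  ⊕-inverseˡ = Vec.zipWith-inverseˡ ℤ₄.-‿inverseˡ

  ⊕-inverseʳ : ∀ v → v ⊕ neg v ≡ 𝟎
  ⊕-inverseʳ = Vec.zipWith-inverseʳ ℤ₄.-‿inverseʳ

  ⊕-medial : ∀ s t u v → (s ⊕ t) ⊕ (u ⊕ v) ≡ (s ⊕ u) ⊕ (t ⊕ v)
  ⊕-medial s t u v = lookup-ext λ i → begin
    lookup ((s ⊕ t) ⊕ (u ⊕ v)) i
      ≡⟨ trans (lookup-⊕ (s ⊕ t) (u ⊕ v) i) (cong₂ ℤ₄._+_ (lookup-⊕ s t i) (lookup-⊕ u v i)) ⟩
    _
      ≡⟨ ℤ₄.interchange (lookup s i) (lookup t i) (lookup u i) (lookup v i) ⟩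
    _
      ≡⟨ trans (lookup-⊕ (s ⊕ u) (t ⊕ v) i) (cong₂ ℤ₄._+_ (lookup-⊕ s u i) (lookup-⊕ t v i)) ⟨
    lookup ((s ⊕ u) ⊕ (t ⊕ v)) i ∎

  •-⊕ : ∀ a u v → a • (u ⊕ v) ≡ a • u ⊕ a • v
  •-⊕ a u v = lookup-ext λ i → begin
    lookup (a • (u ⊕ v)) i
      ≡⟨ trans (lookup-• a (u ⊕ v) i) (cong (a ℤ₄.*_) (lookup-⊕ u v i)) ⟩
    _
      ≡⟨ ℤ₄.distribˡ a (lookup u i) (lookup v i) ⟩
    _
      ≡⟨ trans (lookup-⊕ (a • u) (a • v) i) (cong₂ ℤ₄._+_ (lookup-• a u i) (lookup-• a v i)) ⟨
    lookup (a • u ⊕ a • v) i ∎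

  +-• : ∀ a b v → (a ℤ₄.+ b) • v ≡ a • v ⊕ b • v
  +-• a b v = lookup-ext λ i → begin
    lookup ((a ℤ₄.+ b) • v) i
      ≡⟨ lookup-• (a ℤ₄.+ b) v i ⟩
    _
      ≡⟨ ℤ₄.distribʳ (lookup v i) a b ⟩
    _
      ≡⟨ trans (lookup-⊕ (a • v) (b • v) i) (cong₂ ℤ₄._+_ (lookup-• a v i) (lookup-• b v i)) ⟨
    lookup (a • v ⊕ b • v) i ∎

  *-• : ∀ a b v → (a ℤ₄.* b) • v ≡ a • b • v
  *-• a b v = lookup-ext λ i → begin
    lookup ((a ℤ₄.* b) • v) i  ≡⟨ lookup-• (a ℤ₄.* b) v i ⟩
    _  ≡⟨ ℤ₄.*-assoc a b (lookup v i) ⟩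
    _  ≡⟨ cong (a ℤ₄.*_) (lookup-• b v i) ⟨
    _                          ≡⟨ lookup-• a (b • v) i ⟨
    lookup (a • b • v) i  ∎

  •-swap : ∀ a b v → a • b • v ≡ b • a • v
  •-swap a b v = trans (sym (*-• a b v)) (trans (cong (_• v) (ℤ₄.*-comm a b)) (*-• b a v))

  0-• : ∀ v → ℤ₄.0# • v ≡ 𝟎
  0-• v = lookup-ext λ i →
    trans (lookup-• ℤ₄.0# v i) (trans (ℤ₄.zeroˡ (lookup v i)) (sym (lookup-𝟎 i)))

  1-• : ∀ v → ℤ₄.1# • v ≡ v
  1-• v = lookup-ext λ i → trans (lookup-• ℤ₄.1# v i) (ℤ₄.*-identityˡ (lookup v i))

  •-𝟎 : ∀ a → a • 𝟎 ≡ 𝟎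
  •-𝟎 a = lookup-ext λ i → begin
    lookup (a • 𝟎) i   ≡⟨ lookup-• a 𝟎 i ⟩
    a ℤ₄.* lookup 𝟎 i  ≡⟨ cong (a ℤ₄.*_) (lookup-𝟎 i) ⟩
    a ℤ₄.* ℤ₄.0#       ≡⟨ ℤ₄.zeroʳ a ⟩
    ℤ₄.0#              ≡⟨ lookup-𝟎 i ⟨
    lookup 𝟎 i  ∎

  coeff-⊕ : ∀ {d} (u v : Vec ℤ₄ d) k →
            coeff (toList (Vec.zipWith ℤ₄._+_ u v)) k ≡ coeff (toList u) k ℤ₄.+ coeff (toList v) k
  coeff-⊕ []      []      k         = refl
  coeff-⊕ (a ∷ u) (b ∷ v) zero    = refl
  coeff-⊕ (a ∷ u) (b ∷ v) (suc k) = coeff-⊕ u v k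

  coeff-• : ∀ {d} a (v : Vec ℤ₄ d) k →
            coeff (toList (Vec.map (a ℤ₄.*_) v)) k ≡ a ℤ₄.* coeff (toList v) k
  coeff-• a []      k         = sym (ℤ₄.zeroʳ a)
  coeff-• a (b ∷ v) zero    = refl
  coeff-• a (b ∷ v) (suc k) = coeff-• a v k

  coeff-toList : ∀ {d} (v : Vec ℤ₄ d) i → coeff (toList v) (toℕ i) ≡ lookup v i
  coeff-toList (a ∷ v) zero    = refl
  coeff-toList (a ∷ v) (suc i) = coeff-toList v i

  coeff-beyond : ∀ p {k} → length p ≤ k → coeff p k ≡ ℤ₄.0#
  coeff-beyond []      _         = refl
  coeff-beyond (a ∷ p) (s≤s p≤k) = coeff-beyond p p≤k

  -- Coefficients of x v(x) before reduction; the one at index Δ is the overflow that `x·_` cancels.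
  xCoeff : Column → ℕ → ℤ₄
  xCoeff v = coeff (ℤ₄.0# ∷ toList v)

  xCoeff-⊕ : ∀ u v k → xCoeff (u ⊕ v) k ≡ xCoeff u k ℤ₄.+ xCoeff v k
  xCoeff-⊕ u v zero    = refl
  xCoeff-⊕ u v (suc k) = coeff-⊕ u v k

  xCoeff-• : ∀ a v k → xCoeff (a • v) k ≡ a ℤ₄.* xCoeff v k
  xCoeff-• a v zero    = sym (ℤ₄.zeroʳ a)
  xCoeff-• a v (suc k) = coeff-• a v k

  lookup-x· : ∀ v i → lookup (x· v) i ≡
              xCoeff v (toℕ i) ℤ₄.+ (ℤ₄.- (xCoeff v Δ ℤ₄.* coeff h (toℕ i)))
  lookup-x· v i = Vec.lookup∘tabulate _ i

  x·-⊕ : ∀ u v → x· (u ⊕ v) ≡ (x· u) ⊕ (x· v)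
  x·-⊕ u v = lookup-ext λ i →
    let hᵢ = coeff h (toℕ i)
        s₁ = xCoeff u (toℕ i) ; s₂ = xCoeff v (toℕ i)
        t₁ = xCoeff u Δ       ; t₂ = xCoeff v Δ
    in begin
    lookup (x· (u ⊕ v)) i
      ≡⟨ lookup-x· (u ⊕ v) i ⟩
    xCoeff (u ⊕ v) (toℕ i) ℤ₄.+ (ℤ₄.- (xCoeff (u ⊕ v) Δ ℤ₄.* hᵢ))
      ≡⟨ cong₂ (λ s t → s ℤ₄.+ (ℤ₄.- (t ℤ₄.* hᵢ))) (xCoeff-⊕ u v (toℕ i)) (xCoeff-⊕ u v Δ) ⟩
    (s₁ ℤ₄.+ s₂) ℤ₄.+ (ℤ₄.- ((t₁ ℤ₄.+ t₂) ℤ₄.* hᵢ))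
      ≡⟨ cong (λ t → (s₁ ℤ₄.+ s₂) ℤ₄.+ (ℤ₄.- t)) (ℤ₄.distribʳ hᵢ t₁ t₂) ⟩
    (s₁ ℤ₄.+ s₂) ℤ₄.+ (ℤ₄.- (t₁ ℤ₄.* hᵢ ℤ₄.+ t₂ ℤ₄.* hᵢ))
      ≡⟨ cong ((s₁ ℤ₄.+ s₂) ℤ₄.+_) (ℤ₄.-‿+-comm (t₁ ℤ₄.* hᵢ) (t₂ ℤ₄.* hᵢ)) ⟨
    (s₁ ℤ₄.+ s₂) ℤ₄.+ (ℤ₄.- (t₁ ℤ₄.* hᵢ) ℤ₄.+ ℤ₄.- (t₂ ℤ₄.* hᵢ))
      ≡⟨ ℤ₄.interchange s₁ s₂ _ _ ⟩
    (s₁ ℤ₄.+ ℤ₄.- (t₁ ℤ₄.* hᵢ)) ℤ₄.+ (s₂ ℤ₄.+ ℤ₄.- (t₂ ℤ₄.* hᵢ))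
      ≡⟨ cong₂ ℤ₄._+_ (lookup-x· u i) (lookup-x· v i) ⟨
    lookup (x· u) i ℤ₄.+ lookup (x· v) i
      ≡⟨ lookup-⊕ (x· u) (x· v) i ⟨
    lookup ((x· u) ⊕ (x· v)) i ∎

  x·-• : ∀ a v → x· (a • v) ≡ a • (x· v)
  x·-• a v = lookup-ext λ i →
    let hᵢ = coeff h (toℕ i)
        s  = xCoeff v (toℕ i) ; t = xCoeff v Δ
    in begin
    lookup (x· (a • v)) i
      ≡⟨ lookup-x· (a • v) i ⟩
    xCoeff (a • v) (toℕ i) ℤ₄.+ (ℤ₄.- (xCoeff (a • v) Δ ℤ₄.* hᵢ))
      ≡⟨ cong₂ (λ s t → s ℤ₄.+ (ℤ₄.- (t ℤ₄.* hᵢ))) (xCoeff-• a v (toℕ i)) (xCoeff-• a v Δ) ⟩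
    a ℤ₄.* s ℤ₄.+ (ℤ₄.- ((a ℤ₄.* t) ℤ₄.* hᵢ))
      ≡⟨ cong (λ t → a ℤ₄.* s ℤ₄.+ (ℤ₄.- t)) (ℤ₄.*-assoc a t hᵢ) ⟩
    a ℤ₄.* s ℤ₄.+ (ℤ₄.- (a ℤ₄.* (t ℤ₄.* hᵢ)))
      ≡⟨ cong (a ℤ₄.* s ℤ₄.+_) (ℤ₄.-‿distribʳ-* a (t ℤ₄.* hᵢ)) ⟩
    a ℤ₄.* s ℤ₄.+ a ℤ₄.* (ℤ₄.- (t ℤ₄.* hᵢ))
      ≡⟨ ℤ₄.distribˡ a s _ ⟨
    a ℤ₄.* (s ℤ₄.+ (ℤ₄.- (t ℤ₄.* hᵢ)))
      ≡⟨ cong (a ℤ₄.*_) (lookup-x· v i) ⟨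
    a ℤ₄.* lookup (x· v) i
      ≡⟨ lookup-• a (x· v) i ⟨
    lookup (a • (x· v)) i ∎

  x·-𝟎 : x· 𝟎 ≡ 𝟎
  x·-𝟎 = begin
    x· 𝟎              ≡⟨ cong x·_ (0-• 𝟎) ⟨
    x· (ℤ₄.0# • 𝟎)    ≡⟨ x·-• ℤ₄.0# 𝟎 ⟩
    ℤ₄.0# • (x· 𝟎)    ≡⟨ 0-• (x· 𝟎) ⟩
    𝟎  ∎

  𝟏≡constant : 𝟏 ≡ constant ℤ₄.1#
  𝟏≡constant = trans (cong (constant ℤ₄.1# ⊕_) x·-𝟎) (⊕-identityʳ (constant ℤ₄.1#))

  constant≡• : ∀ a → constant a ≡ a • 𝟏
  constant≡• a = lookup-ext λ i → begin
    lookup (constant a) i  ≡⟨ Vec.lookup∘tabulate _ i ⟩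
    coeff (a ∷ []) (toℕ i)         ≡⟨ scale (toℕ i) ⟩
    a ℤ₄.* coeff (ℤ₄.1# ∷ []) (toℕ i)  ≡⟨ cong (a ℤ₄.*_) (Vec.lookup∘tabulate _ i) ⟨
    a ℤ₄.* lookup (constant ℤ₄.1#) i  ≡⟨ cong (λ v → a ℤ₄.* lookup v i) 𝟏≡constant ⟨
    a ℤ₄.* lookup 𝟏 i              ≡⟨ lookup-• a 𝟏 i ⟨
    lookup (a • 𝟏) i  ∎
    where
    scale : ∀ k → coeff (a ∷ []) k ≡ a ℤ₄.* coeff (ℤ₄.1# ∷ []) k
    scale zero    = sym (ℤ₄.*-identityʳ a)
    scale (suc k) = sym (ℤ₄.zeroʳ a)

  -- A polynomial acts on columns as a polynomial in the linear map x·_.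
  -- These actions commute, and this gives the ring axioms without any
  -- computation with ideals.
  act : Poly 4 → Column → Column
  act []      w = 𝟎
  act (a ∷ p) w = a • w ⊕ (x· act p w)

  rem≡act : ∀ p → rem p ≡ act p 𝟏
  rem≡act []      = refl
  rem≡act (a ∷ p) = cong₂ (λ u v → u ⊕ (x· v)) (constant≡• a) (rem≡act p)

  act-⊕ : ∀ p u v → act p (u ⊕ v) ≡ act p u ⊕ act p v
  act-⊕ []      u v = sym (⊕-identityˡ 𝟎)
  act-⊕ (a ∷ p) u v = begin
    a • (u ⊕ v) ⊕ (x· act p (u ⊕ v))
      ≡⟨ cong₂ _⊕_ (•-⊕ a u v) (trans (cong x·_ (act-⊕ p u v)) (x·-⊕ (act p u) (act p v))) ⟩
    (a • u ⊕ a • v) ⊕ ((x· act p u) ⊕ (x· act p v))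
      ≡⟨ ⊕-medial _ _ _ _ ⟩
    (a • u ⊕ (x· act p u)) ⊕ (a • v ⊕ (x· act p v)) ∎

  act-• : ∀ p a v → act p (a • v) ≡ a • act p v
  act-• []      a v = sym (•-𝟎 a)
  act-• (b ∷ p) a v = begin
    b • a • v ⊕ (x· act p (a • v))
      ≡⟨ cong₂ _⊕_ (•-swap b a v) (trans (cong x·_ (act-• p a v)) (x·-• a (act p v))) ⟩
    a • b • v ⊕ a • (x· act p v)
      ≡⟨ •-⊕ a (b • v) (x· act p v) ⟨
    a • (b • v ⊕ (x· act p v)) ∎

  act-x· : ∀ p v → act p (x· v) ≡ x· act p v
  act-x· []      v = sym x·-𝟎
  act-x· (a ∷ p) v = begin
    a • (x· v) ⊕ (x· act p (x· v))  ≡⟨ cong₂ _⊕_ (sym (x·-• a v)) (cong x·_ (act-x· p v)) ⟩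
    (x· (a • v)) ⊕ (x· (x· act p v))  ≡⟨ x·-⊕ (a • v) (x· act p v) ⟨
    x· (a • v ⊕ (x· act p v))  ∎

  act-𝟎 : ∀ p → act p 𝟎 ≡ 𝟎
  act-𝟎 p = begin
    act p 𝟎              ≡⟨ cong (act p) (0-• 𝟎) ⟨
    act p (ℤ₄.0# • 𝟎)    ≡⟨ act-• p ℤ₄.0# 𝟎 ⟩
    ℤ₄.0# • act p 𝟎      ≡⟨ 0-• (act p 𝟎) ⟩
    𝟎  ∎

  act-comm : ∀ p r v → act p (act r v) ≡ act r (act p v)
  act-comm []      r v = sym (act-𝟎 r)
  act-comm (a ∷ p) r v = begin
    a • act r v ⊕ (x· act p (act r v))
      ≡⟨ cong₂ _⊕_ (sym (act-• r a v)) (trans (cong x·_ (act-comm p r v)) (sym (act-x· r (act p v)))) ⟩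
    act r (a • v) ⊕ act r (x· act p v)
      ≡⟨ act-⊕ r (a • v) (x· act p v) ⟨
    act r (a • v ⊕ (x· act p v)) ∎

  act-addP : ∀ p r v → act (addP p r) v ≡ act p v ⊕ act r v
  act-addP []      r       v = sym (⊕-identityˡ (act r v))
  act-addP (a ∷ p) []      v = sym (⊕-identityʳ (act (a ∷ p) v))
  act-addP (a ∷ p) (b ∷ r) v = begin
    (a ℤ₄.+ b) • v ⊕ (x· act (addP p r) v)
      ≡⟨ cong₂ _⊕_ (+-• a b v) (trans (cong x·_ (act-addP p r v)) (x·-⊕ (act p v) (act r v))) ⟩
    (a • v ⊕ b • v) ⊕ ((x· act p v) ⊕ (x· act r v))
      ≡⟨ ⊕-medial _ _ _ _ ⟩
    (a • v ⊕ (x· act p v)) ⊕ (b • v ⊕ (x· act r v)) ∎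

  act-map : ∀ a p v → act (map (a ℤ₄.*_) p) v ≡ a • act p v
  act-map a []      v = sym (•-𝟎 a)
  act-map a (b ∷ p) v = begin
    (a ℤ₄.* b) • v ⊕ (x· act (map (a ℤ₄.*_) p) v)
      ≡⟨ cong₂ _⊕_ (*-• a b v) (trans (cong x·_ (act-map a p v)) (x·-• a (act p v))) ⟩
    a • b • v ⊕ a • (x· act p v)
      ≡⟨ •-⊕ a (b • v) (x· act p v) ⟨
    a • (b • v ⊕ (x· act p v)) ∎

  act-mulP : ∀ p r v → act (mulP p r) v ≡ act p (act r v)
  act-mulP []      r v = refl
  act-mulP (a ∷ p) r v = begin
    act (addP (map (a ℤ₄.*_) r) (ℤ₄.0# ∷ mulP p r)) v
      ≡⟨ act-addP (map (a ℤ₄.*_) r) _ v ⟩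
    act (map (a ℤ₄.*_) r) v ⊕ (ℤ₄.0# • v ⊕ (x· act (mulP p r) v))
      ≡⟨ cong₂ _⊕_ (act-map a r v) (trans (cong (_⊕ (x· act (mulP p r) v)) (0-• v)) (⊕-identityˡ _)) ⟩
    a • act r v ⊕ (x· act (mulP p r) v)
      ≡⟨ cong (λ w → a • act r v ⊕ (x· w)) (act-mulP p r v) ⟩
    a • act r v ⊕ (x· act p (act r v)) ∎

  -- With at most Δ coefficients Horner's scheme never overflows: by induction the intermediate
  -- remainder has coefficient 0 at index Δ - 1, so the multiple of `h` to be subtracted is zero.
  coeff-rem : ∀ p → length p ≤ Δ → ∀ k → coeff (toList (rem p)) k ≡ coeff p k
  coeff-rem p p≤Δ k with k ℕ.<? Δ
  ... | no k≮Δ = trans (coeff-beyond (toList (rem p))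
      (subst (_≤ k) (sym (Vec.length-toList (rem p))) (ℕ.≮⇒≥ k≮Δ)))
                       (sym (coeff-beyond p (ℕ.≤-trans p≤Δ (ℕ.≮⇒≥ k≮Δ))))
  ... | yes k<Δ = subst (λ k → coeff (toList (rem p)) k ≡ coeff p k) (Fin.toℕ-fromℕ< k<Δ)
                    (trans (coeff-toList (rem p) (fromℕ< k<Δ)) (at p p≤Δ (fromℕ< k<Δ)))
    where
    at : ∀ p → length p ≤ Δ → ∀ i → lookup (rem p) i ≡ coeff p (toℕ i)
    at []      _   i = lookup-𝟎 i
    at (a ∷ p) p<Δ i = begin
      lookup (constant a ⊕ (x· rem p)) i
        ≡⟨ lookup-⊕ (constant a) (x· rem p) i ⟩
      lookup (constant a) i ℤ₄.+ lookup (x· rem p) i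
        ≡⟨ cong₂ ℤ₄._+_ (Vec.lookup∘tabulate _ i) (lookup-x· (rem p) i) ⟩
      coeff (a ∷ []) (toℕ i) ℤ₄.+
          (xCoeff (rem p) (toℕ i) ℤ₄.+ (ℤ₄.- (xCoeff (rem p) Δ ℤ₄.* coeff h (toℕ i))))
        ≡⟨ cong (λ t → coeff (a ∷ []) (toℕ i) ℤ₄.+ (xCoeff (rem p) (toℕ i) ℤ₄.+ (ℤ₄.- t))) top ⟩
      coeff (a ∷ []) (toℕ i) ℤ₄.+ (xCoeff (rem p) (toℕ i) ℤ₄.+ ℤ₄.0#)
        ≡⟨ cong (coeff (a ∷ []) (toℕ i) ℤ₄.+_) (ℤ₄.+-identityʳ _) ⟩
      coeff (a ∷ []) (toℕ i) ℤ₄.+ xCoeff (rem p) (toℕ i)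
        ≡⟨ low (toℕ i) ⟩
      coeff (a ∷ p) (toℕ i) ∎
      where
      ih : ∀ k → coeff (toList (rem p)) k ≡ coeff p k
      ih = coeff-rem p (ℕ.<⇒≤ p<Δ)

      xCoeff-top : ∀ d → length p < d → xCoeff (rem p) d ≡ ℤ₄.0#
      xCoeff-top (suc d) (s≤s p≤d) = trans (ih d) (coeff-beyond p p≤d)

      top : xCoeff (rem p) Δ ℤ₄.* coeff h (toℕ i) ≡ ℤ₄.0#
      top = trans (cong (ℤ₄._* coeff h (toℕ i)) (xCoeff-top Δ p<Δ)) (ℤ₄.zeroˡ (coeff h (toℕ i)))

      low : ∀ k → coeff (a ∷ []) k ℤ₄.+ xCoeff (rem p) k ≡ coeff (a ∷ p) k
      low zero    = ℤ₄.+-identityʳ a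
      low (suc k) = trans (ℤ₄.+-identityˡ _) (ih k)

  rem-toList : ∀ v → rem (toList v) ≡ v
  rem-toList v = lookup-ext λ i → begin
    lookup (rem (toList v)) i  ≡⟨ coeff-toList (rem (toList v)) i ⟨
    coeff (toList (rem (toList v))) (toℕ i)
      ≡⟨ coeff-rem (toList v) (ℕ.≤-reflexive (Vec.length-toList v)) (toℕ i) ⟩
    coeff (toList v) (toℕ i)  ≡⟨ coeff-toList v i ⟩
    lookup v i  ∎

  infixl 7 _⊛_
  _⊛_ : Column → Column → Column
  u ⊛ v = rem (mulP (toList u) (toList v))

  -- The left factor becomes an operator and the right factor an ordinary column, so that laws of
  -- the product turn into laws of commuting operators.
  ⊛≡act : ∀ u v → u ⊛ v ≡ act (toList u) v
  ⊛≡act u v = begin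
    rem (mulP (toList u) (toList v))  ≡⟨ rem≡act (mulP (toList u) (toList v)) ⟩
    act (mulP (toList u) (toList v)) 𝟏  ≡⟨ act-mulP (toList u) (toList v) 𝟏 ⟩
    act (toList u) (act (toList v) 𝟏)  ≡⟨ cong (act (toList u)) (rem≡act (toList v)) ⟨
    act (toList u) (rem (toList v))  ≡⟨ cong (act (toList u)) (rem-toList v) ⟩
    act (toList u) v  ∎

  act-𝟏 : ∀ v → act (toList v) 𝟏 ≡ v
  act-𝟏 v = trans (sym (rem≡act (toList v))) (rem-toList v)

  ⊛-comm : ∀ u v → u ⊛ v ≡ v ⊛ u
  ⊛-comm u v = begin
    u ⊛ v                                ≡⟨ ⊛≡act u v ⟩
    act (toList u) v  ≡⟨ cong (act (toList u)) (act-𝟏 v) ⟨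
    act (toList u) (act (toList v) 𝟏)  ≡⟨ act-comm (toList u) (toList v) 𝟏 ⟩
    act (toList v) (act (toList u) 𝟏)  ≡⟨ cong (act (toList v)) (act-𝟏 u) ⟩
    act (toList v) u                     ≡⟨ ⊛≡act v u ⟨
    v ⊛ u  ∎

  -- Moving `w` to the left makes both sides the actions of `u` and `w` on `v`, in the two possible
  -- orders.
  ⊛-assoc : ∀ u v w → (u ⊛ v) ⊛ w ≡ u ⊛ (v ⊛ w)
  ⊛-assoc u v w = begin
    (u ⊛ v) ⊛ w                          ≡⟨ ⊛-comm (u ⊛ v) w ⟩
    w ⊛ (u ⊛ v)                          ≡⟨ ⊛≡act w (u ⊛ v) ⟩
    act (toList w) (u ⊛ v)  ≡⟨ cong (act (toList w)) (⊛≡act u v) ⟩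
    act (toList w) (act (toList u) v)  ≡⟨ act-comm (toList w) (toList u) v ⟩
    act (toList u) (act (toList w) v)  ≡⟨ cong (act (toList u)) (⊛≡act w v) ⟨
    act (toList u) (w ⊛ v)               ≡⟨ ⊛≡act u (w ⊛ v) ⟨
    u ⊛ (w ⊛ v)  ≡⟨ cong (u ⊛_) (⊛-comm w v) ⟩
    u ⊛ (v ⊛ w)  ∎

  ⊛-distribˡ : ∀ u v w → u ⊛ (v ⊕ w) ≡ (u ⊛ v) ⊕ (u ⊛ w)
  ⊛-distribˡ u v w = begin
    u ⊛ (v ⊕ w)                          ≡⟨ ⊛≡act u (v ⊕ w) ⟩
    act (toList u) (v ⊕ w)  ≡⟨ act-⊕ (toList u) v w ⟩
    act (toList u) v ⊕ act (toList u) w  ≡⟨ cong₂ _⊕_ (⊛≡act u v) (⊛≡act u w) ⟨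
    (u ⊛ v) ⊕ (u ⊛ w)  ∎

  ⊛-distribʳ : ∀ u v w → (v ⊕ w) ⊛ u ≡ (v ⊛ u) ⊕ (w ⊛ u)
  ⊛-distribʳ u v w = begin
    (v ⊕ w) ⊛ u        ≡⟨ ⊛-comm (v ⊕ w) u ⟩
    u ⊛ (v ⊕ w)        ≡⟨ ⊛-distribˡ u v w ⟩
    (u ⊛ v) ⊕ (u ⊛ w)  ≡⟨ cong₂ _⊕_ (⊛-comm u v) (⊛-comm u w) ⟩
    (v ⊛ u) ⊕ (w ⊛ u)  ∎

  ⊛-identityʳ : ∀ v → v ⊛ 𝟏 ≡ v
  ⊛-identityʳ v = trans (⊛≡act v 𝟏) (act-𝟏 v)

  ⊛-identityˡ : ∀ v → 𝟏 ⊛ v ≡ v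
  ⊛-identityˡ v = trans (⊛-comm 𝟏 v) (⊛-identityʳ v)

  commutativeRing : CommutativeRing 0ℓ 0ℓ
  commutativeRing = record
    { RawRing quotientRing
    ; isCommutativeRing = record
      { isRing = record
        { +-isAbelianGroup = record
          { isGroup = record
            { isMonoid = record
              { isSemigroup = record
                { isMagma = record { isEquivalence = isEquivalence ; ∙-cong = cong₂ _⊕_ }
                ; assoc = ⊕-assoc
                }
              ; identity = ⊕-identityˡ , ⊕-identityʳ
              }
            ; inverse = ⊕-inverseˡ , ⊕-inverseʳ
            ; ⁻¹-cong = cong neg
            }
          ; comm = ⊕-comm
          }
        ; *-cong = cong₂ _⊛_
        ; *-assoc = ⊛-assoc
        ; *-identity = ⊛-identityˡ , ⊛-identityʳ
        ; distrib = ⊛-distribˡ , ⊛-distribʳ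
        }
      ; *-comm = ⊛-comm
      }
    }

  open RawSemiringDefinitions (RawRing.rawSemiring quotientRing) using () renaming (_×_ to _·_)

  -- Scalars from ℤ₄ become repeated addition, a notion available in any ring, which is how the
  -- later abstract modules express them.
  •≡· : ∀ a v → a • v ≡ toℕ a · v
  •≡· a v = go a
    where
    one : 1F • v ≡ 1 · v
    one = trans (1-• v) (sym (⊕-identityʳ v))

    two : 2F • v ≡ 2 · v
    two = trans (+-• 1F 1F v) (cong₂ _⊕_ (1-• v) one)

    go : ∀ a → a • v ≡ toℕ a · v
    go 0F = 0-• v
    go 1F = one
    go 2F = two
    go 3F = trans (+-• 1F 2F v) (cong₂ _⊕_ (1-• v) two)

  4·≡𝟎 : ∀ v → 4 · v ≡ 𝟎
  4·≡𝟎 v = begin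
    v ⊕ (3 · v)      ≡⟨ cong₂ _⊕_ (1-• v) (•≡· 3F v) ⟨
    1F • v ⊕ 3F • v  ≡⟨ +-• 1F 3F v ⟨
    0F • v           ≡⟨ 0-• v ⟩
    𝟎  ∎

  ξ⊛ : ∀ v → ξ ⊛ v ≡ x· v
  ξ⊛ v = begin
    ξ ⊛ v                      ≡⟨ ⊛-comm ξ v ⟩
    v ⊛ ξ                      ≡⟨ ⊛≡act v ξ ⟩
    act (toList v) ξ  ≡⟨ cong (act (toList v)) (rem≡act X) ⟩
    act (toList v) (act X 𝟏)   ≡⟨ act-comm (toList v) X 𝟏 ⟩
    act X (act (toList v) 𝟏)   ≡⟨ cong (act X) (act-𝟏 v) ⟩
    act X v  ≡⟨ cong (_⊕ (x· (1F • v ⊕ (x· 𝟎)))) (0-• v) ⟩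
    𝟎 ⊕ (x· (1F • v ⊕ (x· 𝟎)))  ≡⟨ ⊕-identityˡ _ ⟩
    x· (1F • v ⊕ (x· 𝟎))  ≡⟨ cong x·_ (cong₂ _⊕_ (1-• v) x·-𝟎) ⟩
    x· (v ⊕ 𝟎)                 ≡⟨ cong x·_ (⊕-identityʳ v) ⟩
    x· v  ∎
    where
    X : Poly 4
    X = 0F ∷ 1F ∷ []

  -- Coordinatewise: in ℤ₄ only 0 and 2 double to 0, and these are the doubles of 0 and 1.
  halve : ∀ v → v ⊕ v ≡ 𝟎 → ∃ λ w → v ≡ w ⊕ w
  halve v 2v≡𝟎 = Vec.map half v , lookup-ext λ i → begin
    lookup v i  ≡⟨ half-double (lookup v i) (2vᵢ≡0 i) ⟩
    half (lookup v i) ℤ₄.+ half (lookup v i)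
      ≡⟨ cong₂ ℤ₄._+_ (Vec.lookup-map i half v) (Vec.lookup-map i half v) ⟨
    lookup (Vec.map half v) i ℤ₄.+ lookup (Vec.map half v) i
      ≡⟨ lookup-⊕ (Vec.map half v) (Vec.map half v) i ⟨
    lookup (Vec.map half v ⊕ Vec.map half v) i  ∎
    where
    half : ℤ₄ → ℤ₄
    half 2F = 1F
    half _  = 0F

    half-double : ∀ a → a ℤ₄.+ a ≡ ℤ₄.0# → a ≡ half a ℤ₄.+ half a
    half-double 0F _  = refl
    half-double 1F ()
    half-double 2F _  = refl
    half-double 3F ()

    2vᵢ≡0 : ∀ i → lookup v i ℤ₄.+ lookup v i ≡ ℤ₄.0#
    2vᵢ≡0 i = trans (sym (lookup-⊕ v v i)) (trans (cong (λ u → lookup u i) 2v≡𝟎) (lookup-𝟎 i))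

  -- Read off at the constant coordinate, which exists because Δ is positive: there the sum is 2 in
  -- ℤ₄.
  2·𝟏≢𝟎 : 0 < Δ → 𝟏 ⊕ 𝟏 ≢ 𝟎
  2·𝟏≢𝟎 0<Δ eq = contradiction {A = 2F ≡ 0F} (begin
    2F  ≡⟨ cong (λ a → a ℤ₄.+ a) leading ⟨
    lookup 𝟏 i ℤ₄.+ lookup 𝟏 i   ≡⟨ lookup-⊕ 𝟏 𝟏 i ⟨
    lookup (𝟏 ⊕ 𝟏) i  ≡⟨ cong (λ v → lookup v i) eq ⟩
    lookup 𝟎 i                   ≡⟨ lookup-𝟎 i ⟩
    0F  ∎) (λ ())
    where
    i : Fin Δ
    i = fromℕ< 0<Δ

    leading : lookup 𝟏 i ≡ 1F
    leading = begin
      lookup 𝟏 i  ≡⟨ cong (λ v → lookup v i) 𝟏≡constant ⟩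
      lookup (constant 1F) i  ≡⟨ Vec.lookup∘tabulate _ i ⟩
      coeff (1F ∷ []) (toℕ i)  ≡⟨ cong (coeff (1F ∷ [])) (Fin.toℕ-fromℕ< 0<Δ) ⟩
      1F  ∎

  residue : Column → Fin (2 ℕ.^ Δ)
  residue v = Fin.funToFin λ i → toℕ (lookup v i) mod 2

  residue-injective : ∀ {u v} → residue u ≡ residue v → u ⊕ u ≡ v ⊕ v
  residue-injective {u} {v} eq = lookup-ext λ i → begin
    lookup (u ⊕ u) i              ≡⟨ lookup-⊕ u u i ⟩
    lookup u i ℤ₄.+ lookup u i  ≡⟨ double (lookup u i) (lookup v i) (bits i) ⟩
    lookup v i ℤ₄.+ lookup v i    ≡⟨ lookup-⊕ v v i ⟨
    lookup (v ⊕ v) i  ∎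
    where
    double : ∀ a b → toℕ a mod 2 ≡ toℕ b mod 2 → a ℤ₄.+ a ≡ b ℤ₄.+ b
    double = toWitness {a? = all? λ a → all? λ b →
      ((toℕ a mod 2) Fin.≟ (toℕ b mod 2)) →-dec ((a ℤ₄.+ a) Fin.≟ (b ℤ₄.+ b))} _

    bits : ∀ i → toℕ (lookup u i) mod 2 ≡ toℕ (lookup v i) mod 2
    bits i = begin
      toℕ (lookup u i) mod 2  ≡⟨ Fin.finToFun-funToFin _ i ⟨
      Fin.finToFun (residue u) i  ≡⟨ cong (λ k → Fin.finToFun k i) eq ⟩
      Fin.finToFun (residue v) i  ≡⟨ Fin.finToFun-funToFin _ i ⟩
      toℕ (lookup v i) mod 2  ∎

-- What is used of GR(4^Δ), with n = 2^Δ − 1 and q = 2^(Δ − 1): residue shows that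
-- there are at most n + 1 classes modulo 2.
record GaloisRing (n q : ℕ) : Set₁ where
  infixl 6 _+_
  infixl 7 _*_
  infix  8 -_
  field
    R       : Set
    _+_ _*_ : R → R → R
    -_      : R → R
    0# 1#   : R

  rawRing : RawRing 0ℓ 0ℓ
  rawRing = record
    { Carrier = R ; _≈_ = _≡_ ; _+_ = _+_ ; _*_ = _*_ ; -_ = -_ ; 0# = 0# ; 1# = 1# }

  open RawSemiringDefinitions (RawRing.rawSemiring rawRing) public
    using (_^_) renaming (_×_ to _·_)

  field
    isCommutativeRing : IsCommutativeRing _≡_ _+_ _*_ -_ 0# 1#
    _≟_               : DecidableEquality R
    4·≡0              : ∀ x → 4 · x ≡ 0#
    2·1≢0             : 1# + 1# ≢ 0#
    halve             : ∀ x → x + x ≡ 0# → ∃ λ y → x ≡ y + y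
    residue           : R → Fin (suc n)
    residue-injective : ∀ {x y} → residue x ≡ residue y → x + x ≡ y + y
    ξ                 : R
    0<n               : 0 < n
    ξ^n≡1             : ξ ^ n ≡ 1#
    ξ-minimal         : ∀ k → 0 < k → k < n → ξ ^ k ≢ 1#
    1+n≡q+q           : suc n ≡ q ℕ.+ q

-- Congruence modulo 2, powers of `ξ` and square roots.

module GaloisRingTheory {n q : ℕ} (G : GaloisRing n q) where

  open GaloisRing G public

  commutativeRing : CommutativeRing 0ℓ 0ℓ
  commutativeRing = record { isCommutativeRing = isCommutativeRing }

  open CommutativeRing commutativeRing public
    using (+-assoc; +-comm; +-identityˡ; +-identityʳ; -‿inverseˡ; -‿inverseʳ; +-abelianGroup; +-group;
           *-assoc; *-comm; *-identityˡ; *-identityʳ; distribˡ; distribʳ; zeroˡ; zeroʳ;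
           commutativeSemiring; ring; *-commutativeSemigroup)
  open CommutativeSemigroupProperties *-commutativeSemigroup public using ()
    renaming (interchange to *-interchange)
  open AbelianGroupProperties +-abelianGroup public using () renaming (⁻¹-∙-comm to -‿+-comm)
  open RingProperties ring public using (-‿distribˡ-*)
  open GroupProperties +-group public using () renaming
    (⁻¹-involutive to -‿involutive; inverseʳ-unique to -‿unique; ∙-cancelˡ to +-cancelˡ;
     ∙-cancelʳ to +-cancelʳ)
  open ExpProperties commutativeSemiring public using (^-homo-*; ^-assocʳ; ^-distrib-*)
  open Solver commutativeSemiring public using (solve; _:=_; _:+_; _:*_)
  open ≡-Reasoning

  -- Congruence modulo 2, as 2R is exactly the kernel of doubling.
  infix 4 _≋_ _≋̸_
  _≋_ _≋̸_ : R → R → Set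
  x ≋ y = x + x ≡ y + y
  x ≋̸ y = ¬ (x ≋ y)

  Unit₂ : R → Set
  Unit₂ x = x + x ≢ 0#

  0+0≡0 : 0# + 0# ≡ 0#
  0+0≡0 = +-identityˡ 0#

  quadruple≡0 : ∀ x → (x + x) + (x + x) ≡ 0#
  quadruple≡0 x = begin
    (x + x) + (x + x)          ≡⟨ +-assoc x x (x + x) ⟩
    x + (x + (x + x))  ≡⟨ cong (λ y → x + (x + (x + y))) (+-identityʳ x) ⟨
    4 · x                      ≡⟨ 4·≡0 x ⟩
    0#  ∎

  -- In characteristic 4 negation is multiplication by 3; this brings signs within reach of a solver
  -- for commutative semirings.
  -‿≡triple : ∀ x → - x ≡ x + (x + x)
  -‿≡triple x = sym (-‿unique x (x + (x + x)) (trans (sym (+-assoc x x (x + x))) (quadruple≡0 x)))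

  -‿≋ : ∀ x → - x ≋ x
  -‿≋ x = begin
    - x + - x  ≡⟨ cong₂ _+_ (-‿≡triple x) (-‿≡triple x) ⟩
    (x + (x + x)) + (x + (x + x))
      ≡⟨ solve 1 (λ x → (x :+ (x :+ x)) :+ (x :+ (x :+ x)) := (x :+ x) :+ ((x :+ x) :+ (x :+ x))) refl x ⟩
    (x + x) + ((x + x) + (x + x))  ≡⟨ cong ((x + x) +_) (quadruple≡0 x) ⟩
    (x + x) + 0#  ≡⟨ +-identityʳ (x + x) ⟩
    x + x  ∎

  ≋⇒+double : ∀ {x y} → x ≋ y → ∃ λ z → x ≡ y + (z + z)
  ≋⇒+double {x} {y} x≋y with halve (x + - y) doubled
    where
    doubled : (x + - y) + (x + - y) ≡ 0#
    doubled = begin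
      (x + - y) + (x + - y)
        ≡⟨ solve 2 (λ x y → (x :+ y) :+ (x :+ y) := (x :+ x) :+ (y :+ y)) refl x (- y) ⟩
      (x + x) + (- y + - y)    ≡⟨ cong₂ _+_ x≋y (-‿≋ y) ⟩
      (y + y) + (y + y)        ≡⟨ quadruple≡0 y ⟩
      0#  ∎
  ... | z , x-y≡2z = z , (begin
    x                  ≡⟨ +-identityʳ x ⟨
    x + 0#             ≡⟨ cong (x +_) (-‿inverseˡ y) ⟨
    x + (- y + y)      ≡⟨ +-assoc x (- y) y ⟨
    (x + - y) + y      ≡⟨ cong (_+ y) x-y≡2z ⟩
    (z + z) + y        ≡⟨ +-comm (z + z) y ⟩
    y + (z + z)  ∎)

  +double-≋ : ∀ x z → x + (z + z) ≋ x
  +double-≋ x z = begin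
    (x + (z + z)) + (x + (z + z))
      ≡⟨ solve 2 (λ x z → (x :+ (z :+ z)) :+ (x :+ (z :+ z)) := (x :+ x) :+ ((z :+ z) :+ (z :+ z)))
          refl x z ⟩
    (x + x) + ((z + z) + (z + z))  ≡⟨ cong ((x + x) +_) (quadruple≡0 z) ⟩
    (x + x) + 0#                   ≡⟨ +-identityʳ (x + x) ⟩
    x + x  ∎

  +-cong-≋ : ∀ {x x′ y y′} → x ≋ x′ → y ≋ y′ → x + y ≋ x′ + y′
  +-cong-≋ {x} {x′} {y} {y′} x≋ y≋ = begin
    (x + y) + (x + y)          ≡⟨ regroup x y ⟩
    (x + x) + (y + y)          ≡⟨ cong₂ _+_ x≋ y≋ ⟩
    (x′ + x′) + (y′ + y′)      ≡⟨ regroup x′ y′ ⟨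
    (x′ + y′) + (x′ + y′)  ∎
    where
    regroup : ∀ x y → (x + y) + (x + y) ≡ (x + x) + (y + y)
    regroup = solve 2 (λ x y → (x :+ y) :+ (x :+ y) := (x :+ x) :+ (y :+ y)) refl

  double-* : ∀ x y → x * y + x * y ≡ (x + x) * y
  double-* x y = sym (distribʳ y x x)

  *-congʳ-≋ : ∀ {x x′} y → x ≋ x′ → x * y ≋ x′ * y
  *-congʳ-≋ {x} {x′} y x≋ = begin
    x * y + x * y      ≡⟨ double-* x y ⟩
    (x + x) * y        ≡⟨ cong (_* y) x≋ ⟩
    (x′ + x′) * y      ≡⟨ double-* x′ y ⟨
    x′ * y + x′ * y  ∎

  *-cong-≋ : ∀ {x x′ y y′} → x ≋ x′ → y ≋ y′ → x * y ≋ x′ * y′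
  *-cong-≋ {x} {x′} {y} {y′} x≋ y≋ = trans (*-congʳ-≋ y x≋)
    (trans (cong (λ z → z + z) (*-comm x′ y))
      (trans (*-congʳ-≋ x′ y≋) (cong (λ z → z + z) (*-comm y′ x′))))

  double*double≡0 : ∀ x y → (x + x) * (y + y) ≡ 0#
  double*double≡0 x y = trans
    (solve 2 (λ x y → (x :+ x) :* (y :+ y) := (x :* y :+ x :* y) :+ (x :* y :+ x :* y)) refl x y)
    (quadruple≡0 (x * y))

  square-+ : ∀ x y → (x + y) * (x + y) ≡ x * x + ((x + x) + y) * y
  square-+ x y = begin
    (x + y) * (x + y)  ≡⟨ distribʳ (x + y) x y ⟩
    x * (x + y) + y * (x + y)  ≡⟨ cong₂ _+_ (distribˡ x x y) (*-comm y (x + y)) ⟩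
    x * x + x * y + (x + y) * y  ≡⟨ +-assoc (x * x) (x * y) ((x + y) * y) ⟩
    x * x + (x * y + (x + y) * y)  ≡⟨ cong (x * x +_) (distribʳ y x (x + y)) ⟨
    x * x + (x + (x + y)) * y  ≡⟨ cong (λ z → x * x + z * y) (+-assoc x x y) ⟨
    x * x + ((x + x) + y) * y  ∎

  -- For x = y + 2z the difference of the squares is (2y + 2z) · 2z, a multiple of 4.
  square-≋ : ∀ {x y} → x ≋ y → x * x ≡ y * y
  square-≋ {x} {y} x≋y = squared (≋⇒+double {x} {y} x≋y)
    where
    squared : (∃ λ z → x ≡ y + (z + z)) → x * x ≡ y * y
    squared (z , refl) = begin
      (y + (z + z)) * (y + (z + z))  ≡⟨ square-+ y (z + z) ⟩
      y * y + ((y + y) + (z + z)) * (z + z)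
        ≡⟨ cong (λ u → y * y + u * (z + z))
            (solve 2 (λ y z → (y :+ y) :+ (z :+ z) := (y :+ z) :+ (y :+ z)) refl y z) ⟩
      y * y + ((y + z) + (y + z)) * (z + z)  ≡⟨ cong (y * y +_) (double*double≡0 (y + z) z) ⟩
      y * y + 0#  ≡⟨ +-identityʳ (y * y) ⟩
      y * y  ∎

  1^ : ∀ k → 1# ^ k ≡ 1#
  1^ zero    = refl
  1^ (suc k) = trans (*-identityˡ (1# ^ k)) (1^ k)

  ξ^-* : ∀ k → ξ ^ (k ℕ.* n) ≡ 1#
  ξ^-* k = begin
    ξ ^ (k ℕ.* n)  ≡⟨ cong (ξ ^_) (ℕ.*-comm k n) ⟩
    ξ ^ (n ℕ.* k)  ≡⟨ ^-assocʳ ξ n k ⟨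
    (ξ ^ n) ^ k    ≡⟨ cong (_^ k) ξ^n≡1 ⟩
    1# ^ k         ≡⟨ 1^ k ⟩
    1#  ∎

  instance
    n-nonZero : ℕ.NonZero n
    n-nonZero = ℕ.>-nonZero 0<n

  ξ^-% : ∀ k → ξ ^ k ≡ ξ ^ (k % n)
  ξ^-% k = begin
    ξ ^ k  ≡⟨ cong (ξ ^_) (m≡m%n+[m/n]*n k n) ⟩
    ξ ^ (k % n ℕ.+ k / n ℕ.* n)  ≡⟨ ^-homo-* ξ (k % n) (k / n ℕ.* n) ⟩
    ξ ^ (k % n) * ξ ^ (k / n ℕ.* n)  ≡⟨ cong (ξ ^ (k % n) *_) (ξ^-* (k / n)) ⟩
    ξ ^ (k % n) * 1#  ≡⟨ *-identityʳ (ξ ^ (k % n)) ⟩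
    ξ ^ (k % n)  ∎

  power : Fin n → R
  power i = ξ ^ toℕ i

  ξ^-power : ∀ k → ∃ λ i → ξ ^ k ≡ power i
  ξ^-power k = Fin.fromℕ< (m%n<n k n) ,
    trans (ξ^-% k) (cong (ξ ^_) (sym (Fin.toℕ-fromℕ< (m%n<n k n))))

  ξ^-inverse : ∀ k → ∃ λ y → ξ ^ k * y ≡ 1#
  ξ^-inverse k = ξ ^ (k ℕ.* (n ∸ 1)) , (begin
    ξ ^ k * ξ ^ (k ℕ.* (n ∸ 1))  ≡⟨ ^-homo-* ξ k (k ℕ.* (n ∸ 1)) ⟨
    ξ ^ (k ℕ.+ k ℕ.* (n ∸ 1))  ≡⟨ cong (ξ ^_) (ℕ.*-suc k (n ∸ 1)) ⟨
    ξ ^ (k ℕ.* (1 ℕ.+ (n ∸ 1)))  ≡⟨ cong (λ l → ξ ^ (k ℕ.* l)) (ℕ.m+[n∸m]≡n 0<n) ⟩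
    ξ ^ (k ℕ.* n)                  ≡⟨ ξ^-* k ⟩
    1#  ∎)

  ξ^-cancel : ∀ k {x y} → ξ ^ k * x ≡ ξ ^ k * y → x ≡ y
  ξ^-cancel k {x} {y} eq with ξ^-inverse k
  ... | v , inverse = trans (sym (undo x)) (trans (cong (v *_) eq) (undo y))
    where
    undo : ∀ z → v * (ξ ^ k * z) ≡ z
    undo z = begin
      v * (ξ ^ k * z)  ≡⟨ *-assoc v (ξ ^ k) z ⟨
      (v * ξ ^ k) * z  ≡⟨ cong (_* z) (trans (*-comm v (ξ ^ k)) inverse) ⟩
      1# * z           ≡⟨ *-identityˡ z ⟩
      z  ∎

  ξ^-unit : ∀ k → Unit₂ (ξ ^ k)
  ξ^-unit k 2ξ^k≡0 with ξ^-inverse k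
  ... | v , inverse = 2·1≢0 (begin
    1# + 1#  ≡⟨ cong (λ z → z + z) inverse ⟨
    ξ ^ k * v + ξ ^ k * v        ≡⟨ double-* (ξ ^ k) v ⟩
    (ξ ^ k + ξ ^ k) * v          ≡⟨ cong (_* v) 2ξ^k≡0 ⟩
    0# * v                       ≡⟨ zeroˡ v ⟩
    0#  ∎)

  ξ^-distinct : ∀ {k l} → k < l → l < n → ξ ^ k ≢ ξ ^ l
  ξ^-distinct {k} {l} k<l l<n eq = ξ-minimal (l ∸ k) (ℕ.m<n⇒0<n∸m k<l) (ℕ.≤-<-trans (ℕ.m∸n≤m l k) l<n)
    (sym (ξ^-cancel k (begin
      ξ ^ k * 1#               ≡⟨ *-identityʳ (ξ ^ k) ⟩
      ξ ^ k                    ≡⟨ eq ⟩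
      ξ ^ l  ≡⟨ cong (ξ ^_) (ℕ.m+[n∸m]≡n (ℕ.<⇒≤ k<l)) ⟨
      ξ ^ (k ℕ.+ (l ∸ k))      ≡⟨ ^-homo-* ξ k (l ∸ k) ⟩
      ξ ^ k * ξ ^ (l ∸ k)  ∎)))

  power-injective : ∀ {i j} → power i ≡ power j → i ≡ j
  power-injective {i} {j} eq with Fin.<-cmp i j
  ... | tri≈ _ i≡j _ = i≡j
  ... | tri< i<j _ _ = contradiction eq (ξ^-distinct i<j (Fin.toℕ<n j))
  ... | tri> _ _ j<i = contradiction (sym eq) (ξ^-distinct j<i (Fin.toℕ<n i))

  -- The exponent q inverts squaring on powers of ξ because 2q = n + 1.
  square-root : ∀ k → ξ ^ (k ℕ.* q) * ξ ^ (k ℕ.* q) ≡ ξ ^ k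
  square-root k = begin
    ξ ^ (k ℕ.* q) * ξ ^ (k ℕ.* q)  ≡⟨ ^-homo-* ξ (k ℕ.* q) (k ℕ.* q) ⟨
    ξ ^ (k ℕ.* q ℕ.+ k ℕ.* q)  ≡⟨ cong (ξ ^_) (ℕ.*-distribˡ-+ k q q) ⟨
    ξ ^ (k ℕ.* (q ℕ.+ q))  ≡⟨ cong (λ l → ξ ^ (k ℕ.* l)) 1+n≡q+q ⟨
    ξ ^ (k ℕ.* suc n)  ≡⟨ cong (ξ ^_) (ℕ.*-suc k n) ⟩
    ξ ^ (k ℕ.+ k ℕ.* n)            ≡⟨ ^-homo-* ξ k (k ℕ.* n) ⟩
    ξ ^ k * ξ ^ (k ℕ.* n)  ≡⟨ cong (ξ ^ k *_) (ξ^-* k) ⟩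
    ξ ^ k * 1#                     ≡⟨ *-identityʳ (ξ ^ k) ⟩
    ξ ^ k  ∎

  square-^q : ∀ k → (ξ ^ k * ξ ^ k) ^ q ≡ ξ ^ k
  square-^q k = begin
    (ξ ^ k * ξ ^ k) ^ q  ≡⟨ ^-distrib-* (ξ ^ k) (ξ ^ k) q ⟩
    (ξ ^ k) ^ q * (ξ ^ k) ^ q  ≡⟨ cong₂ _*_ (^-assocʳ ξ k q) (^-assocʳ ξ k q) ⟩
    ξ ^ (k ℕ.* q) * ξ ^ (k ℕ.* q)  ≡⟨ square-root k ⟩
    ξ ^ k  ∎

  -- Congruent powers have the same square, and raising to the exponent `q` undoes squaring on
  -- powers of `ξ`. So a residue class contains at most one power.
  ξ^-≋⇒≡ : ∀ k l → ξ ^ k ≋ ξ ^ l → ξ ^ k ≡ ξ ^ l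
  ξ^-≋⇒≡ k l eq = trans (sym (square-^q k))
      (trans (cong (_^ q) (square-≋ {ξ ^ k} {ξ ^ l} eq)) (square-^q l))

  power-injective-≋ : ∀ {i j} → power i ≋ power j → i ≡ j
  power-injective-≋ {i} {j} eq = power-injective (ξ^-≋⇒≡ (toℕ i) (toℕ j) eq)

  -- Zero and the n powers of `ξ` are pairwise incongruent, so their residues fill all n + 1 places.
  -- This is what makes the residue ring a field.
  unit⇒power : ∀ {x} → Unit₂ x → ∃ λ i → x ≋ power i
  unit⇒power {x} 2x≢0 = reached (injective⇒surjective f-injective (residue x))
    where
    f : Fin (suc n) → Fin (suc n)
    f zero    = residue 0#
    f (suc i) = residue (power i)

    f-injective : ∀ {i j} → f i ≡ f j → i ≡ j
    f-injective {zero}  {zero}  _  = refl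
    f-injective {zero}  {suc j} eq =
      contradiction (trans (sym (residue-injective eq)) 0+0≡0) (ξ^-unit (toℕ j))
    f-injective {suc i} {zero}  eq =
      contradiction (trans (residue-injective eq) 0+0≡0) (ξ^-unit (toℕ i))
    f-injective {suc i} {suc j} eq = cong suc (power-injective-≋ (residue-injective eq))

    reached : (∃ λ i → f i ≡ residue x) → ∃ λ i → x ≋ power i
    reached (zero  , eq) = contradiction (trans (residue-injective (sym eq)) 0+0≡0) 2x≢0
    reached (suc i , eq) = i , residue-injective (sym eq)

  -- Modulo 2 the factor `x` may be replaced by a power of `ξ`, which is invertible.
  *-cancel-≋0 : ∀ {x y} → Unit₂ x → x * y + x * y ≡ 0# → y + y ≡ 0#
  *-cancel-≋0 {x} {y} 2x≢0 2xy≡0 with unit⇒power 2x≢0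
  ... | i , x≋ξ^i = ξ^-cancel (toℕ i) (begin
    power i * (y + y)              ≡⟨ distribˡ (power i) y y ⟩
    power i * y + power i * y  ≡⟨ *-congʳ-≋ {x} {power i} y x≋ξ^i ⟨
    x * y + x * y                  ≡⟨ 2xy≡0 ⟩
    0#                             ≡⟨ zeroʳ (power i) ⟨
    power i * 0#  ∎)

-- Sixtuples attached to the lines of the residue field.

module TeichmüllerDifferences {n q : ℕ} (G : GaloisRing n q) where

  open GaloisRingTheory G
  open ≡-Reasoning

  triple : Fin n → List R
  triple i = power i ∷ 2 · power i ∷ 3 · power i ∷ []

  sixtuple : R → R → List R
  sixtuple a b = a ∷ - a ∷ b ∷ - b ∷ (a + b) ∷ - (a + b) ∷ []

  +-cancel-neg : ∀ a b → b + - (a + b) ≡ - a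
  +-cancel-neg a b = begin
    b + - (a + b)        ≡⟨ cong (b +_) (-‿+-comm a b) ⟨
    b + (- a + - b)      ≡⟨ +-comm b (- a + - b) ⟩
    (- a + - b) + b      ≡⟨ +-assoc (- a) (- b) b ⟩
    - a + (- b + b)      ≡⟨ cong (- a +_) (-‿inverseˡ b) ⟩
    - a + 0#             ≡⟨ +-identityʳ (- a) ⟩
    - a  ∎

  neg-cancel-+ : ∀ a b → - a + (a + b) ≡ b
  neg-cancel-+ a b = begin
    - a + (a + b)  ≡⟨ +-assoc (- a) a b ⟨
    (- a + a) + b  ≡⟨ cong (_+ b) (-‿inverseˡ a) ⟩
    0# + b         ≡⟨ +-identityˡ b ⟩
    b  ∎

  -- With c = -(a + b) the sixtuple is {±a, ±b, ±c} for a zero-sum triple, a description unchanged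
  -- by a → b → c → a.
  sixtuple-rotate : ∀ a b → sixtuple a b ⊆ sixtuple b (- (a + b))
  sixtuple-rotate a b (here refl) =
    there (there (there (there (there (here (sym (trans (cong -_ (+-cancel-neg a b)) (-‿involutive a))))))))
  sixtuple-rotate a b (there (here refl)) = there (there (there (there (here (sym (+-cancel-neg a b))))))
  sixtuple-rotate a b (there (there (here refl))) = here refl
  sixtuple-rotate a b (there (there (there (here refl)))) = there (here refl)
  sixtuple-rotate a b (there (there (there (there (here refl))))) =
    there (there (there (here (sym (-‿involutive (a + b))))))
  sixtuple-rotate a b (there (there (there (there (there (here refl)))))) = there (there (here refl))

  sixtuple-swap : ∀ a b → sixtuple a b ⊆ sixtuple (- a) (a + b)
  sixtuple-swap a b (here refl) = there (here (sym (-‿involutive a)))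
  sixtuple-swap a b (there (here refl)) = here refl
  sixtuple-swap a b (there (there (here refl))) =
      there (there (there (there (here (sym (neg-cancel-+ a b))))))
  sixtuple-swap a b (there (there (there (here refl)))) =
    there (there (there (there (there (here (cong -_ (sym (neg-cancel-+ a b))))))))
  sixtuple-swap a b (there (there (there (there (here refl))))) = there (there (here refl))
  sixtuple-swap a b (there (there (there (there (there (here refl)))))) = there (there (there (here refl)))

  -- Squares are Teichmüller elements depending only on the residue modulo 2.
  -- The sixtuple of the line {p, q, p + q} consists of the differences of the squares
  -- of its points.
  δ : R → R → R
  δ x y = x * x + - (y * y)

  Six : R → R → List R
  Six x y = sixtuple (δ x y) (δ y (x + y))

  δ-neg : ∀ x y → - δ x y ≡ δ y x
  δ-neg x y = begin
    - (x * x + - (y * y))  ≡⟨ -‿+-comm (x * x) (- (y * y)) ⟨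
    - (x * x) + - - (y * y)  ≡⟨ cong (- (x * x) +_) (-‿involutive (y * y)) ⟩
    - (x * x) + y * y  ≡⟨ +-comm (- (x * x)) (y * y) ⟩
    y * y + - (x * x)  ∎

  δ-telescope : ∀ x y z → δ x y + δ y z ≡ δ x z
  δ-telescope x y z = begin
    (x * x + - (y * y)) + (y * y + - (z * z))  ≡⟨ +-assoc (x * x) (- (y * y)) (y * y + - (z * z)) ⟩
    x * x + (- (y * y) + (y * y + - (z * z)))  ≡⟨ cong (x * x +_) (neg-cancel-+ (y * y) (- (z * z))) ⟩
    x * x + - (z * z)  ∎

  δ-cong : ∀ {x x′ y y′} → x ≋ x′ → y ≋ y′ → δ x y ≡ δ x′ y′
  δ-cong {x} {x′} {y} {y′} x≋ y≋ = cong₂ (λ s t → s + - t) (square-≋ {x} {x′} x≋) (square-≋ {y} {y′} y≋)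

  Six-cong : ∀ {x x′ y y′} → x ≋ x′ → y ≋ y′ → Six x y ≡ Six x′ y′
  Six-cong {x} {x′} {y} {y′} x≋ y≋ = cong₂ sixtuple (δ-cong {x} {x′} {y} {y′} x≋ y≋)
    (δ-cong {y} {y′} {x + y} {x′ + y′} y≋ (+-cong-≋ {x} {x′} {y} {y′} x≋ y≋))

  x+[y+x]≋y : ∀ x y → x + (y + x) ≋ y
  x+[y+x]≋y x y = trans (cong (λ z → z + z)
      (solve 2 (λ x y → x :+ (y :+ x) := y :+ (x :+ x)) refl x y)) (+double-≋ y x)

  -- The three differences along the cycle x, y, x + y sum to zero, and the point following x + y is
  -- y + (x + y), congruent to x. Shifting the cycle therefore rotates the zero-sum triple.
  Six-rotate : ∀ x y → Six x y ⊆ Six y (x + y)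
  Six-rotate x y = subst (λ b → Six x y ⊆ sixtuple (δ y (x + y)) b) eq
      (sixtuple-rotate (δ x y) (δ y (x + y)))
    where
    eq : - (δ x y + δ y (x + y)) ≡ δ (x + y) (y + (x + y))
    eq = begin
      - (δ x y + δ y (x + y))  ≡⟨ cong -_ (δ-telescope x y (x + y)) ⟩
      - δ x (x + y)                ≡⟨ δ-neg x (x + y) ⟩
      δ (x + y) x  ≡⟨ δ-cong {x + y} {x + y} {y + (x + y)} {x} refl (x+[y+x]≋y y x) ⟨
      δ (x + y) (y + (x + y))  ∎

  Six-swap : ∀ x y → Six x y ⊆ Six y x
  Six-swap x y {u} u∈ = subst (u ∈_) (cong₂ sixtuple (δ-neg x y) eq)
      (sixtuple-swap (δ x y) (δ y (x + y)) u∈)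
    where
    eq : δ x y + δ y (x + y) ≡ δ x (y + x)
    eq = trans (δ-telescope x y (x + y)) (cong (δ x) (+-comm x y))

  infix 4 _∼_
  -- Stands in for spanning the same line.
  _∼_ : R × R → R × R → Set
  (x , y) ∼ (x′ , y′) = Six x y ⊆ Six x′ y′ × Six x′ y′ ⊆ Six x y

  ∼-refl : ∀ {s} → s ∼ s
  ∼-refl = (λ u∈ → u∈) , (λ u∈ → u∈)

  ∼-sym : ∀ {s t} → s ∼ t → t ∼ s
  ∼-sym (s⊆t , t⊆s) = t⊆s , s⊆t

  ∼-trans : ∀ {s t u} → s ∼ t → t ∼ u → s ∼ u
  ∼-trans (s⊆t , t⊆s) (t⊆u , u⊆t) = (t⊆u ∘ s⊆t) , (t⊆s ∘ u⊆t)

  ∼-cong : ∀ {x x′ y y′} → x ≋ x′ → y ≋ y′ → (x , y) ∼ (x′ , y′)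
  ∼-cong {x} {x′} {y} {y′} x≋ y≋ =
      subst (λ l → Six x y ⊆ l × l ⊆ Six x y) (Six-cong {x} {x′} {y} {y′} x≋ y≋) ((λ u∈ → u∈) , λ u∈ → u∈)

  ∼-swap : ∀ x y → (x , y) ∼ (y , x)
  ∼-swap x y = Six-swap x y , Six-swap y x

  -- Three rotations lead back to (x, y) modulo 2, so the reverse of each inclusion is obtained by
  -- continuing round the cycle.
  Six-rotate² : ∀ x y → Six y (x + y) ⊆ Six (x + y) x
  Six-rotate² x y = proj₁ (∼-cong {x + y} {x + y} {y + (x + y)} {x} refl (x+[y+x]≋y y x))
    ∘ Six-rotate y (x + y)

  Six-rotate³ : ∀ x y → Six (x + y) x ⊆ Six x y
  Six-rotate³ x y = proj₁ (∼-cong {x} {x} {(x + y) + x} {y} refl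
    (trans (cong (λ z → z + z) (+-assoc x y x)) (x+[y+x]≋y x y))) ∘ Six-rotate (x + y) x

  ∼-rotate : ∀ x y → (x , y) ∼ (y , x + y)
  ∼-rotate x y = Six-rotate x y , Six-rotate³ x y ∘ Six-rotate² x y

  ∼-rotate² : ∀ x y → (x , y) ∼ (x + y , x)
  ∼-rotate² x y = Six-rotate² x y ∘ Six-rotate x y , Six-rotate³ x y

  point : R → R → Fin 3 → R
  point x y 0F = x
  point x y 1F = y
  point x y 2F = x + y

  -- Linear independence of the residues over 𝔽₂: `x`, `y` and `x + y` are the three non-trivial
  -- combinations.
  record Independent (x y : R) : Set where
    field
      unitˡ : Unit₂ x
      unitʳ : Unit₂ y
      unit⁺ : Unit₂ (x + y)

  open Independent public

  unit⁺⇒≋̸ : ∀ {x y} → Unit₂ (x + y) → x ≋̸ y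
  unit⁺⇒≋̸ {x} {y} unit x≋y = unit (begin
    (x + y) + (x + y)  ≡⟨ +-cong-≋ {x} {y} {y} {y} x≋y refl ⟩
    (y + y) + (y + y)  ≡⟨ quadruple≡0 y ⟩
    0#  ∎)

  ≋̸⇒unit⁺ : ∀ {x y} → x ≋̸ y → Unit₂ (x + y)
  ≋̸⇒unit⁺ {x} {y} x≋̸y 2[x+y]≡0 = x≋̸y (begin
    x + x                          ≡⟨ +double-≋ x y ⟨
    (x + (y + y)) + (x + (y + y))  ≡⟨ cong (λ z → z + z) (+-assoc x y y) ⟨
    ((x + y) + y) + ((x + y) + y)  ≡⟨ +-cong-≋ {x + y} {0#} {y} {y} (trans 2[x+y]≡0 (sym 0+0≡0)) refl ⟩
    (0# + y) + (0# + y)  ≡⟨ cong (λ z → z + z) (+-identityˡ y) ⟩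
    y + y  ∎)

  ≋-dec : ∀ x y → Dec (x ≋ y)
  ≋-dec x y = (x + x) ≟ (y + y)

  point-injective : ∀ {x y} → Independent x y → ∀ i j → point x y i ≋ point x y j → i ≡ j
  point-injective {x} {y} ind = go
    where
    x≋̸y : x ≋̸ y
    x≋̸y = unit⁺⇒≋̸ {x} {y} (unit⁺ ind)

    x≋̸x+y : x ≋̸ x + y
    x≋̸x+y = unit⁺⇒≋̸ {x} {x + y} λ eq → unitʳ ind
        (trans (sym (trans (cong (λ z → z + z) (cong (x +_) (+-comm x y))) (x+[y+x]≋y x y))) eq)

    y≋̸x+y : y ≋̸ x + y
    y≋̸x+y = unit⁺⇒≋̸ {y} {x + y} λ eq → unitˡ ind (trans (sym (x+[y+x]≋y y x)) eq)

    go : ∀ i j → point x y i ≋ point x y j → i ≡ j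
    go 0F 0F _  = refl
    go 1F 1F _  = refl
    go 2F 2F _  = refl
    go 0F 1F eq = contradiction eq x≋̸y
    go 1F 0F eq = contradiction (sym eq) x≋̸y
    go 0F 2F eq = contradiction eq x≋̸x+y
    go 2F 0F eq = contradiction (sym eq) x≋̸x+y
    go 1F 2F eq = contradiction eq y≋̸x+y
    go 2F 1F eq = contradiction (sym eq) y≋̸x+y

  point-independent : ∀ {x y} → Independent x y → ∀ {i j} → i ≢ j →
                      Independent (point x y i) (point x y j)
  point-independent {x} {y} ind {i} {j} i≢j = record
    { unitˡ = unit i
    ; unitʳ = unit j
    ; unit⁺ = ≋̸⇒unit⁺ {point x y i} {point x y j} (i≢j ∘ point-injective ind i j)
    }
    where
    unit : ∀ i → Unit₂ (point x y i)
    unit 0F = unitˡ ind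
    unit 1F = unitʳ ind
    unit 2F = unit⁺ ind

  δ-expand : ∀ x y → δ x y ≡ (x + y) * (x + y) + (y * (x + y) + y * (x + y))
  δ-expand x y = begin
    x * x + - (y * y)
      ≡⟨ cong (x * x +_) (-‿distribˡ-* y y) ⟩
    x * x + - y * y
      ≡⟨ cong (λ z → x * x + z * y) -y≡ ⟩
    x * x + (((x + x) + y) + ((x + y) + (x + y))) * y
      ≡⟨ cong (x * x +_) (trans (distribʳ y _ _)
          (cong (((x + x) + y) * y +_) (distribʳ y (x + y) (x + y)))) ⟩
    x * x + (((x + x) + y) * y + ((x + y) * y + (x + y) * y))
      ≡⟨ +-assoc (x * x) (((x + x) + y) * y) _ ⟨
    (x * x + ((x + x) + y) * y) + ((x + y) * y + (x + y) * y)
      ≡⟨ cong₂ (λ a b → a + (b + b)) (sym (square-+ x y)) (*-comm (x + y) y) ⟩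
    (x + y) * (x + y) + (y * (x + y) + y * (x + y)) ∎
    where
    -- Both sides are 3y up to 4x = 0. The summand 2x + y, multiplied by y, completes x² to (x +
    -- y)²; the remaining 2(x + y) gives the doubled product.
    -y≡ : - y ≡ ((x + x) + y) + ((x + y) + (x + y))
    -y≡ = begin
      - y                                ≡⟨ -‿≡triple y ⟩
      y + (y + y)  ≡⟨ +-identityʳ (y + (y + y)) ⟨
      y + (y + y) + 0#  ≡⟨ cong (y + (y + y) +_) (quadruple≡0 x) ⟨
      y + (y + y) + ((x + x) + (x + x))
        ≡⟨ solve 2 (λ x y → y :+ (y :+ y) :+ ((x :+ x) :+ (x :+ x)) :=
            ((x :+ x) :+ y) :+ ((x :+ y) :+ (x :+ y))) refl x y ⟩
      ((x + x) + y) + ((x + y) + (x + y))  ∎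

  -- Modulo 2 the sum x² + y² is (x + y)², so for congruent squares (x + y)² vanishes, while a
  -- residue field has no zero divisors.
  square-cancel-≋ : ∀ {x y} → x * x ≋ y * y → x ≋ y
  square-cancel-≋ {x} {y} x²≋y² with ≋-dec x y
  ... | yes x≋y = x≋y
  ... | no x≋̸y = contradiction (*-cancel-≋0 {x + y} {x + y} unit (begin
    (x + y) * (x + y) + (x + y) * (x + y)  ≡⟨ cong (λ z → z + z) (square-+ x y) ⟩
    (x * x + ((x + x) + y) * y) + (x * x + ((x + x) + y) * y)
      ≡⟨ +-cong-≋ {x * x} {y * y} {((x + x) + y) * y} {y * y} x²≋y²
           (*-congʳ-≋ {(x + x) + y} {y} y (trans (cong (λ z → z + z) (+-comm (x + x) y)) (+double-≋ y x))) ⟩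
    (y * y + y * y) + (y * y + y * y)  ≡⟨ quadruple≡0 (y * y) ⟩
    0#  ∎)) unit
    where
    unit : Unit₂ (x + y)
    unit = ≋̸⇒unit⁺ {x} {y} x≋̸y

  *-cancel-≋ : ∀ {x y z} → Unit₂ z → y * z ≋ x * z → y ≋ x
  *-cancel-≋ {x} {y} {z} unit eq with ≋-dec y x
  ... | yes y≋x = y≋x
  ... | no y≋̸x = contradiction (*-cancel-≋0 {z} {y + x} unit (begin
    z * (y + x) + z * (y + x)
      ≡⟨ cong (λ a → a + a) (trans (*-comm z (y + x)) (distribʳ z y x)) ⟩
    (y * z + x * z) + (y * z + x * z)  ≡⟨ +-cong-≋ {y * z} {x * z} {x * z} {x * z} eq refl ⟩
    (x * z + x * z) + (x * z + x * z)  ≡⟨ quadruple≡0 (x * z) ⟩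
    0#  ∎)) (≋̸⇒unit⁺ {y} {x} y≋̸x)

  δ-≋-square : ∀ x y → δ x y ≋ (x + y) * (x + y)
  δ-≋-square x y = trans (cong (λ z → z + z) (δ-expand x y)) (+double-≋ ((x + y) * (x + y)) (y * (x + y)))

  -- In (x + y)² + 2y(x + y) the residue is (x + y)², which determines x + y modulo 2. Cancelling
  -- that square leaves 2y(x + y), and dividing by the unit x + y determines y modulo 2.
  δ-injective : ∀ {x y x′ y′} → Unit₂ (x + y) → δ x y ≡ δ x′ y′ → x ≋ x′ × y ≋ y′
  δ-injective {x} {y} {x′} {y′} unit eq = x≋x′ , y≋y′
    where
    s≋s′ : x + y ≋ x′ + y′
    s≋s′ = square-cancel-≋ {x + y} {x′ + y′}
      (trans (sym (δ-≋-square x y)) (trans (cong (λ z → z + z) eq) (δ-≋-square x′ y′)))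

    y≋y′ : y ≋ y′
    y≋y′ = *-cancel-≋ {y′} {y} {x + y} unit (trans
      (+-cancelˡ ((x + y) * (x + y)) _ _ (begin
        (x + y) * (x + y) + (y * (x + y) + y * (x + y))  ≡⟨ δ-expand x y ⟨
        δ x y  ≡⟨ eq ⟩
        δ x′ y′  ≡⟨ δ-expand x′ y′ ⟩
        (x′ + y′) * (x′ + y′) + (y′ * (x′ + y′) + y′ * (x′ + y′))
          ≡⟨ cong (_+ (y′ * (x′ + y′) + y′ * (x′ + y′))) (square-≋ {x + y} {x′ + y′} s≋s′) ⟨
        (x + y) * (x + y) + (y′ * (x′ + y′) + y′ * (x′ + y′))  ∎))
      (*-cong-≋ {y′} {y′} {x′ + y′} {x + y} refl (sym s≋s′)))

    [x+y]+y≋x : ∀ x y → (x + y) + y ≋ x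
    [x+y]+y≋x x y = trans (cong (λ z → z + z) (+-assoc x y y)) (+double-≋ x y)

    x≋x′ : x ≋ x′
    x≋x′ = trans (sym ([x+y]+y≋x x y))
        (trans (+-cong-≋ {x + y} {x′ + y′} {y} {y′} s≋s′ y≋y′) ([x+y]+y≋x x′ y′))

  -- Solves u = (x + y)² + 2y(x + y) in that form. Write u = s² + 2w with s the square root of the
  -- power of `ξ` congruent to u; x + y has to be s modulo 2, and y = w / s.
  δ-surjective : ∀ u → Unit₂ u → ∃₂ λ x y → u ≡ δ x y × Unit₂ (x + y)
  δ-surjective u unit with unit⇒power unit
  ... | i , u≋ξ^i = construct (≋⇒+double {u} {power i} u≋ξ^i) (ξ^-inverse k)
    where
    k : ℕ
    k = toℕ i ℕ.* q

    s : R
    s = ξ ^ k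

    construct : (∃ λ w → u ≡ power i + (w + w)) → (∃ λ v → s * v ≡ 1#) →
                ∃₂ λ x y → u ≡ δ x y × Unit₂ (x + y)
    construct (w , u≡) (v , sv≡1) = s + y , y , sym (begin
      δ (s + y) y
        ≡⟨ δ-expand (s + y) y ⟩
      ((s + y) + y) * ((s + y) + y) + (y * ((s + y) + y) + y * ((s + y) + y))
        ≡⟨ cong₂ _+_ (square-≋ {(s + y) + y} {s} sum≋s) (*-cong-≋ {y} {y} {(s + y) + y} {s} refl sum≋s) ⟩
      s * s + (y * s + y * s)
        ≡⟨ cong₂ (λ a b → a + (b + b)) (square-root (toℕ i)) ys≡w ⟩
      power i + (w + w)
        ≡⟨ u≡ ⟨
      u ∎) , λ eq → ξ^-unit k (trans (sym sum≋s) eq)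
      where
      y : R
      y = w * v

      sum≋s : (s + y) + y ≋ s
      sum≋s = trans (cong (λ z → z + z) (+-assoc s y y)) (+double-≋ s y)

      ys≡w : y * s ≡ w
      ys≡w = begin
        (w * v) * s    ≡⟨ *-assoc w v s ⟩
        w * (v * s)  ≡⟨ cong (w *_) (trans (*-comm v s) sv≡1) ⟩
        w * 1#         ≡⟨ *-identityʳ w ⟩
        w  ∎

  -- The second index names one of the other two points through `punchIn`, so the index type is that
  -- of ordered pairs of distinct points.
  slot : R → R → Fin 3 × Fin 2 → R
  slot x y (i , j) = δ (point x y i) (point x y (Fin.punchIn i j))

  -- In the order in which `sixtuple` lists its entries: ±(x² - y²), ±(y² - (x + y)²), ±(x² - (x +
  -- y)²).
  slots : List (Fin 3 × Fin 2)
  slots = (0F , 0F) ∷ (1F , 0F) ∷ (1F , 1F) ∷ (2F , 1F) ∷ (0F , 1F) ∷ (2F , 0F) ∷ []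

  slots-unique : Unique slots
  slots-unique = toWitness {a? = DecUnique.unique? (Product.≡-dec Fin._≟_ Fin._≟_) slots} _

  Six≡slots : ∀ x y → Six x y ≡ map (slot x y) slots
  Six≡slots x y
    rewrite δ-telescope x y (x + y) | δ-neg x y | δ-neg y (x + y) | δ-neg x (x + y) = refl

  slot-injective : ∀ {x y} → Independent x y → ∀ {s t} → slot x y s ≡ slot x y t → s ≡ t
  slot-injective {x} {y} ind {i , j} {i′ , j′} eq = combine i′ j′
    (point-injective ind i i′ (proj₁ both))
        (point-injective ind (Fin.punchIn i j) (Fin.punchIn i′ j′) (proj₂ both))
    where
    unit : Unit₂ (point x y i + point x y (Fin.punchIn i j))
    unit = unit⁺ (point-independent ind (Fin.punchInᵢ≢i i j ∘ sym))

    both : point x y i ≋ point x y i′ × point x y (Fin.punchIn i j) ≋ point x y (Fin.punchIn i′ j′)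
    both = δ-injective {point x y i} {point x y (Fin.punchIn i j)}
                       {point x y i′} {point x y (Fin.punchIn i′ j′)} unit eq

    combine : ∀ i′ j′ → i ≡ i′ → Fin.punchIn i j ≡ Fin.punchIn i′ j′ → (i , j) ≡ (i′ , j′)
    combine _ j′ refl eq = cong (i ,_) (Fin.punchIn-injective i j j′ eq)

  Six-unique : ∀ {x y} → Independent x y → Unique (Six x y)
  Six-unique {x} {y} ind = subst Unique (sym (Six≡slots x y))
    (Unique.map⁺ (slot-injective ind) {slots} slots-unique)

  Six-∈ : ∀ {x y} → Independent x y → ∀ {u} → u ∈ Six x y →
          ∃₂ λ x′ y′ → Independent x′ y′ × u ≡ δ x′ y′ × (x , y) ∼ (x′ , y′)
  Six-∈ {x} {y} ind {u} u∈ with ∈-map⁻ (slot x y) {xs = slots} (subst (u ∈_) (Six≡slots x y) u∈)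
  ... | (i , j) , _ , u≡ = point x y i , point x y (Fin.punchIn i j) ,
    point-independent ind (Fin.punchInᵢ≢i i j ∘ sym) , u≡ , same i j
    where
    same : ∀ i j → (x , y) ∼ (point x y i , point x y (Fin.punchIn i j))
    same 0F 0F = ∼-refl
    same 0F 1F = ∼-trans (∼-rotate² x y) (∼-swap (x + y) x)
    same 1F 0F = ∼-swap x y
    same 1F 1F = ∼-rotate x y
    same 2F 0F = ∼-rotate² x y
    same 2F 1F = ∼-trans (∼-rotate x y) (∼-swap y (x + y))

  -- A common element is a difference of squares for only one pair of points modulo 2, and two
  -- points determine their line.
  Six-overlap : ∀ {x y x′ y′} → Independent x y → Independent x′ y′ →
                ∀ {u} → u ∈ Six x y → u ∈ Six x′ y′ → (x , y) ∼ (x′ , y′)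
  Six-overlap ind ind′ u∈ u∈′ with Six-∈ ind u∈ | Six-∈ ind′ u∈′
  ... | p , q , indpq , u≡ , ∼pq | p′ , q′ , _ , u≡′ , ∼pq′ =
    ∼-trans ∼pq (∼-trans (∼-cong {p} {p′} {q} {q′} (proj₁ p≋) (proj₂ p≋)) (∼-sym ∼pq′))
    where
    p≋ : p ≋ p′ × q ≋ q′
    p≋ = δ-injective {p} {q} {p′} {q′} (unit⁺ indpq) (trans (sym u≡) u≡′)

  -- A transversal: one independent pair for each line.
  record LineSystem (m : ℕ) : Set where
    field
      line        : Fin m → R × R
      independent : ∀ j → uncurry Independent (line j)
      disjoint    : ∀ {i j u} → u ∈ uncurry Six (line i) → u ∈ uncurry Six (line j) → i ≡ j
      covered     : ∀ {x y} → Independent x y → ∃ λ j → (x , y) ∼ line j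

  private
    N : ℕ
    N = n ℕ.* (n ∸ 1)

  -- Enumerates the ordered pairs of distinct non-zero residue classes, each class being represented
  -- by its power of `ξ`.
  powerPair : Fin n × Fin (n ∸ 1) → R × R
  powerPair (i , j) = power i , power (others i j)

  powerPair-independent : ∀ ij → uncurry Independent (powerPair ij)
  powerPair-independent (i , j) = record
    { unitˡ = ξ^-unit (toℕ i)
    ; unitʳ = ξ^-unit (toℕ (others i j))
    ; unit⁺ = ≋̸⇒unit⁺ {power i} {power (others i j)} (others≢ i j ∘ sym ∘ power-injective-≋)
    }

  powerPair-injective : ∀ ij kl → uncurry δ (powerPair ij) ≡ uncurry δ (powerPair kl) → ij ≡ kl
  powerPair-injective (i , j) (k , l) eq =
      combine (power-injective-≋ (proj₁ both)) (power-injective-≋ (proj₂ both))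
    where
    both : power i ≋ power k × power (others i j) ≋ power (others k l)
    both = δ-injective {power i} {power (others i j)} {power k} {power (others k l)}
             (unit⁺ (powerPair-independent (i , j))) eq

    combine : ∀ {k l} → i ≡ k → others i j ≡ others k l → (i , j) ≡ (k , l)
    combine {l = l} refl eq = cong (i ,_) (others-injective i j l eq)

  powerPair-covers : ∀ {x y} → Independent x y →
    ∃ λ ij → x ≋ proj₁ (powerPair ij) × y ≋ proj₂ (powerPair ij)
  powerPair-covers {x} {y} ind with unit⇒power (unitˡ ind) | unit⇒power (unitʳ ind)
  ... | i , x≋ | j , y≋ = locate (others-surjective i≢j)
    where
    i≢j : i ≢ j
    i≢j i≡j = unit⁺⇒≋̸ {x} {y} (unit⁺ ind) (trans x≋ (trans (cong (λ i → power i + power i) i≡j) (sym y≋)))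

    locate : (∃ λ k → others i k ≡ j) → ∃ λ ij → x ≋ proj₁ (powerPair ij) × y ≋ proj₂ (powerPair ij)
    locate (k , eq) = (i , k) , x≋ , trans y≋ (cong (λ j → power j + power j) (sym eq))

  pairAt : Fin N → R × R
  pairAt k = powerPair (Fin.remQuot (n ∸ 1) k)

  pairAt-covers : ∀ {x y} → Independent x y → ∃ λ k → x ≋ proj₁ (pairAt k) × y ≋ proj₂ (pairAt k)
  pairAt-covers {x} {y} ind = go (powerPair-covers ind)
    where
    go : (∃ λ ij → x ≋ proj₁ (powerPair ij) × y ≋ proj₂ (powerPair ij)) →
         ∃ λ k → x ≋ proj₁ (pairAt k) × y ≋ proj₂ (pairAt k)
    go ((i , j) , eqs) = Fin.combine i j ,
      subst (λ ij → x ≋ proj₁ (powerPair ij) × y ≋ proj₂ (powerPair ij)) (sym (Fin.remQuot-combine i j)) eqs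

  -- The chosen sixtuples strung together and the list of all differences of pairs of distinct
  -- powers are both free of repetitions and contain each other. Comparing lengths gives the count.
  lineSystem : ∃ λ m → LineSystem m × m ℕ.* 6 ≡ n ℕ.* (n ∸ 1)
  lineSystem = extract (disjointRepresentatives B compare (allFin N))
    where
    B : Fin N → List R
    B = uncurry Six ∘ pairAt

    ind : ∀ k → uncurry Independent (pairAt k)
    ind k = powerPair-independent (Fin.remQuot (n ∸ 1) k)

    compare : ∀ i j → Disjoint (B i) (B j) ⊎ (B i ⊆ B j × B j ⊆ B i)
    compare i j with Any.any? (λ u → DecMembership._∈?_ _≟_ u (B j)) (B i)
    ... | no none = inj₁ λ (u∈Bi , u∈Bj) → none (Any.map (λ { refl → u∈Bj }) u∈Bi)
    ... | yes some with u , u∈Bi , u∈Bj ← find some = inj₂ (Six-overlap (ind i) (ind j) u∈Bi u∈Bj)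

    extract : (∃ λ reps → AllPairs (λ i j → Disjoint (B i) (B j)) reps ×
                          All (λ i → Any (λ j → B i ⊆ B j × B j ⊆ B i) reps) (allFin N)) →
              ∃ λ m → LineSystem m × m ℕ.* 6 ≡ n ℕ.* (n ∸ 1)
    extract (reps , disjoint , covered) = length reps , system , (begin
      length reps ℕ.* 6  ≡⟨ length-concat-constant B 6 (λ _ → refl) reps ⟨
      length (concat (map B reps))    ≡⟨ ℕ.≤-antisym
        (unique-⊆⇒length≤ blocks-unique blocks⊆differences)
        (unique-⊆⇒length≤ differences-unique differences⊆blocks) ⟩
      length differences  ≡⟨ length-map difference (allFin N) ⟩
      length (allFin N)  ≡⟨ length-tabulate {n = N} (λ i → i) ⟩
      N  ∎)
      where
      difference : Fin N → R
      difference = uncurry δ ∘ pairAt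

      differences : List R
      differences = map difference (allFin N)

      difference-injective : ∀ {i j} → difference i ≡ difference j → i ≡ j
      difference-injective {i} {j} eq = begin
        i
          ≡⟨ Fin.combine-remQuot {n} (n ∸ 1) i ⟨
        uncurry Fin.combine (Fin.remQuot {n} (n ∸ 1) i)
          ≡⟨ cong (uncurry Fin.combine)
              (powerPair-injective (Fin.remQuot (n ∸ 1) i) (Fin.remQuot (n ∸ 1) j) eq) ⟩
        uncurry Fin.combine (Fin.remQuot {n} (n ∸ 1) j)  ≡⟨ Fin.combine-remQuot {n} (n ∸ 1) j ⟩
        j  ∎

      differences-unique : Unique differences
      differences-unique = Unique.map⁺ difference-injective (Unique.allFin⁺ N)

      blocks-unique : Unique (concat (map B reps))
      blocks-unique = Unique.concat⁺ (All.map⁺ (All.universal (λ k → Six-unique (ind k)) reps))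
                                     (AllPairs.map⁺ disjoint)

      cover : ∀ k → ∃ λ j → (B k ⊆ B (List.lookup reps j) × B (List.lookup reps j) ⊆ B k)
      cover k = Any.index found , Any.lookup-index found
        where found = All.lookup covered (∈-allFin k)

      differences⊆blocks : differences ⊆ concat (map B reps)
      differences⊆blocks u∈ with ∈-map⁻ difference u∈
      ... | k , _ , refl = ∈-concat⁺
          (Any.map⁺ (Any.map (λ (k⊆j , _) → k⊆j (here refl)) (All.lookup covered (∈-allFin k))))

      blocks⊆differences : concat (map B reps) ⊆ differences
      blocks⊆differences {u} u∈ = inBlock (Any.satisfied (Any.map⁻ (∈-concat⁻ (map B reps) u∈)))
        where
        asDifference : ∀ {s} → (∃₂ λ x y → Independent x y × u ≡ δ x y × s ∼ (x , y)) → u ∈ differences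
        asDifference (x , y , indxy , u≡δ , _) = found (pairAt-covers indxy)
          where
          found : (∃ λ k → x ≋ proj₁ (pairAt k) × y ≋ proj₂ (pairAt k)) → u ∈ differences
          found (k , x≋ , y≋) = subst (_∈ differences)
            (sym (trans u≡δ (δ-cong {x} {proj₁ (pairAt k)} {y} {proj₂ (pairAt k)} x≋ y≋)))
            (∈-map⁺ difference (∈-allFin k))

        inBlock : (∃ λ j → u ∈ B j) → u ∈ differences
        inBlock (j , u∈Bj) = asDifference (Six-∈ (ind j) u∈Bj)

      system : LineSystem (length reps)
      system = record
        { line        = pairAt ∘ List.lookup reps
        ; independent = ind ∘ List.lookup reps
        ; disjoint    = λ {i} {j} u∈i u∈j → distinguish i j (u∈i , u∈j)
        ; covered     = λ {x} {y} indxy → locate indxy (pairAt-covers indxy)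
        }
        where
        distinguish : ∀ i j {u} → u ∈ B (List.lookup reps i) × u ∈ B (List.lookup reps j) → i ≡ j
        distinguish i j both with i Fin.≟ j
        ... | yes i≡j = i≡j
        ... | no i≢j  = contradiction both (disjointAt i≢j)
          where
          disjointAt : i ≢ j → Disjoint (B (List.lookup reps i)) (B (List.lookup reps j))
          disjointAt = allPairs-lookup {R = λ i j → Disjoint (B i) (B j)}
            (λ apart (u∈ , u∈′) → apart (u∈′ , u∈)) disjoint i j

        locate : ∀ {x y} → Independent x y → (∃ λ k → x ≋ proj₁ (pairAt k) × y ≋ proj₂ (pairAt k)) →
                 ∃ λ j → (x , y) ∼ pairAt (List.lookup reps j)
        locate {x} {y} indxy (k , x≋ , y≋) with cover k
        ... | j , k∼j = j , ∼-trans (∼-cong {x} {proj₁ (pairAt k)} {y} {proj₂ (pairAt k)} x≋ y≋) k∼j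

-- The partition into triples and sixtuples of lines.

module TeichmüllerPartition {n q : ℕ} (G : GaloisRing n q) where

  open GaloisRingTheory G
  open TeichmüllerDifferences G
  open ≡-Reasoning

  root : Fin n → R
  root i = ξ ^ (toℕ i ℕ.* q)

  -- The units of a triple are the differences of squares with one point equal to 0; uniqueness of
  -- the two points then separates triples from sixtuples.
  power≡δ : ∀ i → power i ≡ δ (root i) 0#
  power≡δ i = begin
    power i                        ≡⟨ square-root (toℕ i) ⟨
    root i * root i  ≡⟨ +-identityʳ (root i * root i) ⟨
    root i * root i + 0#  ≡⟨ cong (root i * root i +_) -0² ⟨
    root i * root i + - (0# * 0#)  ∎
    where
    -0² : - (0# * 0#) ≡ 0#
    -0² = trans (cong -_ (zeroˡ 0#)) (trans (sym (+-identityˡ (- 0#))) (-‿inverseʳ 0#))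

  -power≡δ : ∀ i → - power i ≡ δ 0# (root i)
  -power≡δ i = trans (cong -_ (power≡δ i)) (δ-neg (root i) 0#)

  2·≡ : ∀ x → 2 · x ≡ x + x
  2·≡ x = cong (x +_) (+-identityʳ x)

  3·≡ : ∀ x → 3 · x ≡ - x
  3·≡ x = trans (cong (x +_) (2·≡ x)) (sym (-‿≡triple x))

  triple-∈ : ∀ i {u} → u ∈ triple i → u ≡ power i + power i ⊎ (u ≡ power i ⊎ u ≡ - power i)
  triple-∈ i (here refl)                  = inj₂ (inj₁ refl)
  triple-∈ i (there (here refl))          = inj₁ (2·≡ (power i))
  triple-∈ i (there (there (here refl)))  = inj₂ (inj₂ (3·≡ (power i)))

  triple-≋ : ∀ i {u} → u ∈ triple i → u ≡ power i + power i ⊎ u ≋ power i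
  triple-≋ i u∈ with triple-∈ i u∈
  ... | inj₁ u≡        = inj₁ u≡
  ... | inj₂ (inj₁ u≡) = inj₂ (cong (λ z → z + z) u≡)
  ... | inj₂ (inj₂ u≡) = inj₂ (trans (cong (λ z → z + z) u≡) (-‿≋ (power i)))

  triple-disjoint : ∀ i j {u} → u ∈ triple i → u ∈ triple j → i ≡ j
  triple-disjoint i j u∈i u∈j with triple-≋ i u∈i | triple-≋ j u∈j
  ... | inj₁ u≡2i | inj₁ u≡2j = power-injective-≋ (trans (sym u≡2i) u≡2j)
  ... | inj₁ refl | inj₂ u≋j  = contradiction (trans (sym u≋j) (quadruple≡0 (power i))) (ξ^-unit (toℕ j))
  ... | inj₂ u≋i  | inj₁ refl = contradiction (trans (sym u≋i) (quadruple≡0 (power j))) (ξ^-unit (toℕ i))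
  ... | inj₂ u≋i  | inj₂ u≋j  = power-injective-≋ (trans (sym u≋i) u≋j)

  δ-unit : ∀ {x y} → Unit₂ (x + y) → Unit₂ (δ x y)
  δ-unit {x} {y} unit 2δ≡0 = unit (*-cancel-≋0 unit (trans (sym (δ-≋-square x y)) 2δ≡0))

  -- Every element of a sixtuple is a unit, which excludes 2ξ^i. If it were ±ξ^i, then one of its
  -- two points would be zero modulo 2.
  triple-Six-disjoint : ∀ i {x y} → Independent x y → ∀ {u} → u ∈ triple i → ¬ u ∈ Six x y
  triple-Six-disjoint i ind {u} u∈i u∈S with Six-∈ ind u∈S | triple-∈ i u∈i
  ... | x , y , indxy , u≡δ , _ | inj₁ u≡2p = δ-unit (unit⁺ indxy)
    (trans (cong (λ z → z + z) (trans (sym u≡δ) u≡2p)) (quadruple≡0 (power i)))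
  ... | x , y , indxy , u≡δ , _ | inj₂ (inj₁ u≡p) = unitʳ indxy (trans
    (proj₂ (δ-injective {x} {y} {root i} {0#} (unit⁺ indxy) (trans (sym u≡δ) (trans u≡p (power≡δ i)))))
        0+0≡0)
  ... | x , y , indxy , u≡δ , _ | inj₂ (inj₂ u≡-p) = unitˡ indxy (trans
    (proj₁ (δ-injective {x} {y} {0#} {root i} (unit⁺ indxy)
        (trans (sym u≡δ) (trans u≡-p (-power≡δ i))))) 0+0≡0)

  square≡power : ∀ {x} → Unit₂ x → ∃ λ i → x * x ≡ power i
  square≡power {x} unit with unit⇒power unit
  ... | l , x≋ξ^l with ξ^-power (toℕ l ℕ.+ toℕ l)
  ...   | i , eq = i , (begin
    x * x  ≡⟨ square-≋ {x} {power l} x≋ξ^l ⟩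
    power l * power l  ≡⟨ ^-homo-* ξ (toℕ l) (toℕ l) ⟨
    ξ ^ (toℕ l ℕ.+ toℕ l)          ≡⟨ eq ⟩
    power i  ∎)

  data Kind (u : R) : Set where
    inTriple : ∀ i → u ∈ triple i → Kind u
    inSix    : ∀ {x y} → Independent x y → u ≡ δ x y → Kind u

  -0≡0 : - 0# ≡ 0#
  -0≡0 = trans (sym (+-identityˡ (- 0#))) (-‿inverseʳ 0#)

  double≡0⇒≋0 : ∀ {x} → x + x ≡ 0# → x ≋ 0#
  double≡0⇒≋0 2x≡0 = trans 2x≡0 (sym 0+0≡0)

  δ-0ˡ : ∀ {x} y → x + x ≡ 0# → δ x y ≡ - (y * y)
  δ-0ˡ {x} y 2x≡0 = begin
    δ x y  ≡⟨ δ-cong {x} {0#} {y} {y} (double≡0⇒≋0 2x≡0) refl ⟩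
    0# * 0# + - (y * y)  ≡⟨ cong (_+ - (y * y)) (zeroˡ 0#) ⟩
    0# + - (y * y)           ≡⟨ +-identityˡ (- (y * y)) ⟩
    - (y * y)  ∎

  δ-0ʳ : ∀ x {y} → y + y ≡ 0# → δ x y ≡ x * x
  δ-0ʳ x {y} 2y≡0 = begin
    δ x y  ≡⟨ δ-cong {x} {x} {y} {0#} refl (double≡0⇒≋0 2y≡0) ⟩
    x * x + - (0# * 0#)  ≡⟨ cong (λ z → x * x + - z) (zeroˡ 0#) ⟩
    x * x + - 0#             ≡⟨ cong (x * x +_) -0≡0 ⟩
    x * x + 0#               ≡⟨ +-identityʳ (x * x) ⟩
    x * x  ∎

  unit⁺⇒unitʳ : ∀ {x y} → Unit₂ (x + y) → x + x ≡ 0# → Unit₂ y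
  unit⁺⇒unitʳ {x} {y} unit 2x≡0 2y≡0 = unit (begin
    (x + y) + (x + y)  ≡⟨ +-cong-≋ {x} {0#} {y} {0#} (double≡0⇒≋0 2x≡0) (double≡0⇒≋0 2y≡0) ⟩
    (0# + 0#) + (0# + 0#)  ≡⟨ quadruple≡0 0# ⟩
    0#  ∎)

  square-kind : ∀ u {x} → Unit₂ x → u ≡ x * x ⊎ u ≡ - (x * x) → Kind u
  square-kind u {x} unit u≡ = go (square≡power {x} unit) u≡
    where
    go : (∃ λ i → x * x ≡ power i) → u ≡ x * x ⊎ u ≡ - (x * x) → Kind u
    go (i , eq) (inj₁ u≡x²)  = inTriple i (here (trans u≡x² eq))
    go (i , eq) (inj₂ u≡-x²) = inTriple i (there (there (here
      (trans u≡-x² (trans (cong -_ eq) (sym (3·≡ (power i))))))))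

  δ-kind : ∀ {u} x y → u ≡ δ x y → Unit₂ (x + y) → Dec (x + x ≡ 0#) → Dec (y + y ≡ 0#) → Kind u
  δ-kind {u} x y u≡δ unit⁺ (yes 2x≡0) _ =
    square-kind u {y} (unit⁺⇒unitʳ {x} {y} unit⁺ 2x≡0) (inj₂ (trans u≡δ (δ-0ˡ {x} y 2x≡0)))
  δ-kind {u} x y u≡δ unit⁺ (no unitˡ) (yes 2y≡0) =
    square-kind u {x} unitˡ (inj₁ (trans u≡δ (δ-0ʳ x {y} 2y≡0)))
  δ-kind x y u≡δ unit⁺ (no unitˡ) (no unitʳ) =
    inSix {x = x} {y} (record { unitˡ = unitˡ ; unitʳ = unitʳ ; unit⁺ = unit⁺ }) u≡δ

  double-kind : ∀ {u w} → u ≢ 0# → u ≡ w + w → Kind u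
  double-kind {u} {w} u≢0 u≡2w = go (unit⇒power {w} (λ 2w≡0 → u≢0 (trans u≡2w 2w≡0)))
    where
    go : (∃ λ i → w ≋ power i) → Kind u
    go (i , w≋) = inTriple i (there (here (trans u≡2w (trans w≋ (sym (2·≡ (power i)))))))

  -- An element killed by 2 is a double, hence some 2ξ^i. Any other is a difference of two squares,
  -- which collapses to ±ξ^i when one of the points is zero modulo 2.
  classify : ∀ u → u ≢ 0# → Kind u
  classify u u≢0 = go ((u + u) ≟ 0#)
    where
    half : (∃ λ w → u ≡ w + w) → Kind u
    half (w , u≡2w) = double-kind u≢0 u≡2w

    difference : Unit₂ u → (∃₂ λ x y → u ≡ δ x y × Unit₂ (x + y)) → Kind u
    difference unit (x , y , u≡δ , unit⁺) = δ-kind x y u≡δ unit⁺ ((x + x) ≟ 0#) ((y + y) ≟ 0#)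

    go : Dec (u + u ≡ 0#) → Kind u
    go (yes 2u≡0) = half (halve u 2u≡0)
    go (no unit)  = difference unit (δ-surjective u unit)

  -- Stated for any number `m` of sixtuples, because the number of lines is not yet identified with
  -- the prescribed one.
  blockOf : ∀ {m} → (Fin m → Pred R 0ℓ) → Fin n ⊎ Fin m → Pred R 0ℓ
  blockOf S (inj₁ i) u = u ∈ triple i
  blockOf S (inj₂ j) u = S j u

  module Blocks {m : ℕ} (L : LineSystem m) where

    open LineSystem L

    S : Fin m → Pred R 0ℓ
    S j u = u ∈ uncurry Six (line j)

    block-nonzero : ∀ k u → blockOf S k u → u ≢ 0#
    block-nonzero (inj₁ i) u u∈ u≡0 with triple-≋ i u∈
    ... | inj₁ u≡2p = ξ^-unit (toℕ i) (trans (sym u≡2p) u≡0)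
    ... | inj₂ u≋p  = ξ^-unit (toℕ i) (trans (sym u≋p) (trans (cong (λ z → z + z) u≡0) 0+0≡0))
    block-nonzero (inj₂ j) u u∈ u≡0 with Six-∈ (independent j) u∈
    ... | x , y , indxy , u≡δ , _ =
      δ-unit {x} {y} (unit⁺ indxy) (trans (cong (λ z → z + z) (trans (sym u≡δ) u≡0)) 0+0≡0)

    block-unique : ∀ k l {u} → blockOf S k u → blockOf S l u → k ≡ l
    block-unique (inj₁ i) (inj₁ j) u∈i u∈j = cong inj₁ (triple-disjoint i j u∈i u∈j)
    block-unique (inj₁ i) (inj₂ j) u∈i u∈j = contradiction u∈j (triple-Six-disjoint i (independent j) u∈i)
    block-unique (inj₂ i) (inj₁ j) u∈i u∈j = contradiction u∈i (triple-Six-disjoint j (independent i) u∈j)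
    block-unique (inj₂ i) (inj₂ j) u∈i u∈j = cong inj₂ (disjoint u∈i u∈j)

    block-exists : ∀ u → u ≢ 0# → ∃ λ k → blockOf S k u
    block-exists u u≢0 with classify u u≢0
    ... | inTriple i u∈ = inj₁ i , u∈
    ... | inSix ind u≡δ with j , ∼j ← covered ind = inj₂ j , proj₁ ∼j (here u≡δ)

    -- θ acts on the points of lines and φ on their squares.
    invariant : (φ θ : R → R) → (∀ x y → φ (x + y) ≡ φ x + φ y) → (∀ x → φ (- x) ≡ - φ x) →
                (∀ x y → θ (x + y) ≡ θ x + θ y) → (∀ x → Unit₂ x → Unit₂ (θ x)) →
                (∀ x → φ (x * x) ≡ θ x * θ x) → (∀ i → ∃ λ i′ → φ (power i) ≡ power i′) →
                ∀ k → ∃ λ l → Image φ (blockOf S k) ≐ blockOf S l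
    invariant φ θ φ-+ φ-neg θ-+ θ-unit φ-square φ-power (inj₁ i) with φ-power i
    ... | i′ , φp≡p′ = inj₁ i′ , image-list φ (begin
      φ p ∷ φ (2 · p) ∷ φ (3 · p) ∷ []
        ≡⟨ cong₂ (λ a b → φ p ∷ a ∷ b ∷ []) (trans (cong φ (2·≡ p)) (trans (φ-+ p p) (sym (2·≡ (φ p)))))
             (trans (cong φ (3·≡ p)) (trans (φ-neg p) (sym (3·≡ (φ p))))) ⟩
      φ p ∷ 2 · φ p ∷ 3 · φ p ∷ []
        ≡⟨ cong (λ a → a ∷ 2 · a ∷ 3 · a ∷ []) φp≡p′ ⟩
      triple i′ ∎)
      where
      p : R
      p = power i
    invariant φ θ φ-+ φ-neg θ-+ θ-unit φ-square φ-power (inj₂ j) with line j | independent j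
    ... | x , y | ind with covered {θ x} {θ y} (record
          { unitˡ = θ-unit x (unitˡ ind)
          ; unitʳ = θ-unit y (unitʳ ind)
          ; unit⁺ = subst Unit₂ (θ-+ x y) (θ-unit (x + y) (unit⁺ ind)) })
    ...   | l , (S⊆ , S⊇) with image-list φ mapped
      where
      φ-δ : ∀ x y → φ (δ x y) ≡ δ (θ x) (θ y)
      φ-δ x y = begin
        φ (x * x + - (y * y))  ≡⟨ φ-+ (x * x) (- (y * y)) ⟩
        φ (x * x) + φ (- (y * y))
          ≡⟨ cong₂ _+_ (φ-square x) (trans (φ-neg (y * y)) (cong -_ (φ-square y))) ⟩
        δ (θ x) (θ y)  ∎

      mapped : map φ (Six x y) ≡ Six (θ x) (θ y)
      mapped
        rewrite φ-neg (δ x y + δ y (x + y)) | φ-+ (δ x y) (δ y (x + y)) | φ-neg (δ x y)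
              | φ-neg (δ y (x + y))
              | φ-δ x y | φ-δ y (x + y) | θ-+ x y = refl
    ...     | image⊆ , image⊇ = inj₂ l , S⊆ ∘ image⊆ , image⊇ ∘ S⊇

-- Roots of polynomials modulo 2 and the order of ring automorphisms.

module RootCounting {n q : ℕ} (G : GaloisRing n q) where

  open GaloisRingTheory G
  open TeichmüllerDifferences G
  open ≡-Reasoning

  -- The value at x of the monic polynomial of degree d whose lower
  -- coefficients are given, constant term first.
  monic : ∀ {d} → Vec R d → R → R
  monic []       x = 1#
  monic (c ∷ cs) x = c + x * monic cs x

  addScaled : ∀ {d} → Vec R (suc d) → R → Vec R d → Vec R (suc d)
  -- The empty vector stands for the constant polynomial 1, so `a` itself enters the last
  -- coefficient.
  addScaled (c ∷ [])      a []       = (c + a) ∷ []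
  addScaled (c ∷ c′ ∷ cs) a (s ∷ ss) = (c + a * s) ∷ addScaled (c′ ∷ cs) a ss

  monic-addScaled : ∀ {d} (cs : Vec R (suc d)) a ss x →
                    monic (addScaled cs a ss) x ≡ monic cs x + a * monic ss x
  monic-addScaled (c ∷ []) a [] x = begin
    (c + a) + x * 1#          ≡⟨ +-assoc c a (x * 1#) ⟩
    c + (a + x * 1#)  ≡⟨ cong (c +_) (+-comm a (x * 1#)) ⟩
    c + (x * 1# + a)          ≡⟨ +-assoc c (x * 1#) a ⟨
    (c + x * 1#) + a  ≡⟨ cong ((c + x * 1#) +_) (*-identityʳ a) ⟨
    (c + x * 1#) + a * 1#  ∎
  monic-addScaled (c ∷ c′ ∷ cs) a (s ∷ ss) x = begin
    (c + a * s) + x * monic (addScaled (c′ ∷ cs) a ss) x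
      ≡⟨ cong (λ z → (c + a * s) + x * z) (monic-addScaled (c′ ∷ cs) a ss x) ⟩
    (c + a * s) + x * (P + a * Q)
      ≡⟨ cong ((c + a * s) +_) (trans (distribˡ x P (a * Q)) (cong (x * P +_) x[aQ]≡a[xQ])) ⟩
    (c + a * s) + (x * P + a * (x * Q))
      ≡⟨ solve 4 (λ c u v w → (c :+ u) :+ (v :+ w) := (c :+ v) :+ (u :+ w))
          refl c (a * s) (x * P) (a * (x * Q)) ⟩
    (c + x * P) + (a * s + a * (x * Q))
      ≡⟨ cong ((c + x * P) +_) (distribˡ a s (x * Q)) ⟨
    (c + x * P) + a * (s + x * Q) ∎
    where
    P Q : R
    P = monic (c′ ∷ cs) x
    Q = monic ss x

    x[aQ]≡a[xQ] : x * (a * Q) ≡ a * (x * Q)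
    x[aQ]≡a[xQ] = trans (sym (*-assoc x a Q)) (trans (cong (_* Q) (*-comm x a)) (*-assoc a x Q))

  -- Division by X − a, written modulo 2 so that no signs occur.
  quotient : ∀ {d} → Vec R (suc d) → R → Vec R d
  quotient {zero}  _        a = []
  quotient {suc d} (c ∷ cs) a = addScaled cs a (quotient cs a)

  -- Let P = c + X P′ and, by induction, P′ = P′(a) + (X + a) Q. With the quotient P′ + a Q the two
  -- sides differ by a P′ taken twice, which disappears modulo 2.
  factor-≋ : ∀ {d} (cs : Vec R (suc d)) a x →
             monic cs x ≋ monic cs a + (x + a) * monic (quotient cs a) x
  factor-≋ {zero} (c ∷ []) a x = sym (begin
    (c + a * 1# + (x + a) * 1#) + (c + a * 1# + (x + a) * 1#)
      ≡⟨ cong (λ z → z + z) (begin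
        c + a * 1# + (x + a) * 1#  ≡⟨ cong₂ (λ s t → c + s + t) (*-identityʳ a) (*-identityʳ (x + a)) ⟩
        c + a + (x + a)
          ≡⟨ solve 3 (λ c a x → c :+ a :+ (x :+ a) := (c :+ x) :+ (a :+ a)) refl c a x ⟩
        (c + x) + (a + a)  ≡⟨ cong (λ s → (c + s) + (a + a)) (*-identityʳ x) ⟨
        (c + x * 1#) + (a + a)  ∎) ⟩
    ((c + x * 1#) + (a + a)) + ((c + x * 1#) + (a + a))
      ≡⟨ +double-≋ (c + x * 1#) a ⟩
    (c + x * 1#) + (c + x * 1#) ∎)
  factor-≋ {suc d} (c ∷ cs) a x = sym (begin
    (c + a * Pa + (x + a) * monic (addScaled cs a (quotient cs a)) x) + _
      ≡⟨ cong (λ z → (c + a * Pa + (x + a) * z) + (c + a * Pa + (x + a) * z))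
          (monic-addScaled cs a (quotient cs a) x) ⟩
    (c + a * Pa + (x + a) * (Px + a * Q)) + (c + a * Pa + (x + a) * (Px + a * Q))
      ≡⟨ cong (λ z → z + z) regroup ⟩
    (c + x * Px + (a * Px + a * (Pa + (x + a) * Q))) + (c + x * Px + (a * Px + a * (Pa + (x + a) * Q)))
      ≡⟨ +-cong-≋ {c + x * Px} {c + x * Px} {a * Px + a * (Pa + (x + a) * Q)} {a * Px + a * Px} refl
           (+-cong-≋ {a * Px} {a * Px} {a * (Pa + (x + a) * Q)} {a * Px} refl
             (*-cong-≋ {a} {a} {Pa + (x + a) * Q} {Px} refl (sym (factor-≋ cs a x)))) ⟩
    (c + x * Px + (a * Px + a * Px)) + (c + x * Px + (a * Px + a * Px))
      ≡⟨ +double-≋ (c + x * Px) (a * Px) ⟩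
    (c + x * Px) + (c + x * Px) ∎)
    where
    Pa Px Q : R
    Pa = monic cs a
    Px = monic cs x
    Q  = monic (quotient cs a) x

    regroup : c + a * Pa + (x + a) * (Px + a * Q) ≡ c + x * Px + (a * Px + a * (Pa + (x + a) * Q))
    regroup = begin
      c + a * Pa + (x + a) * (Px + a * Q)
        ≡⟨ cong (c + a * Pa +_) (trans (distribˡ (x + a) Px (a * Q))
            (cong₂ _+_ (distribʳ Px x a) commute)) ⟩
      c + a * Pa + ((x * Px + a * Px) + a * ((x + a) * Q))
        ≡⟨ solve 5 (λ c u v w t → c :+ u :+ ((v :+ w) :+ t) := c :+ v :+ (w :+ (u :+ t)))
            refl c (a * Pa) (x * Px) (a * Px) (a * ((x + a) * Q)) ⟩
      c + x * Px + (a * Px + (a * Pa + a * ((x + a) * Q)))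
        ≡⟨ cong (λ z → c + x * Px + (a * Px + z)) (distribˡ a Pa ((x + a) * Q)) ⟨
      c + x * Px + (a * Px + a * (Pa + (x + a) * Q)) ∎
      where
      commute : (x + a) * (a * Q) ≡ a * ((x + a) * Q)
      commute = trans (sym (*-assoc (x + a) a Q))
          (trans (cong (_* Q) (*-comm (x + a) a)) (*-assoc a (x + a) Q))

  -- Dividing off the root `r zero` leaves a polynomial of smaller degree that vanishes at the other
  -- roots, since the sums with `r zero` are units. The process ends with the constant 1.
  no-excess-roots : ∀ {d} (cs : Vec R d) (r : Fin (suc d) → R) →
                    (∀ {i j} → r i ≋ r j → i ≡ j) → ¬ (∀ i → monic cs (r i) ≋ 0#)
  no-excess-roots []       r r-injective roots = 2·1≢0 (trans (roots zero) 0+0≡0)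
  no-excess-roots {suc d} (c ∷ cs) r r-injective roots =
    no-excess-roots (quotient (c ∷ cs) a) (r ∘ suc) (Fin.suc-injective ∘ r-injective) λ i →
      trans (*-cancel-≋0 {r (suc i) + a} {Q i} (≋̸⇒unit⁺ {r (suc i)} {a} (suc≢zero ∘ r-injective)) (begin
        (r (suc i) + a) * Q i + (r (suc i) + a) * Q i
          ≡⟨ cong (λ z → z + z) (+-identityˡ ((r (suc i) + a) * Q i)) ⟨
        (0# + (r (suc i) + a) * Q i) + (0# + (r (suc i) + a) * Q i)
          ≡⟨ +-cong-≋ {0#} {monic (c ∷ cs) a} {(r (suc i) + a) * Q i} {(r (suc i) + a) * Q i}
              (sym (roots zero)) refl ⟩
        (monic (c ∷ cs) a + (r (suc i) + a) * Q i) + (monic (c ∷ cs) a + (r (suc i) + a) * Q i)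
          ≡⟨ factor-≋ (c ∷ cs) a (r (suc i)) ⟨
        monic (c ∷ cs) (r (suc i)) + monic (c ∷ cs) (r (suc i))
          ≡⟨ trans (roots (suc i)) 0+0≡0 ⟩
        0# ∎)) (sym 0+0≡0)
    where
    a : R
    a = r zero

    Q : Fin (suc d) → R
    Q i = monic (quotient (c ∷ cs) a) (r (suc i))

    suc≢zero : ∀ {i : Fin (suc d)} → suc i ≢ zero
    suc≢zero ()

  square-+-≋ : ∀ x y → (x + y) * (x + y) ≋ x * x + y * y
  square-+-≋ x y = trans (cong (λ z → z + z) (square-+ x y))
    (+-cong-≋ {x * x} {x * x} {((x + x) + y) * y} {y * y} refl
      (*-congʳ-≋ {(x + x) + y} {y} y (trans (cong (λ z → z + z) (+-comm (x + x) y)) (+double-≋ y x))))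

  integer : ℕ → R
  integer c = c · 1#

  square-integer-≋ : ∀ c → integer c * integer c ≋ integer c
  square-integer-≋ zero    = cong (λ z → z + z) (zeroˡ 0#)
  square-integer-≋ (suc c) = trans (square-+-≋ 1# (integer c))
    (+-cong-≋ {1# * 1#} {1#} {integer c * integer c} {integer c}
      (cong (λ z → z + z) (*-identityˡ 1#)) (square-integer-≋ c))

  integral : ∀ {d} → Vec ℕ d → R → R
  integral cs = monic (Vec.map integer cs)

  -- Integers satisfy c² ≡ c modulo 2 and squaring is additive modulo 2; hence the roots are closed
  -- under squaring.
  integral-square-≋ : ∀ {d} (cs : Vec ℕ d) x → integral cs (x * x) ≋ integral cs x * integral cs x
  integral-square-≋ []       x = cong (λ z → z + z) (sym (*-identityˡ 1#))
  integral-square-≋ (c ∷ cs) x = sym (begin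
    (C + x * P) * (C + x * P) + (C + x * P) * (C + x * P)
      ≡⟨ square-+-≋ C (x * P) ⟩
    (C * C + (x * P) * (x * P)) + (C * C + (x * P) * (x * P))
      ≡⟨ cong (λ z → (C * C + z) + (C * C + z)) (*-interchange x P x P) ⟩
    (C * C + (x * x) * (P * P)) + (C * C + (x * x) * (P * P))
      ≡⟨ +-cong-≋ {C * C} {C} {(x * x) * (P * P)} {(x * x) * integral cs (x * x)} (square-integer-≋ c)
           (*-cong-≋ {x * x} {x * x} {P * P} {integral cs (x * x)} refl (sym (integral-square-≋ cs x))) ⟩
    (C + (x * x) * integral cs (x * x)) + (C + (x * x) * integral cs (x * x)) ∎)
    where
    C P : R
    C = integer c
    P = integral cs x

  evaluate : ∀ {d} → Vec ℕ d → R → R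
  evaluate []       x = 0#
  evaluate (c ∷ cs) x = integer c + x * evaluate cs x

  integral≡evaluate+^ : ∀ {d} (cs : Vec ℕ d) x → integral cs x ≡ evaluate cs x + x ^ d
  integral≡evaluate+^ []       x = sym (+-identityˡ 1#)
  integral≡evaluate+^ {suc d} (c ∷ cs) x = begin
    integer c + x * integral cs x
      ≡⟨ cong (λ z → integer c + x * z) (integral≡evaluate+^ cs x) ⟩
    integer c + x * (evaluate cs x + x ^ d)
      ≡⟨ cong (integer c +_) (distribˡ x (evaluate cs x) (x ^ d)) ⟩
    integer c + (x * evaluate cs x + x * x ^ d)
      ≡⟨ +-assoc (integer c) (x * evaluate cs x) (x * x ^ d) ⟨
    (integer c + x * evaluate cs x) + x * x ^ d  ∎

  module Automorphism
    (φ : R → R)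
    (φ-+ : ∀ x y → φ (x + y) ≡ φ x + φ y)
    (φ-* : ∀ x y → φ (x * y) ≡ φ x * φ y)
    (φ-0 : φ 0# ≡ 0#)
    (φ-1 : φ 1# ≡ 1#)
    where

    φ-^ : ∀ x k → φ (x ^ k) ≡ φ x ^ k
    φ-^ x zero    = φ-1
    φ-^ x (suc k) = trans (φ-* x (x ^ k)) (cong (φ x *_) (φ-^ x k))

    φ-integer : ∀ c → φ (integer c) ≡ integer c
    φ-integer zero    = φ-0
    φ-integer (suc c) = trans (φ-+ 1# (integer c)) (cong₂ _+_ φ-1 (φ-integer c))

    φ-evaluate : ∀ {d} (cs : Vec ℕ d) x → φ (evaluate cs x) ≡ evaluate cs (φ x)
    φ-evaluate []       x = φ-0
    φ-evaluate (c ∷ cs) x = trans (φ-+ (integer c) (x * evaluate cs x))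
      (cong₂ _+_ (φ-integer c) (trans (φ-* x (evaluate cs x)) (cong (φ x *_) (φ-evaluate cs x))))

    φ-integral : ∀ {d} (cs : Vec ℕ d) x → φ (integral cs x) ≡ integral cs (φ x)
    φ-integral []       x = φ-1
    φ-integral (c ∷ cs) x = trans (φ-+ (integer c) (x * integral cs x))
      (cong₂ _+_ (φ-integer c) (trans (φ-* x (integral cs x)) (cong (φ x *_) (φ-integral cs x))))

    φξ^n≡1 : φ ξ ^ n ≡ 1#
    φξ^n≡1 = trans (sym (φ-^ ξ n)) (trans (cong φ ξ^n≡1) φ-1)

    unit-of-order : ∀ {x} → x ^ n ≡ 1# → Unit₂ x
    unit-of-order {x} x^n≡1 2x≡0 = 2·1≢0 (begin
      1# + 1#  ≡⟨ cong (λ z → z + z) x^n≡1 ⟨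
      x ^ n + x ^ n  ≡⟨ cong (λ k → x ^ k + x ^ k) (ℕ.m+[n∸m]≡n 0<n) ⟨
      x * x ^ (n ∸ 1) + x * x ^ (n ∸ 1)  ≡⟨ double-* x (x ^ (n ∸ 1)) ⟩
      (x + x) * x ^ (n ∸ 1)  ≡⟨ cong (_* x ^ (n ∸ 1)) 2x≡0 ⟩
      0# * x ^ (n ∸ 1)  ≡⟨ zeroˡ (x ^ (n ∸ 1)) ⟩
      0#  ∎)

    -- Here x = x^(n + 1) = (x²)^q, and x² depends only on the residue, so x coincides with the
    -- power of `ξ` congruent to it.
    power-of-order : ∀ {x} → x ^ n ≡ 1# → ∃ λ i → x ≡ power i
    power-of-order {x} x^n≡1 = go (unit⇒power (unit-of-order x^n≡1))
      where
      go : (∃ λ i → x ≋ power i) → ∃ λ i → x ≡ power i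
      go (i , x≋) = i , (begin
        x                            ≡⟨ *-identityʳ x ⟨
        x * 1#                       ≡⟨ cong (x *_) x^n≡1 ⟨
        x ^ suc n                  ≡⟨ cong (x ^_) 1+n≡q+q ⟩
        x ^ (q ℕ.+ q)                ≡⟨ ^-homo-* x q q ⟩
        x ^ q * x ^ q                ≡⟨ ^-distrib-* x x q ⟨
        (x * x) ^ q  ≡⟨ cong (_^ q) (square-≋ {x} {power i} x≋) ⟩
        (power i * power i) ^ q      ≡⟨ square-^q (toℕ i) ⟩
        power i  ∎)

    φ-power : ∀ i → ∃ λ i′ → φ (power i) ≡ power i′
    φ-power i = go (power-of-order φξ^n≡1)
      where
      go : (∃ λ a → φ ξ ≡ power a) → ∃ λ i′ → φ (power i) ≡ power i′
      go (a , φξ≡) = proj₁ reduced , (begin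
        φ (power i)               ≡⟨ φ-^ ξ (toℕ i) ⟩
        φ ξ ^ toℕ i               ≡⟨ cong (_^ toℕ i) φξ≡ ⟩
        (ξ ^ toℕ a) ^ toℕ i  ≡⟨ ^-assocʳ ξ (toℕ a) (toℕ i) ⟩
        ξ ^ (toℕ a ℕ.* toℕ i)     ≡⟨ proj₂ reduced ⟩
        power (proj₁ reduced)  ∎)
        where reduced = ξ^-power (toℕ a ℕ.* toℕ i)

    -- φ ξ is a root modulo 2 of a monic polynomial of degree Δ over 𝔽₂, all of whose
    -- roots are the ξ^(2^i); so φ is a power of the Frobenius automorphism.
    module _ (Δ : ℕ) (1+n≡2^Δ : suc n ≡ 2 ℕ.^ Δ)
             (coordinates : ∀ v → ∃ λ (cs : Vec ℕ Δ) → evaluate cs ξ ≡ v) where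

      -- The coordinates enter without a sign change, so the monic polynomial takes the value 2ξ^Δ
      -- at `ξ` rather than 0, which is enough modulo 2.
      cs : Vec ℕ Δ
      cs = proj₁ (coordinates (ξ ^ Δ))

      conjugate : ℕ → R
      conjugate i = ξ ^ (2 ℕ.^ i)

      conjugate-square : ∀ i → conjugate (suc i) ≡ conjugate i * conjugate i
      conjugate-square i = begin
        ξ ^ (2 ℕ.^ i ℕ.+ (2 ℕ.^ i ℕ.+ 0))  ≡⟨ cong (λ k → ξ ^ (2 ℕ.^ i ℕ.+ k)) (ℕ.+-identityʳ (2 ℕ.^ i)) ⟩
        ξ ^ (2 ℕ.^ i ℕ.+ 2 ℕ.^ i)  ≡⟨ ^-homo-* ξ (2 ℕ.^ i) (2 ℕ.^ i) ⟩
        conjugate i * conjugate i  ∎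

      root-ξ : integral cs ξ ≋ 0#
      root-ξ = begin
        integral cs ξ + integral cs ξ
          ≡⟨ cong (λ z → z + z) (trans (integral≡evaluate+^ cs ξ)
              (cong (_+ ξ ^ Δ) (proj₂ (coordinates (ξ ^ Δ))))) ⟩
        (ξ ^ Δ + ξ ^ Δ) + (ξ ^ Δ + ξ ^ Δ)
          ≡⟨ quadruple≡0 (ξ ^ Δ) ⟩
        0#
          ≡⟨ 0+0≡0 ⟨
        0# + 0# ∎

      root-conjugate : ∀ i → integral cs (conjugate i) ≋ 0#
      root-conjugate zero    = trans (cong (λ x → integral cs x + integral cs x) (*-identityʳ ξ)) root-ξ
      root-conjugate (suc i) = begin
        P (conjugate (suc i)) + P (conjugate (suc i))
          ≡⟨ cong (λ x → P x + P x) (conjugate-square i) ⟩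
        P (conjugate i * conjugate i) + P (conjugate i * conjugate i)
          ≡⟨ integral-square-≋ cs (conjugate i) ⟩
        P (conjugate i) * P (conjugate i) + P (conjugate i) * P (conjugate i)
          ≡⟨ *-cong-≋ {P (conjugate i)} {0#} {P (conjugate i)} {0#} (root-conjugate i) (root-conjugate i) ⟩
        0# * 0# + 0# * 0#
          ≡⟨ cong (λ z → z + z) (zeroˡ 0#) ⟩
        0# + 0# ∎
        where
        P : R → R
        P = integral cs

      root-φξ : integral cs (φ ξ) ≋ 0#
      root-φξ = begin
        integral cs (φ ξ) + integral cs (φ ξ)  ≡⟨ cong (λ z → z + z) (φ-integral cs ξ) ⟨
        φ (integral cs ξ) + φ (integral cs ξ)  ≡⟨ φ-+ (integral cs ξ) (integral cs ξ) ⟨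
        φ (integral cs ξ + integral cs ξ)  ≡⟨ cong φ root-ξ ⟩
        φ (0# + 0#)  ≡⟨ cong φ 0+0≡0 ⟩
        φ 0#                                       ≡⟨ φ-0 ⟩
        0#                                         ≡⟨ 0+0≡0 ⟨
        0# + 0#  ∎

      conjugate-distinct : ∀ {i j} → i < j → j < Δ → ¬ conjugate i ≋ conjugate j
      conjugate-distinct {i} {j} i<j j<Δ eq =
        ξ^-distinct (ℕ.^-monoʳ-< 2 (s≤s (s≤s z≤n)) i<j) 2^j<n (ξ^-≋⇒≡ (2 ℕ.^ i) (2 ℕ.^ j) eq)
        where
        2≤2^j : 2 ≤ 2 ℕ.^ j
        2≤2^j = ℕ.^-monoʳ-≤ 2 (ℕ.≤-trans (s≤s z≤n) i<j)

        -- From 2^j + 2 ≤ 2^j + 2^j ≤ 2^Δ = n + 1; the exponent j is positive because i < j.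
        2^j<n : 2 ℕ.^ j < n
        2^j<n = ℕ.≤-pred (ℕ.≤-trans (ℕ.≤-reflexive (ℕ.+-comm 2 (2 ℕ.^ j)))
          (ℕ.≤-trans (ℕ.+-monoʳ-≤ (2 ℕ.^ j) 2≤2^j)
            (ℕ.≤-trans (ℕ.≤-reflexive (cong (2 ℕ.^ j ℕ.+_) (sym (ℕ.+-identityʳ (2 ℕ.^ j)))))
              (ℕ.≤-trans (ℕ.^-monoʳ-≤ 2 j<Δ) (ℕ.≤-reflexive (sym 1+n≡2^Δ))))))

      -- Otherwise `φ ξ` and the Δ conjugates would be Δ + 1 incongruent roots of a monic polynomial
      -- of degree Δ. Congruence improves to equality because both sides are powers of `ξ`.
      φξ-conjugate : ∃ λ i → φ ξ ≡ conjugate i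
      φξ-conjugate = go (Fin.any? λ i → ≋-dec (φ ξ) (conjugate (toℕ i)))
        where
        roots : Fin (suc Δ) → R
        roots zero    = φ ξ
        roots (suc i) = conjugate (toℕ i)

        toConjugate : ∀ i → φ ξ ≋ conjugate i → φ ξ ≡ conjugate i
        toConjugate i eq = exact (power-of-order φξ^n≡1)
          where
          exact : (∃ λ a → φ ξ ≡ power a) → φ ξ ≡ conjugate i
          exact (a , φξ≡) = trans φξ≡ (ξ^-≋⇒≡ (toℕ a) (2 ℕ.^ i) (trans (cong (λ z → z + z) (sym φξ≡)) eq))

        go : Dec (∃ λ (i : Fin Δ) → φ ξ ≋ conjugate (toℕ i)) → ∃ λ i → φ ξ ≡ conjugate i
        go (yes (i , eq)) = toℕ i , toConjugate (toℕ i) eq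
        go (no none) = contradiction roots-vanish
            (no-excess-roots (Vec.map integer cs) roots roots-injective)
          where
          roots-vanish : ∀ i → integral cs (roots i) ≋ 0#
          roots-vanish zero    = root-φξ
          roots-vanish (suc i) = root-conjugate (toℕ i)

          roots-injective : ∀ {i j} → roots i ≋ roots j → i ≡ j
          roots-injective {zero}  {zero}  _  = refl
          roots-injective {zero}  {suc j} eq = contradiction (j , eq) none
          roots-injective {suc i} {zero}  eq = contradiction (i , sym eq) none
          roots-injective {suc i} {suc j} eq = cong suc (distinct (Fin.<-cmp i j))
            where
            distinct : Tri (i Fin.< j) (i ≡ j) (j Fin.< i) → i ≡ j
            distinct (tri< i<j _ _) = contradiction eq (conjugate-distinct i<j (Fin.toℕ<n j))
            distinct (tri≈ _ i≡j _) = i≡j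
            distinct (tri> _ _ j<i) = contradiction (sym eq) (conjugate-distinct j<i (Fin.toℕ<n i))

      fold-φ-ξ : ∀ i → φ ξ ≡ conjugate i → ∀ t → fold ξ φ t ≡ ξ ^ ((2 ℕ.^ i) ℕ.^ t)
      fold-φ-ξ i φξ≡ zero    = sym (*-identityʳ ξ)
      fold-φ-ξ i φξ≡ (suc t) = begin
        φ (fold ξ φ t)  ≡⟨ cong φ (fold-φ-ξ i φξ≡ t) ⟩
        φ (ξ ^ ((2 ℕ.^ i) ℕ.^ t))  ≡⟨ φ-^ ξ ((2 ℕ.^ i) ℕ.^ t) ⟩
        φ ξ ^ ((2 ℕ.^ i) ℕ.^ t)  ≡⟨ cong (_^ ((2 ℕ.^ i) ℕ.^ t)) φξ≡ ⟩
        (ξ ^ (2 ℕ.^ i)) ^ ((2 ℕ.^ i) ℕ.^ t)  ≡⟨ ^-assocʳ ξ (2 ℕ.^ i) ((2 ℕ.^ i) ℕ.^ t) ⟩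
        ξ ^ ((2 ℕ.^ i) ℕ.^ suc t)  ∎

      ξ^[2^Δ]^ : ∀ i → ξ ^ ((2 ℕ.^ Δ) ℕ.^ i) ≡ ξ
      ξ^[2^Δ]^ zero    = *-identityʳ ξ
      ξ^[2^Δ]^ (suc i) = begin
        ξ ^ ((2 ℕ.^ Δ) ℕ.* (2 ℕ.^ Δ) ℕ.^ i)  ≡⟨ ^-assocʳ ξ (2 ℕ.^ Δ) ((2 ℕ.^ Δ) ℕ.^ i) ⟨
        (ξ ^ (2 ℕ.^ Δ)) ^ ((2 ℕ.^ Δ) ℕ.^ i)  ≡⟨ cong (λ k → (ξ ^ k) ^ ((2 ℕ.^ Δ) ℕ.^ i)) 1+n≡2^Δ ⟨
        (ξ * ξ ^ n) ^ ((2 ℕ.^ Δ) ℕ.^ i)  ≡⟨ cong (λ x → (ξ * x) ^ ((2 ℕ.^ Δ) ℕ.^ i)) ξ^n≡1 ⟩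
        (ξ * 1#) ^ ((2 ℕ.^ Δ) ℕ.^ i)  ≡⟨ cong (_^ ((2 ℕ.^ Δ) ℕ.^ i)) (*-identityʳ ξ) ⟩
        ξ ^ ((2 ℕ.^ Δ) ℕ.^ i)                  ≡⟨ ξ^[2^Δ]^ i ⟩
        ξ  ∎

      fold-evaluate : ∀ t {d} (cs : Vec ℕ d) x → fold (evaluate cs x) φ t ≡ evaluate cs (fold x φ t)
      fold-evaluate zero    cs x = refl
      fold-evaluate (suc t) cs x = trans (cong φ (fold-evaluate t cs x)) (φ-evaluate cs (fold x φ t))

      -- The exponent of `ξ` after Δ steps is (2^i)^Δ = (2^Δ)^i, and ξ^(2^Δ) = ξ. The integer
      -- coordinates of `v` are fixed by φ.
      φ^Δ≡id : ∀ v → fold v φ Δ ≡ v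
      φ^Δ≡id v = go φξ-conjugate (coordinates v)
        where
        go : (∃ λ i → φ ξ ≡ conjugate i) → (∃ λ (cs : Vec ℕ Δ) → evaluate cs ξ ≡ v) → fold v φ Δ ≡ v
        go (i , φξ≡) (cs , refl) = trans (fold-evaluate Δ cs ξ) (cong (evaluate cs) (begin
          fold ξ φ Δ                  ≡⟨ fold-φ-ξ i φξ≡ Δ ⟩
          ξ ^ ((2 ℕ.^ i) ℕ.^ Δ)       ≡⟨ cong (ξ ^_) (begin
            (2 ℕ.^ i) ℕ.^ Δ   ≡⟨ ℕ.^-*-assoc 2 i Δ ⟩
            2 ℕ.^ (i ℕ.* Δ)  ≡⟨ cong (2 ℕ.^_) (ℕ.*-comm i Δ) ⟩
            2 ℕ.^ (Δ ℕ.* i)   ≡⟨ ℕ.^-*-assoc 2 Δ i ⟨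
            (2 ℕ.^ Δ) ℕ.^ i  ∎) ⟩
          ξ ^ ((2 ℕ.^ Δ) ℕ.^ i)       ≡⟨ ξ^[2^Δ]^ i ⟩
          ξ  ∎))

-- Syndromes of words.

module Syndromes {n q : ℕ} (G : GaloisRing n q) where

  open GaloisRingTheory G
  open TeichmüllerDifferences G
  open SumProperties (CommutativeRing.+-commutativeMonoid commutativeRing) public
    using (sum; sum-cong-≗; sum-permute)
  open MultProperties (CommutativeRing.+-monoid commutativeRing) public
    using (×-homo-+)
  open ≡-Reasoning

  infixr 8 _•_
  _•_ : ℤ₄ → R → R
  x • r = toℕ x · r

  ·-%4 : ∀ k r → (k % 4) · r ≡ k · r
  ·-%4 k r = sym (begin
    k · r  ≡⟨ cong (_· r) (m≡m%n+[m/n]*n k 4) ⟩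
    (k % 4 ℕ.+ k / 4 ℕ.* 4) · r  ≡⟨ ×-homo-+ r (k % 4) (k / 4 ℕ.* 4) ⟩
    (k % 4) · r + (k / 4 ℕ.* 4) · r  ≡⟨ cong ((k % 4) · r +_) (multiple (k / 4)) ⟩
    (k % 4) · r + 0#  ≡⟨ +-identityʳ ((k % 4) · r) ⟩
    (k % 4) · r  ∎)
    where
    multiple : ∀ l → (l ℕ.* 4) · r ≡ 0#
    multiple zero    = refl
    multiple (suc l) = begin
      (4 ℕ.+ l ℕ.* 4) · r        ≡⟨ ×-homo-+ r 4 (l ℕ.* 4) ⟩
      4 · r + (l ℕ.* 4) · r  ≡⟨ cong₂ _+_ (4·≡0 r) (multiple l) ⟩
      0# + 0#                    ≡⟨ 0+0≡0 ⟩
      0#  ∎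

  •-+ : ∀ x y r → (x ℤ₄.+ y) • r ≡ x • r + y • r
  •-+ x y r = begin
    toℕ ((toℕ x ℕ.+ toℕ y) mod 4) · r  ≡⟨ cong (_· r) (Fin.toℕ-fromℕ< (m%n<n (toℕ x ℕ.+ toℕ y) 4)) ⟩
    ((toℕ x ℕ.+ toℕ y) % 4) · r  ≡⟨ ·-%4 (toℕ x ℕ.+ toℕ y) r ⟩
    (toℕ x ℕ.+ toℕ y) · r  ≡⟨ ×-homo-+ r (toℕ x) (toℕ y) ⟩
    x • r + y • r  ∎

  -- The product H cᵀ read as an element of R instead of a column of check sums.
  syndrome : ∀ {N} → (Fin N → R) → Vec ℤ₄ N → R
  syndrome h c = sum λ i → Vec.lookup c i • h i

  -- The old contribution is added on the left instead of subtracted on the right, so no negation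
  -- occurs.
  syndrome-update : ∀ {N} (h : Fin N → R) c i x →
    syndrome h (c [ i ]≔ x) + Vec.lookup c i • h i ≡ syndrome h c + x • h i
  syndrome-update h (y ∷ c) zero x =
    solve 3 (λ s t u → s :+ t :+ u := u :+ t :+ s) refl (x • h zero) (syndrome (h ∘ suc) c) (y • h zero)
  syndrome-update h (y ∷ c) (suc i) x = begin
    y • h zero + syndrome (h ∘ suc) (c [ i ]≔ x) + Vec.lookup c i • h (suc i)  ≡⟨ +-assoc _ _ _ ⟩
    y • h zero + (syndrome (h ∘ suc) (c [ i ]≔ x) + Vec.lookup c i • h (suc i))
      ≡⟨ cong (y • h zero +_) (syndrome-update (h ∘ suc) c i x) ⟩
    y • h zero + (syndrome (h ∘ suc) c + x • h (suc i))  ≡⟨ +-assoc _ _ _ ⟨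
    y • h zero + syndrome (h ∘ suc) c + x • h (suc i)  ∎

-- Coordinates of words and the factors of D(m, n).

module _ {m n : ℕ} where

  position₀ position₁ : Fin m → Fin (m ℕ.* 2 ℕ.+ n)
  position₀ j = Fin.combine {m} {2} j 0F ↑ˡ n
  position₁ j = Fin.combine {m} {2} j 1F ↑ˡ n

  position : Fin n → Fin (m ℕ.* 2 ℕ.+ n)
  position i = (m ℕ.* 2) ↑ʳ i

  -- A view exhibiting each coordinate in the form in which `component` reads it.
  data Position : Fin (m ℕ.* 2 ℕ.+ n) → Set where
    first  : ∀ j → Position (position₀ j)
    second : ∀ j → Position (position₁ j)
    right  : ∀ i → Position (position i)

  locate : ∀ k → Position k
  locate k = go (splitAt (m ℕ.* 2) k) refl
    where
    left : ∀ l → Position (l ↑ˡ n)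
    left l = subst (λ l → Position (l ↑ˡ n)) (Fin.combine-remQuot {m} 2 l) (at (remQuot {m} 2 l))
      where
      at : ∀ jt → Position (uncurry Fin.combine jt ↑ˡ n)
      at (j , 0F) = first j
      at (j , 1F) = second j

    go : ∀ s → splitAt (m ℕ.* 2) k ≡ s → Position k
    go (inj₁ l) eq = subst Position (Fin.splitAt⁻¹-↑ˡ eq) (left l)
    go (inj₂ i) eq = subst Position (Fin.splitAt⁻¹-↑ʳ eq) (right i)

  ↑ˡ≢↑ʳ : ∀ {k l} (i : Fin k) (j : Fin l) → i ↑ˡ l ≢ k ↑ʳ j
  ↑ˡ≢↑ʳ {k} {l} i j eq with () ← trans (sym (Fin.splitAt-↑ˡ k i l))
      (trans (cong (splitAt k) eq) (Fin.splitAt-↑ʳ k l j))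

  combine↑ˡ-injective : ∀ {i j : Fin m} {s t : Fin 2} → Fin.combine i s ↑ˡ n ≡ Fin.combine j t ↑ˡ n →
      i ≡ j × s ≡ t
  combine↑ˡ-injective {i} {j} {s} {t} eq = Fin.combine-injective i s j t (Fin.↑ˡ-injective n _ _ eq)

  setComponent : ∀ f → Graph.Vertex (factor m n f) → Word m n → Word m n
  setComponent (inj₁ j) (x , y) v = (v [ position₀ j ]≔ x) [ position₁ j ]≔ y
  setComponent (inj₂ i) x       v = v [ position i ]≔ x

  component-set : ∀ f x v → component m n f (setComponent f x v) ≡ x
  component-set (inj₁ j) (x , y) v = cong₂ _,_
    (trans (Vec.lookup∘updateAt′ (position₀ j) (position₁ j)
        (λ eq → Fin.0≢1+n (proj₂ (combine↑ˡ-injective {j} {j} eq))) (v [ position₀ j ]≔ x))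
           (Vec.lookup∘updateAt (position₀ j) v))
    (Vec.lookup∘updateAt (position₁ j) (v [ position₀ j ]≔ x))
  component-set (inj₂ i) x       v = Vec.lookup∘updateAt (position i) v

  component-set-other : ∀ f g x v → g ≢ f → component m n g (setComponent f x v) ≡ component m n g v
  component-set-other (inj₁ j) (inj₁ k) (x , y) v k≢j = cong₂ _,_ (unchanged 0F) (unchanged 1F)
    where
    unchanged : ∀ t → Vec.lookup (setComponent (inj₁ j) (x , y) v) (Fin.combine k t ↑ˡ n) ≡
        Vec.lookup v (Fin.combine k t ↑ˡ n)
    unchanged t = trans
      (Vec.lookup∘updateAt′ _ (position₁ j)
          (λ eq → k≢j (cong inj₁ (proj₁ (combine↑ˡ-injective {k} {j} eq)))) (v [ position₀ j ]≔ x))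
      (Vec.lookup∘updateAt′ _ (position₀ j)
          (λ eq → k≢j (cong inj₁ (proj₁ (combine↑ˡ-injective {k} {j} eq)))) v)
  component-set-other (inj₁ j) (inj₂ i) (x , y) v _ = trans
    (Vec.lookup∘updateAt′ (position i) (position₁ j) (↑ˡ≢↑ʳ _ i ∘ sym) (v [ position₀ j ]≔ x))
    (Vec.lookup∘updateAt′ (position i) (position₀ j) (↑ˡ≢↑ʳ _ i ∘ sym) v)
  component-set-other (inj₂ i) (inj₁ j) x v _ = cong₂ _,_
    (Vec.lookup∘updateAt′ (position₀ j) (position i) (↑ˡ≢↑ʳ _ i) v)
    (Vec.lookup∘updateAt′ (position₁ j) (position i) (↑ˡ≢↑ʳ _ i) v)
  component-set-other (inj₂ i) (inj₂ k) x v k≢i =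
    Vec.lookup∘updateAt′ (position k) (position i) (k≢i ∘ cong inj₂ ∘ Fin.↑ʳ-injective (m ℕ.* 2) k i) v

  component-ext : ∀ {u v} → (∀ f → component m n f u ≡ component m n f v) → u ≡ v
  component-ext {u} {v} eq = trans (sym (Vec.tabulate∘lookup u))
    (trans (Vec.tabulate-cong (λ k → agree (locate k))) (Vec.tabulate∘lookup v))
    where
    agree : ∀ {k} → Position k → Vec.lookup u k ≡ Vec.lookup v k
    agree (first j)  = cong proj₁ (eq (inj₁ j))
    agree (second j) = cong proj₂ (eq (inj₁ j))
    agree (right i)  = eq (inj₂ i)

  agree-off⇒set : ∀ f u v → (∀ g → g ≢ f → component m n g v ≡ component m n g u) →
                  u ≡ setComponent f (component m n f u) v
  agree-off⇒set f u v eq = component-ext λ g → at g (Sum.≡-dec Fin._≟_ Fin._≟_ g f)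
    where
    at : ∀ g → Dec (g ≡ f) → component m n g u ≡ component m n g (setComponent f (component m n f u) v)
    at g (yes refl) = sym (component-set f (component m n f u) v)
    at g (no g≢f)   = sym (trans (component-set-other f g (component m n f u) v g≢f) (eq g g≢f))

-- The 1-perfect code by syndrome decoding.

module PerfectCode {n q : ℕ} (G : GaloisRing n q) where

  open GaloisRingTheory G
  open TeichmüllerDifferences G
  open Syndromes G
  open ≡-Reasoning

  -- Indexed like the factors of the graph, sixtuples before triples, the opposite of `blockOf`.
  Block : ∀ {m} → (Fin m → R × R) → Fin m ⊎ Fin n → R → Set
  Block P (inj₁ j) u = u ∈ uncurry sixtuple (P j)
  Block P (inj₂ i) u = u ∈ triple i

  record Partitioned {m : ℕ} (P : Fin m → R × R) : Set where
    field
      block-nonzero   : ∀ f {u} → Block P f u → u ≢ 0#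
      block-exists    : ∀ u → u ≢ 0# → ∃ λ f → Block P f u
      block-unique    : ∀ f g {u} → Block P f u → Block P g u → f ≡ g
      sixtuple-unique : ∀ j → Unique (uncurry sixtuple (P j))

  record IsColumnFunction {m : ℕ} (P : Fin m → R × R) (h : Fin (m ℕ.* 2 ℕ.+ n) → R) : Set where
    field
      h-first  : ∀ j → h (position₀ j) ≡ proj₁ (P j)
      h-second : ∀ j → h (position₁ j) ≡ proj₂ (P j)
      h-right  : ∀ i → h (position {m} i) ≡ power i

  -- The connecting set of `Sh`, ordered so that entry t, applied as coefficients to (a, b), gives
  -- entry t of `sixtuple a b`.
  generator : Fin 6 → ℤ₄ × ℤ₄
  generator 0F = 1F , 0F
  generator 1F = 3F , 0F
  generator 2F = 0F , 1F
  generator 3F = 0F , 3F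
  generator 4F = 1F , 1F
  generator 5F = 3F , 3F

  1•≡ : ∀ r → 1F • r ≡ r
  1•≡ = +-identityʳ

  3•≡ : ∀ r → 3F • r ≡ - r
  3•≡ r = trans (cong (λ s → r + (r + s)) (+-identityʳ r)) (sym (-‿≡triple r))

  generator-value : ∀ a b t →
    proj₁ (generator t) • a + proj₂ (generator t) • b ≡ List.lookup (sixtuple a b) t
  generator-value a b 0F = trans (+-identityʳ (1F • a)) (1•≡ a)
  generator-value a b 1F = trans (+-identityʳ (3F • a)) (3•≡ a)
  generator-value a b 2F = trans (+-identityˡ (1F • b)) (1•≡ b)
  generator-value a b 3F = trans (+-identityˡ (3F • b)) (3•≡ b)
  generator-value a b 4F = cong₂ _+_ (1•≡ a) (1•≡ b)
  generator-value a b 5F = trans (cong₂ _+_ (3•≡ a) (3•≡ b)) (-‿+-comm a b)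

  [x-y]+y≡x : ∀ x y → x ≡ (x ℤ₄.+ (ℤ₄.- y)) ℤ₄.+ y
  [x-y]+y≡x = toWitness {a? = Fin.all? λ x → Fin.all? λ y →
    x Fin.≟ ((x ℤ₄.+ (ℤ₄.- y)) ℤ₄.+ y)} _

  difference⇒sum : ∀ u v e → v ℤ₄.+ (ℤ₄.- u) ≡ e → u ≡ v ℤ₄.+ (ℤ₄.- e)
  difference⇒sum = toWitness {a? = Fin.all? λ u → Fin.all? λ v → Fin.all? λ e →
    ((v ℤ₄.+ (ℤ₄.- u)) Fin.≟ e) →-dec (u Fin.≟ (v ℤ₄.+ (ℤ₄.- e)))} _

  subtract-difference : ∀ u s → (u ℤ₄.+ (ℤ₄.- s)) ℤ₄.+ (ℤ₄.- u) ≡ ℤ₄.- s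
  subtract-difference = toWitness {a? = Fin.all? λ u → Fin.all? λ s →
    ((u ℤ₄.+ (ℤ₄.- s)) ℤ₄.+ (ℤ₄.- u)) Fin.≟ (ℤ₄.- s)} _

  +-cancelʳ₄ : ∀ x y s → x ℤ₄.+ s ≡ y ℤ₄.+ s → x ≡ y
  +-cancelʳ₄ = toWitness {a? = Fin.all? λ x → Fin.all? λ y → Fin.all? λ s →
    ((x ℤ₄.+ s) Fin.≟ (y ℤ₄.+ s)) →-dec (x Fin.≟ y)} _

  _⊞_ : ℤ₄ × ℤ₄ → ℤ₄ × ℤ₄ → ℤ₄ × ℤ₄
  (x , y) ⊞ (x′ , y′) = x ℤ₄.+ x′ , y ℤ₄.+ y′

  Sh-adjacent⇒ : ∀ u v → Graph.Adj Sh u v → ∃ λ t → u ≡ v ⊞ generator t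
  Sh-adjacent⇒ (u₁ , u₂) (v₁ , v₂) adj = go adj
    where
    by : ∀ {e} → (v₁ ℤ₄.+ (ℤ₄.- u₁) , v₂ ℤ₄.+ (ℤ₄.- u₂)) ≡ e →
         (u₁ , u₂) ≡ (v₁ , v₂) ⊞ (ℤ₄.- proj₁ e , ℤ₄.- proj₂ e)
    by {e₁ , e₂} eq = cong₂ _,_ (difference⇒sum u₁ v₁ e₁ (cong proj₁ eq))
        (difference⇒sum u₂ v₂ e₂ (cong proj₂ eq))

    go : Graph.Adj Sh (u₁ , u₂) (v₁ , v₂) → ∃ λ t → (u₁ , u₂) ≡ (v₁ , v₂) ⊞ generator t
    -- Adjacency records v - u whereas the error is u - v, so every case returns the opposite
    -- generator.
    go (here eq)                                         = 3F , by eq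
    go (there (here eq))                                 = 2F , by eq
    go (there (there (here eq)))                         = 1F , by eq
    go (there (there (there (here eq))))                 = 0F , by eq
    go (there (there (there (there (here eq)))))         = 5F , by eq
    go (there (there (there (there (there (here eq)))))) = 4F , by eq

  Sh-neighbour : ∀ u t → ∃ λ v → Graph.Adj Sh u v × u ≡ v ⊞ generator t
  Sh-neighbour (u₁ , u₂) t = (u₁ ℤ₄.+ (ℤ₄.- s₁) , u₂ ℤ₄.+ (ℤ₄.- s₂)) , adjacent t ,
    cong₂ _,_ ([x-y]+y≡x u₁ s₁) ([x-y]+y≡x u₂ s₂)
    where
    s₁ s₂ : ℤ₄
    s₁ = proj₁ (generator t)
    s₂ = proj₂ (generator t)

    difference : ∀ s₁ s₂ → ((u₁ ℤ₄.+ (ℤ₄.- s₁)) ℤ₄.+ (ℤ₄.- u₁) , (u₂ ℤ₄.+ (ℤ₄.- s₂)) ℤ₄.+ (ℤ₄.- u₂)) ≡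
        (ℤ₄.- s₁ , ℤ₄.- s₂)
    difference s₁ s₂ = cong₂ _,_ (subtract-difference u₁ s₁) (subtract-difference u₂ s₂)

    adjacent : ∀ t → Graph.Adj Sh (u₁ , u₂)
      (u₁ ℤ₄.+ (ℤ₄.- proj₁ (generator t)) , u₂ ℤ₄.+ (ℤ₄.- proj₂ (generator t)))
    adjacent 0F = there (there (there (here (difference 1F 0F))))
    adjacent 1F = there (there (here (difference 3F 0F)))
    adjacent 2F = there (here (difference 0F 1F))
    adjacent 3F = here (difference 0F 3F)
    adjacent 4F = there (there (there (there (there (here (difference 1F 1F))))))
    adjacent 5F = there (there (there (there (here (difference 3F 3F)))))

  module _ {m : ℕ} (P : Fin m → R × R) (partitioned : Partitioned P)
           (h : Fin (m ℕ.* 2 ℕ.+ n) → R) (columns : IsColumnFunction P h) where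

    open Partitioned partitioned
    open IsColumnFunction columns

    Factor : Set
    Factor = Fin m ⊎ Fin n

    V : Factor → Set
    V f = Graph.Vertex (factor m n f)

    contribution : ∀ f → V f → R
    contribution (inj₁ j) (x , y) = x • proj₁ (P j) + y • proj₂ (P j)
    contribution (inj₂ i) x       = x • power i

    syndrome-set : ∀ f x v → syndrome h (setComponent f x v) + contribution f (component m n f v) ≡
                             syndrome h v + contribution f x
    syndrome-set (inj₁ j) (x , y) v = begin
      syndrome h (v′ [ position₁ j ]≔ y) + (v₀ • a + v₁ • b)
        ≡⟨ cong₂ (λ s t → syndrome h (v′ [ position₁ j ]≔ y) + (v₀ • s + t)) (sym (h-first j))
             (cong₂ _•_ v₁≡ (sym (h-second j))) ⟩
      syndrome h (v′ [ position₁ j ]≔ y) +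
          (v₀ • h (position₀ j) + Vec.lookup v′ (position₁ j) • h (position₁ j))
        ≡⟨ solve 3 (λ s t u → s :+ (t :+ u) := (s :+ u) :+ t)
            refl _ (v₀ • h (position₀ j)) (Vec.lookup v′ (position₁ j) • h (position₁ j)) ⟩
      syndrome h (v′ [ position₁ j ]≔ y) + Vec.lookup v′ (position₁ j) • h (position₁ j) +
        v₀ • h (position₀ j)
        ≡⟨ cong (_+ v₀ • h (position₀ j)) (syndrome-update h v′ (position₁ j) y) ⟩
      syndrome h v′ + y • h (position₁ j) + v₀ • h (position₀ j)
        ≡⟨ solve 3 (λ s t u → s :+ t :+ u := s :+ u :+ t)
            refl (syndrome h v′) (y • h (position₁ j)) (v₀ • h (position₀ j)) ⟩
      syndrome h v′ + v₀ • h (position₀ j) + y • h (position₁ j)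
        ≡⟨ cong (_+ y • h (position₁ j)) (syndrome-update h v (position₀ j) x) ⟩
      syndrome h v + x • h (position₀ j) + y • h (position₁ j)
        ≡⟨ +-assoc (syndrome h v) _ _ ⟩
      syndrome h v + (x • h (position₀ j) + y • h (position₁ j))
        ≡⟨ cong₂ (λ s t → syndrome h v + (x • s + y • t)) (h-first j) (h-second j) ⟩
      syndrome h v + (x • a + y • b) ∎
      where
      a b : R
      a = proj₁ (P j)
      b = proj₂ (P j)

      v′ : Word m n
      v′ = v [ position₀ j ]≔ x

      v₀ v₁ : ℤ₄
      v₀ = Vec.lookup v (position₀ j)
      v₁ = Vec.lookup v (position₁ j)

      v₁≡ : v₁ ≡ Vec.lookup v′ (position₁ j)
      v₁≡ = sym (Vec.lookup∘updateAt′ (position₁ j) (position₀ j)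
        (λ eq → Fin.0≢1+n (sym (proj₂ (combine↑ˡ-injective {m} {n} {j} {j} eq)))) v)
    syndrome-set (inj₂ i) x v = begin
      syndrome h (v [ position {m} i ]≔ x) + vᵢ • power i
        ≡⟨ cong (λ p → syndrome h (v [ position {m} i ]≔ x) + vᵢ • p) (h-right i) ⟨
      syndrome h (v [ position {m} i ]≔ x) + vᵢ • h (position {m} i)
        ≡⟨ syndrome-update h v (position {m} i) x ⟩
      syndrome h v + x • h (position {m} i)
        ≡⟨ cong (λ p → syndrome h v + x • p) (h-right i) ⟩
      syndrome h v + x • power i  ∎
      where
      vᵢ : ℤ₄
      vᵢ = Vec.lookup v (position {m} i)

    contribution-⊞ : ∀ j u v → contribution (inj₁ j) (u ⊞ v) ≡ contribution (inj₁ j) u +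
        contribution (inj₁ j) v
    contribution-⊞ j (x , y) (x′ , y′) = trans
      (cong₂ _+_ (•-+ x x′ (proj₁ (P j))) (•-+ y y′ (proj₂ (P j))))
      (solve 4 (λ s t u v → (s :+ t) :+ (u :+ v) := (s :+ u) :+ (t :+ v)) refl _ _ _ _)

    multiple-∈-triple : ∀ i (t : ℤ₄) → t ≢ 0F → t • power i ∈ triple i
    multiple-∈-triple i 0F t≢0 = contradiction refl t≢0
    multiple-∈-triple i 1F _   = here (+-identityʳ (power i))
    multiple-∈-triple i 2F _   = there (here refl)
    multiple-∈-triple i 3F _   = there (there (here refl))

    triple-multiple : ∀ i {u} → u ∈ triple i → ∃ λ t → t ≢ 0F × u ≡ t • power i
    triple-multiple i (here refl)                 = 1F , (λ ()) , sym (+-identityʳ (power i))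
    triple-multiple i (there (here refl))         = 2F , (λ ()) , refl
    triple-multiple i (there (there (here refl))) = 3F , (λ ()) , refl

    adjacent⇒block : ∀ f u v → Graph.Adj (factor m n f) u v →
                     ∃ λ d → Block P f d × contribution f u ≡ contribution f v + d
    adjacent⇒block (inj₁ j) u v adj with Sh-adjacent⇒ u v adj
    ... | t , refl = List.lookup (uncurry sixtuple (P j)) t , ∈-lookup {xs = uncurry sixtuple (P j)} t ,
      trans (contribution-⊞ j v (generator t))
          (cong (contribution (inj₁ j) v +_) (generator-value (proj₁ (P j)) (proj₂ (P j)) t))
    adjacent⇒block (inj₂ i) u v u≢v = t • power i , multiple-∈-triple i t t≢0 , (begin
      u • power i  ≡⟨ cong (_• power i) ([x-y]+y≡x u v) ⟩
      (t ℤ₄.+ v) • power i      ≡⟨ •-+ t v (power i) ⟩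
      t • power i + v • power i  ≡⟨ +-comm (t • power i) (v • power i) ⟩
      v • power i + t • power i  ∎)
      where
      t : ℤ₄
      t = u ℤ₄.+ (ℤ₄.- v)

      t≢0 : t ≢ 0F
      t≢0 t≡0 = u≢v (trans ([x-y]+y≡x u v) (trans (cong (ℤ₄._+ v) t≡0) (0+ v)))
        where
        0+ : ∀ v → 0F ℤ₄.+ v ≡ v
        0+ = toWitness {a? = Fin.all? λ v → (0F ℤ₄.+ v) Fin.≟ v} _

    block⇒neighbour : ∀ f u d → Block P f d →
      ∃ λ v → Graph.Adj (factor m n f) u v × contribution f u ≡ contribution f v + d
    block⇒neighbour (inj₁ j) u d d∈ = go (Sh-neighbour u t)
      where
      t : Fin 6
      t = Any.index d∈

      go : (∃ λ v → Graph.Adj Sh u v × u ≡ v ⊞ generator t) →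
           ∃ λ v → Graph.Adj Sh u v × contribution (inj₁ j) u ≡ contribution (inj₁ j) v + d
      go (v , adj , u≡) = v , adj , (begin
        contribution (inj₁ j) u
          ≡⟨ cong (contribution (inj₁ j)) u≡ ⟩
        contribution (inj₁ j) (v ⊞ generator t)
          ≡⟨ contribution-⊞ j v (generator t) ⟩
        contribution (inj₁ j) v + contribution (inj₁ j) (generator t)
          ≡⟨ cong (contribution (inj₁ j) v +_)
              (trans (generator-value (proj₁ (P j)) (proj₂ (P j)) t) (sym (Any.lookup-index d∈))) ⟩
        contribution (inj₁ j) v + d ∎)
    block⇒neighbour (inj₂ i) u d d∈ = go (triple-multiple i d∈)
      where
      distinct : ∀ u t → u ≡ u ℤ₄.+ (ℤ₄.- t) → t ≡ 0F
      distinct = toWitness {a? = Fin.all? λ u → Fin.all? λ t →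
        (u Fin.≟ (u ℤ₄.+ (ℤ₄.- t))) →-dec (t Fin.≟ 0F)} _

      go : (∃ λ t → t ≢ 0F × d ≡ t • power i) →
           ∃ λ v → u ≢ v × u • power i ≡ v • power i + d
      go (t , t≢0 , d≡) = u ℤ₄.+ (ℤ₄.- t) , t≢0 ∘ distinct u t , (begin
        u • power i  ≡⟨ cong (_• power i) ([x-y]+y≡x u t) ⟩
        ((u ℤ₄.+ (ℤ₄.- t)) ℤ₄.+ t) • power i  ≡⟨ •-+ (u ℤ₄.+ (ℤ₄.- t)) t (power i) ⟩
        (u ℤ₄.+ (ℤ₄.- t)) • power i + t • power i  ≡⟨ cong ((u ℤ₄.+ (ℤ₄.- t)) • power i +_) d≡ ⟨
        (u ℤ₄.+ (ℤ₄.- t)) • power i + d  ∎)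

    -- In a factor `Sh` this is the distinctness of the six elements of the sixtuple; in a factor K₄
    -- it is the non-vanishing of the triple. It gives uniqueness of the codeword once the factor is
    -- known.
    contribution-injective : ∀ f u v v′ → Graph.Adj (factor m n f) u v → Graph.Adj (factor m n f) u v′ →
                             contribution f v ≡ contribution f v′ → v ≡ v′
    contribution-injective (inj₁ j) u v v′ adj adj′ eq with Sh-adjacent⇒ u v adj | Sh-adjacent⇒ u v′ adj′
    ... | t , u≡ | t′ , u≡′ = cong₂ _,_
      (+-cancelʳ₄ (proj₁ v) (proj₁ v′) (proj₁ (generator t)) (cong proj₁ same))
      (+-cancelʳ₄ (proj₂ v) (proj₂ v′) (proj₂ (generator t)) (cong proj₂ same))
      where
      c : ℤ₄ × ℤ₄ → R
      c = contribution (inj₁ j)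

      t≡t′ : t ≡ t′
      t≡t′ = unique-lookup-injective (sixtuple-unique j) t t′ (begin
        List.lookup (uncurry sixtuple (P j)) t  ≡⟨ generator-value (proj₁ (P j)) (proj₂ (P j)) t ⟨
        c (generator t)  ≡⟨ +-cancelˡ (c v) _ _ (begin
          c v + c (generator t)  ≡⟨ contribution-⊞ j v (generator t) ⟨
          c (v ⊞ generator t)  ≡⟨ cong c (trans (sym u≡) u≡′) ⟩
          c (v′ ⊞ generator t′)  ≡⟨ contribution-⊞ j v′ (generator t′) ⟩
          c v′ + c (generator t′)  ≡⟨ cong (_+ c (generator t′)) eq ⟨
          c v + c (generator t′)  ∎) ⟩
        c (generator t′)  ≡⟨ generator-value (proj₁ (P j)) (proj₂ (P j)) t′ ⟩
        List.lookup (uncurry sixtuple (P j)) t′  ∎)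

      same : v ⊞ generator t ≡ v′ ⊞ generator t
      same = trans (sym u≡) (trans u≡′ (cong (λ t → v′ ⊞ generator t) (sym t≡t′)))
    contribution-injective (inj₂ i) u v v′ _ _ eq with v Fin.≟ v′
    ... | yes v≡v′ = v≡v′
    ... | no v≢v′ = go (adjacent⇒block (inj₂ i) v v′ v≢v′)
      where
      go : (∃ λ d → d ∈ triple i × v • power i ≡ v′ • power i + d) → v ≡ v′
      go (d , d∈ , eq′) = contradiction
        (sym (+-cancelˡ (v′ • power i) 0# d (trans (+-identityʳ (v′ • power i)) (trans (sym eq) eq′))))
        (block-nonzero (inj₂ i) d∈)

    data Near (v c : Word m n) : Set where
      equal  : c ≡ v → Near v c
      differ : ∀ f → Graph.Adj (factor m n f) (component m n f v) (component m n f c) →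
               c ≡ setComponent f (component m n f c) v → Near v c

    near : ∀ {v c} → DistanceAtMost (D m n) 1 v c → Near v c
    near (0 , _ , stop) = equal refl
    near {v} {c} (1 , _ , step (f , adj , agree) stop) =
      differ f adj (agree-off⇒set f c v agree)
    near (suc (suc _) , s≤s () , _)

    adjacent-set : ∀ f x v → Graph.Adj (factor m n f) (component m n f v) x →
                   DistanceAtMost (D m n) 1 v (setComponent f x v)
    adjacent-set f x v adj = 1 , s≤s z≤n ,
      step (f , subst (Graph.Adj (factor m n f) (component m n f v)) (sym (component-set f x v)) adj
              , λ g g≢f → sym (component-set-other f g x v g≢f)) stop

    syndrome-shift : ∀ f x v d → contribution f (component m n f v) ≡ contribution f x + d →
                     syndrome h v ≡ syndrome h (setComponent f x v) + d
    syndrome-shift f x v d eq = +-cancelʳ (contribution f x) _ _ (begin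
      syndrome h v + contribution f x  ≡⟨ syndrome-set f x v ⟨
      syndrome h (setComponent f x v) + contribution f (component m n f v)
        ≡⟨ cong (syndrome h (setComponent f x v) +_) eq ⟩
      syndrome h (setComponent f x v) + (contribution f x + d)
        ≡⟨ solve 3 (λ s t u → s :+ (t :+ u) := (s :+ u) :+ t)
            refl (syndrome h (setComponent f x v)) (contribution f x) d ⟩
      syndrome h (setComponent f x v) + d + contribution f x  ∎)

    Codeword : Word m n → Set
    Codeword c = syndrome h c ≡ 0#

    -- Since `c` has syndrome 0, the syndrome of `v` is the contribution of the error alone; its
    -- block therefore reveals the factor in which `v` and `c` differ.
    codeword-differ : ∀ f {v c} → Codeword c →
        Graph.Adj (factor m n f) (component m n f v) (component m n f c) →
                      c ≡ setComponent f (component m n f c) v →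
                      Block P f (syndrome h v) ×
                      contribution f (component m n f v) ≡ contribution f (component m n f c) + syndrome h v
    codeword-differ f {v} {c} c∈C adj c≡ = go (adjacent⇒block f (component m n f v) x adj)
      where
      x : V f
      x = component m n f c

      go : (∃ λ d → Block P f d × contribution f (component m n f v) ≡ contribution f x + d) →
           Block P f (syndrome h v) × contribution f (component m n f v) ≡ contribution f x + syndrome h v
      go (d , d∈ , eq) = subst
          (λ d → Block P f d × contribution f (component m n f v) ≡ contribution f x + d) (sym s≡d) (d∈ , eq)
        where
        s≡d : syndrome h v ≡ d
        s≡d = begin
          syndrome h v  ≡⟨ syndrome-shift f x v d eq ⟩
          syndrome h (setComponent f x v) + d  ≡⟨ cong (λ c → syndrome h c + d) c≡ ⟨
          syndrome h c + d  ≡⟨ cong (_+ d) c∈C ⟩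
          0# + d  ≡⟨ +-identityˡ d ⟩
          d  ∎

    -- A zero syndrome lies in no block, so `v` is its own codeword. A non-zero one lies in exactly
    -- one block, which names the factor to correct, and the element within the block names the
    -- neighbour.
    perfect : IsPerfect₁ (D m n) Codeword
    perfect v = go (syndrome h v ≟ 0#)
      where
      Unique-codeword : Set
      Unique-codeword = ∃! _≡_ λ c → Codeword c × DistanceAtMost (D m n) 1 v c

      go : Dec (syndrome h v ≡ 0#) → Unique-codeword
      go (yes s≡0) = v , (s≡0 , 0 , z≤n , stop) , λ (c∈C , close) → unique c∈C (near close)
        where
        unique : ∀ {c} → Codeword c → Near v c → v ≡ c
        unique c∈C (equal c≡v)        = sym c≡v
        unique c∈C (differ f adj c≡) =
            contradiction s≡0 (block-nonzero f (proj₁ (codeword-differ f c∈C adj c≡)))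
      go (no s≢0) = build (block-exists (syndrome h v) s≢0)
        where
        build : (∃ λ f → Block P f (syndrome h v)) → Unique-codeword
        build (f , s∈f) = finish (block⇒neighbour f (component m n f v) (syndrome h v) s∈f)
          where
          finish : (∃ λ x → Graph.Adj (factor m n f) (component m n f v) x ×
                            contribution f (component m n f v) ≡ contribution f x + syndrome h v) →
                                Unique-codeword
          finish (x , adj , eq) = setComponent f x v , (c∈C , adjacent-set f x v adj) ,
            λ (c′∈C , close) → unique c′∈C (near close)
            where
            c∈C : Codeword (setComponent f x v)
            c∈C = sym (+-cancelʳ (syndrome h v) _ _
                (trans (+-identityˡ (syndrome h v)) (syndrome-shift f x v (syndrome h v) eq)))

            unique : ∀ {c} → Codeword c → Near v c → setComponent f x v ≡ c
            unique c∈C (equal refl) = contradiction c∈C s≢0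
            unique {c} c∈C (differ g adj′ c≡) =
                align g adj′ c≡ (block-unique f g s∈f (proj₁ (codeword-differ g c∈C adj′ c≡)))
              where
              align : ∀ g → Graph.Adj (factor m n g) (component m n g v) (component m n g c) →
                      c ≡ setComponent g (component m n g c) v → f ≡ g → setComponent f x v ≡ c
              align g adj′ c≡ refl = sym (trans c≡ (cong (λ y → setComponent f y v)
                (contribution-injective f (component m n f v) (component m n f c) x adj′ adj
                  (+-cancelʳ (syndrome h v) _ _ (trans (sym (proj₂ (codeword-differ f c∈C adj′ c≡))) eq)))))

-- Iterates of a map of finite order.

module _ {A : Set} (f : A → A) where

  fold-suc : ∀ t x → fold (f x) f t ≡ f (fold x f t)
  fold-suc t x = trans (sym (fold-+ x f t {1})) (cong (fold x f) (ℕ.+-comm t 1))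

  fold-* : ∀ s t x → fold x (λ y → fold y f t) s ≡ fold x f (s ℕ.* t)
  fold-* zero    t x = refl
  fold-* (suc s) t x = trans (cong (λ y → fold y f t) (fold-* s t x)) (sym (fold-+ x f t))

  fold-period : ∀ s t {x} → fold x f t ≡ x → fold x f (s ℕ.* t) ≡ x
  fold-period zero    t eq = refl
  fold-period (suc s) t {x} eq =
      trans (fold-+ x f t) (trans (cong (λ y → fold y f t) (fold-period s t eq)) eq)

  fold-injective : (∀ {x y} → f x ≡ f y → x ≡ y) → ∀ t {x y} → fold x f t ≡ fold y f t → x ≡ y
  fold-injective f-injective zero    eq = eq
  fold-injective f-injective (suc t) eq = fold-injective f-injective t (f-injective eq)

  order⇒injective : ∀ t → (∀ x → fold x f (suc t) ≡ x) → ∀ {x y} → f x ≡ f y → x ≡ y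
  order⇒injective t order {x} {y} eq = trans (sym (order x))
    (trans (sym (fold-suc t x)) (trans (cong (λ z → fold z f t) eq) (trans (fold-suc t y) (order y))))

-- Additive symmetries of sixtuples and permutations of coordinates.

module Symmetries {n q : ℕ} (G : GaloisRing n q) where

  open GaloisRingTheory G
  open TeichmüllerDifferences G
  open TeichmüllerPartition G using (blockOf)
  open Syndromes G
  open PerfectCode G
  open ≡-Reasoning

  additive⇒0 : (f : R → R) → (∀ x y → f (x + y) ≡ f x + f y) → f 0# ≡ 0#
  additive⇒0 f f-+ = +-cancelˡ (f 0#) (f 0#) 0#
    (trans (sym (f-+ 0# 0#)) (trans (cong f 0+0≡0) (sym (+-identityʳ (f 0#)))))

  additive⇒neg : (f : R → R) → (∀ x y → f (x + y) ≡ f x + f y) → ∀ x → f (- x) ≡ - f x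
  additive⇒neg f f-+ x = -‿unique (f x) (f (- x))
    (trans (sym (f-+ x (- x))) (trans (cong f (-‿inverseʳ x)) (additive⇒0 f f-+)))

  map-sixtuple : (f : R → R) → (∀ x y → f (x + y) ≡ f x + f y) → ∀ a b →
                 map f (sixtuple a b) ≡ sixtuple (f a) (f b)
  map-sixtuple f f-+ a b
    rewrite additive⇒neg f f-+ a | additive⇒neg f f-+ b | additive⇒neg f f-+ (a + b) | f-+ a b = refl

  -- A signed permutation of {±a, ±b, ±(a+b)} has order dividing 12, because among
  -- u, g u, g² u, g³ u two agree up to sign.
  module SignedPermutation (g : R → R) (g-+ : ∀ x y → g (x + y) ≡ g x + g y) (k : ℕ)
                           (g-order : ∀ x → fold x g (suc (k ℕ.* 12)) ≡ x) where

    g-injective : ∀ {x y} → g x ≡ g y → x ≡ y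
    g-injective = order⇒injective g (k ℕ.* 12) g-order

    fold-neg : ∀ t x → fold (- x) g t ≡ - fold x g t
    fold-neg zero    x = refl
    fold-neg (suc t) x = trans (cong g (fold-neg t x)) (additive⇒neg g g-+ (fold x g t))

    base : R → R → Fin 3 → R
    base a b 0F = a
    base a b 1F = b
    base a b 2F = a + b

    sign : ∀ {a b u} → u ∈ sixtuple a b → ∃ λ c → u ≡ base a b c ⊎ u ≡ - base a b c
    sign (here eq)                                         = 0F , inj₁ eq
    sign (there (here eq))                                 = 0F , inj₂ eq
    sign (there (there (here eq)))                         = 1F , inj₁ eq
    sign (there (there (there (here eq))))                 = 1F , inj₂ eq
    sign (there (there (there (there (here eq)))))         = 2F , inj₁ eq
    sign (there (there (there (there (there (here eq)))))) = 2F , inj₂ eq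

    same-base : ∀ {u v w} → (u ≡ w ⊎ u ≡ - w) → (v ≡ w ⊎ v ≡ - w) → v ≡ u ⊎ v ≡ - u
    same-base (inj₁ refl) (inj₁ refl) = inj₁ refl
    same-base (inj₁ refl) (inj₂ refl) = inj₂ refl
    same-base {w = w} (inj₂ refl) (inj₁ refl) = inj₂ (sym (-‿involutive w))
    same-base (inj₂ refl) (inj₂ refl) = inj₁ refl

    -- Doubling the time absorbs the sign, as iterates of an additive map commute with negation.
    return : ∀ {u} d → fold u g d ≡ u ⊎ fold u g d ≡ - u → fold u g (d ℕ.+ d) ≡ u
    return {u} d (inj₁ eq) = trans (fold-+ u g d) (trans (cong (λ v → fold v g d) eq) eq)
    return {u} d (inj₂ eq) = begin
      fold u g (d ℕ.+ d)        ≡⟨ fold-+ u g d ⟩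
      fold (fold u g d) g d  ≡⟨ cong (λ v → fold v g d) eq ⟩
      fold (- u) g d            ≡⟨ fold-neg d u ⟩
      - fold u g d              ≡⟨ cong -_ eq ⟩
      - - u                     ≡⟨ -‿involutive u ⟩
      u  ∎

    divides-12 : ∀ d → 0 < d → d < 4 → ∃ λ e → 12 ≡ e ℕ.* (d ℕ.+ d)
    divides-12 1 _ _ = 6 , refl
    divides-12 2 _ _ = 3 , refl
    divides-12 3 _ _ = 2 , refl
    divides-12 (suc (suc (suc (suc d)))) _ (s≤s (s≤s (s≤s (s≤s ()))))

    fixes : ∀ {a b} → (∀ {u} → u ∈ sixtuple a b → g u ∈ sixtuple a b) →
            ∀ {u} → u ∈ sixtuple a b → g u ≡ u
    fixes {a} {b} stable {u} u∈ = repeated (Fin.pigeonhole (ℕ.≤-refl {4}) class)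
      where
      orbit∈ : ∀ t → fold u g t ∈ sixtuple a b
      orbit∈ zero    = u∈
      orbit∈ (suc t) = stable (orbit∈ t)

      class : Fin 4 → Fin 3
      class t = proj₁ (sign (orbit∈ (toℕ t)))

      finish : ∀ d → (∃ λ e → 12 ≡ e ℕ.* (d ℕ.+ d)) → fold u g (d ℕ.+ d) ≡ u → g u ≡ u
      -- The exponent `suc (k * 12)` is one step more than a multiple of the period 12, so that
      -- single step does nothing to u.
      finish d (e , 12≡) eq = trans (cong g (sym (fold-period g k 12 period-12))) (g-order u)
        where
        period-12 : fold u g 12 ≡ u
        period-12 = subst (λ t → fold u g t ≡ u) (sym 12≡) (fold-period g e (d ℕ.+ d) eq)

      repeated : (∃₂ λ i j → i Fin.< j × class i ≡ class j) → g u ≡ u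
      repeated (i , j , i<j , same) = finish d
        (divides-12 d (ℕ.m<n⇒0<n∸m i<j) (ℕ.≤-<-trans (ℕ.m∸n≤m (toℕ j) (toℕ i)) (Fin.toℕ<n j)))
        (return d (shifted (same-base (proj₂ (sign (orbit∈ (toℕ i))))
          (subst (λ c → fold u g (toℕ j) ≡ base a b c ⊎ fold u g (toℕ j) ≡ - base a b c) (sym same)
              (proj₂ (sign (orbit∈ (toℕ j))))))))
        where
        d : ℕ
        d = toℕ j ∸ toℕ i

        split : fold u g (toℕ j) ≡ fold (fold u g d) g (toℕ i)
        split = trans (cong (fold u g) (sym (ℕ.m+[n∸m]≡n (ℕ.<⇒≤ i<j)))) (fold-+ u g (toℕ i))

        shifted : fold u g (toℕ j) ≡ fold u g (toℕ i) ⊎ fold u g (toℕ j) ≡ - fold u g (toℕ i) →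
                  fold u g d ≡ u ⊎ fold u g d ≡ - u
        shifted (inj₁ eq) = inj₁ (fold-injective g g-injective (toℕ i) (trans (sym split) eq))
        shifted (inj₂ eq) = inj₂ (fold-injective g g-injective (toℕ i)
          (trans (sym split) (trans eq (sym (fold-neg (toℕ i) u)))))

  record Partition {m : ℕ} (S : Fin m → Pred R 0ℓ) : Set where
    field
      sixtuples : ∀ j → ∃₂ λ a b → Unique (sixtuple a b) × S j ≐ (_∈ sixtuple a b)
      nonzero   : ∀ k u → blockOf S k u → u ≢ 0#
      covers    : ∀ u → u ≢ 0# → ∃ λ k → blockOf S k u
      disjoint  : ∀ k l {u} → blockOf S k u → blockOf S l u → k ≡ l

  Choice : ∀ {m} → (Fin m → Pred R 0ℓ) → (Fin m → R × R) → Set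
  Choice S P = ∀ j → S j ≐ (_∈ uncurry sixtuple (P j))

  choice⇒partitioned : ∀ {m} {S : Fin m → Pred R 0ℓ} {P} → Partition S → Choice S P → Partitioned P
  choice⇒partitioned {m} {S} {P} partition choice = record
    { block-nonzero   = λ f {u} u∈ → nonzero (flip f) u (toS f u∈)
    ; block-exists    = λ u u≢0 → exists (covers u u≢0)
    ; block-unique    = λ f g u∈f u∈g → flip-injective f g
        (disjoint (flip f) (flip g) (toS f u∈f) (toS g u∈g))
    ; sixtuple-unique = λ j → unique j (sixtuples j)
    }
    where
    open Partition partition

    flip : Fin m ⊎ Fin n → Fin n ⊎ Fin m
    flip (inj₁ j) = inj₂ j
    flip (inj₂ i) = inj₁ i

    flip-injective : ∀ f g → flip f ≡ flip g → f ≡ g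
    flip-injective (inj₁ _) (inj₁ _) refl = refl
    flip-injective (inj₂ _) (inj₂ _) refl = refl

    toS : ∀ f {u} → Block P f u → blockOf S (flip f) u
    toS (inj₁ j) = proj₂ (choice j)
    toS (inj₂ i) u∈ = u∈

    exists : ∀ {u} → (∃ λ k → blockOf S k u) → ∃ λ f → Block P f u
    exists (inj₁ i , u∈) = inj₂ i , u∈
    exists (inj₂ j , u∈) = inj₁ j , proj₁ (choice j) u∈

    unique : ∀ j → (∃₂ λ a b → Unique (sixtuple a b) × S j ≐ (_∈ sixtuple a b)) →
        Unique (uncurry sixtuple (P j))
    unique j (a , b , ab! , S≐) = unique-⊆⇒unique _≟_ ab! (proj₁ (choice j) ∘ proj₂ S≐) ℕ.≤-refl

  module _ {m : ℕ} {P : Fin m → R × R} (partitioned : Partitioned P)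
           {h : Fin (m ℕ.* 2 ℕ.+ n) → R} (columns : IsColumnFunction P h) where

    open Partitioned partitioned
    open IsColumnFunction columns

    columnFactor : ∀ {k} → Position {m} {n} k → Fin m ⊎ Fin n
    columnFactor (first j)  = inj₁ j
    columnFactor (second j) = inj₁ j
    columnFactor (right i)  = inj₂ i

    column∈block : ∀ {k} (p : Position {m} {n} k) → Block P (columnFactor p) (h k)
    column∈block (first j)  = here (h-first j)
    column∈block (second j) = there (there (here (h-second j)))
    column∈block (right i)  = here (h-right i)

    first≢second : ∀ j → proj₁ (P j) ≢ proj₂ (P j)
    first≢second j with sixtuple-unique j
    ... | (_ ∷ a≢b ∷ _) ∷ _ = a≢b

    column-injective : ∀ {k l} → h k ≡ h l → k ≡ l
    column-injective {k} {l} eq = go (locate {m} {n} k) (locate {m} {n} l) eq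
      where
      same-factor : ∀ {k l} (p : Position {m} {n} k) (p′ : Position {m} {n} l) → h k ≡ h l →
          columnFactor p ≡ columnFactor p′
      same-factor p p′ eq = block-unique (columnFactor p) (columnFactor p′) (column∈block p)
        (subst (Block P (columnFactor p′)) (sym eq) (column∈block p′))

      clash : ∀ {i j} → h (position₀ {m} {n} i) ≡ h (position₁ {m} {n} j) → i ≢ j
      clash {i} eq refl = first≢second i (trans (sym (h-first i)) (trans eq (h-second i)))

      inj₁-injective : ∀ {i j : Fin m} → inj₁ {B = Fin n} i ≡ inj₁ j → i ≡ j
      inj₁-injective refl = refl

      go : ∀ {k l} → Position {m} {n} k → Position {m} {n} l → h k ≡ h l → k ≡ l
      go (first i)  (first j)  eq = cong position₀ (inj₁-injective (same-factor (first i) (first j) eq))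
      go (first i)  (second j) eq =
          contradiction (inj₁-injective (same-factor (first i) (second j) eq)) (clash eq)
      go (second i) (first j)  eq =
          contradiction (sym (inj₁-injective (same-factor (second i) (first j) eq))) (clash (sym eq))
      go (second i) (second j) eq = cong position₁ (inj₁-injective (same-factor (second i) (second j) eq))
      go (right i)  (right j)  eq =
          cong (position {m}) (power-injective (trans (sym (h-right i)) (trans eq (h-right j))))
      go (first i)  (right j)  eq with () ← same-factor (first i) (right j) eq
      go (second i) (right j)  eq with () ← same-factor (second i) (right j) eq
      go (right i)  (first j)  eq with () ← same-factor (right i) (first j) eq
      go (right i)  (second j) eq with () ← same-factor (right i) (second j) eq

  module _ {N : ℕ} (h : Fin N → R) (h-injective : ∀ {k l} → h k ≡ h l → k ≡ l)
           (φ : R → R) (φ-+ : ∀ x y → φ (x + y) ≡ φ x + φ y)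
               (φ-injective : ∀ {x y} → φ x ≡ φ y → x ≡ y) where

    IsColumnOf : Pred R 0ℓ
    IsColumnOf r = ∃ λ i → h i ≡ r

    Corresponding : Permutation′ N → Set
    Corresponding π = ∀ i → h (π ⟨$⟩ʳ i) ≡ φ (h i)

    permutation : Image φ IsColumnOf ≐ IsColumnOf → ∃! Perm._≈_ Corresponding
    permutation (image⊆ , image⊇) = Perm.permutation to from to∘from from∘to , proj₂ ∘ forward ,
      λ {π} corresponds i → h-injective (trans (proj₂ (forward i)) (sym (corresponds i)))
      where
      forward : ∀ i → IsColumnOf (φ (h i))
      forward i = image⊆ (h i , (i , refl) , refl)

      to : Fin N → Fin N
      to = proj₁ ∘ forward

      backward : ∀ k → ∃ λ i → φ (h i) ≡ h k
      backward k = go (image⊇ (k , refl))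
        where
        go : Image φ IsColumnOf (h k) → ∃ λ i → φ (h i) ≡ h k
        go (_ , (i , refl) , eq) = i , eq

      from : Fin N → Fin N
      from = proj₁ ∘ backward

      to∘from : ∀ k → to (from k) ≡ k
      to∘from k = h-injective (trans (proj₂ (forward (from k))) (proj₂ (backward k)))

      from∘to : ∀ i → from (to i) ≡ i
      from∘to i = h-injective (φ-injective (trans (proj₂ (backward (to i))) (proj₂ (forward i))))

    φ-· : ∀ t x → φ (t · x) ≡ t · φ x
    φ-· zero    x = additive⇒0 φ φ-+
    φ-· (suc t) x = trans (φ-+ x (t · x)) (cong (φ x +_) (φ-· t x))

    φ-sum : ∀ {k} (f : Fin k → R) → φ (sum f) ≡ sum (φ ∘ f)
    φ-sum {zero}  f = additive⇒0 φ φ-+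
    φ-sum {suc k} f = trans (φ-+ (f zero) (sum (f ∘ suc))) (cong (φ (f zero) +_) (φ-sum (f ∘ suc)))

    -- Reindexing the sum along π replaces each column by its image under φ, and additivity takes φ
    -- out of the sum. Membership in the code is then preserved both ways because φ is injective.
    syndrome-permute : ∀ π → Corresponding π → ∀ c → syndrome h (permute π c) ≡ φ (syndrome h c)
    syndrome-permute π corresponds c = begin
      sum (λ k → Vec.lookup (permute π c) k • h k)
        ≡⟨ sum-permute (λ k → Vec.lookup (permute π c) k • h k) π ⟩
      sum (λ i → Vec.lookup (permute π c) (π ⟨$⟩ʳ i) • h (π ⟨$⟩ʳ i))
        ≡⟨ sum-cong-≗ (λ i → cong₂ _•_
            (trans (Vec.lookup∘tabulate _ (π ⟨$⟩ʳ i)) (cong (Vec.lookup c) (Perm.inverseˡ π)))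
                (corresponds i)) ⟩
      sum (λ i → Vec.lookup c i • φ (h i))
        ≡⟨ sum-cong-≗ (λ i → φ-· (toℕ (Vec.lookup c i)) (h i)) ⟨
      sum (λ i → φ (Vec.lookup c i • h i))
        ≡⟨ φ-sum (λ i → Vec.lookup c i • h i) ⟨
      φ (syndrome h c) ∎

    automorphism : ∀ π → Corresponding π → IsAutomorphism (λ c → syndrome h c ≡ 0#) π
    automorphism π corresponds = into , onto
      where
      into : ∀ {d} → Image (permute π) (λ c → syndrome h c ≡ 0#) d → syndrome h d ≡ 0#
      into (c , c∈C , refl) = trans (syndrome-permute π corresponds c)
          (trans (cong φ c∈C) (additive⇒0 φ φ-+))

      onto : ∀ {d} → syndrome h d ≡ 0# → Image (permute π) (λ c → syndrome h c ≡ 0#) d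
      onto {d} d∈C = c , φ-injective (begin
        φ (syndrome h c)  ≡⟨ syndrome-permute π corresponds c ⟨
        syndrome h (permute π c)  ≡⟨ cong (syndrome h) permuted ⟩
        syndrome h d                ≡⟨ d∈C ⟩
        0#                          ≡⟨ additive⇒0 φ φ-+ ⟨
        φ 0#  ∎) , permuted
        where
        c : Vec ℤ₄ N
        c = permute (Perm.flip π) d

        permuted : permute π c ≡ d
        permuted = trans (Vec.tabulate-cong
            (λ k → trans (Vec.lookup∘tabulate _ (π ⟨$⟩ˡ k)) (cong (Vec.lookup d) (Perm.inverseʳ π))))
                         (Vec.tabulate∘lookup d)

-- Pairs chosen consistently along the orbits of sixtuples.

module EquivariantChoice {n q : ℕ} (G : GaloisRing n q) where

  open GaloisRingTheory G
  open TeichmüllerDifferences G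
  open TeichmüllerPartition G using (blockOf)
  open PerfectCode G
  open Symmetries G
  open ≡-Reasoning

  -- Only additivity is asked of φ, so that multiplication by `ξ` and ring automorphisms are treated
  -- alike. An exponent 1 modulo 12 expresses order prime to 6 and is inherited by all powers of φ.
  record Symmetry {m : ℕ} (S : Fin m → Pred R 0ℓ) (φ : R → R) : Set where
    field
      φ-+       : ∀ x y → φ (x + y) ≡ φ x + φ y
      φ-power   : ∀ i → ∃ λ i′ → φ (power i) ≡ power i′
      invariant : ∀ k → ∃ λ l → Image φ (blockOf S k) ≐ blockOf S l
      k         : ℕ
      φ-order   : ∀ x → fold x φ (suc (k ℕ.* 12)) ≡ x

    φ-injective : ∀ {x y} → φ x ≡ φ y → x ≡ y
    φ-injective = order⇒injective φ (k ℕ.* 12) φ-order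

  module _ {m : ℕ} {S : Fin m → Pred R 0ℓ} (partition : Partition S) {φ : R → R}
      (symmetry : Symmetry S φ) where

    open Partition partition
    open Symmetry symmetry

    K M : ℕ
    K = k ℕ.* 12
    M = suc K

    -- Iterating φ `K` times inverts it, and every iterate of a power of `ξ` is again a power.
    power-preimage : ∀ i → ∃ λ i′ → φ (power i′) ≡ power i
    power-preimage i = proj₁ (iterate K) , trans (cong φ (sym (proj₂ (iterate K)))) (φ-order (power i))
      where
      iterate : ∀ t → ∃ λ i′ → fold (power i) φ t ≡ power i′
      iterate zero    = i , refl
      iterate (suc t) = proj₁ (φ-power (proj₁ (iterate t))) ,
        trans (cong φ (proj₂ (iterate t))) (proj₂ (φ-power (proj₁ (iterate t))))

    image-index : ∀ j → ∃ λ l → Image φ (S j) ≐ S l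
    image-index j = go (invariant (inj₂ j))
      where
      -- φ permutes the triples, so it cannot send a sixtuple to a triple.
      go : (∃ λ l → Image φ (S j) ≐ blockOf S l) → ∃ λ l → Image φ (S j) ≐ S l
      go (inj₂ l , S≐) = l , S≐
      go (inj₁ i , S≐) = contradiction (proj₂ S≐ (here refl)) (outside (power-preimage i))
        where
        outside : (∃ λ i′ → φ (power i′) ≡ power i) → ¬ Image φ (S j) (power i)
        outside (i′ , eq) (x , x∈S , φx≡) with () ← disjoint (inj₁ i′) (inj₂ j)
          (here {xs = 2 · power i′ List.∷ 3 · power i′ List.∷ List.[]} refl)
              (subst (S j) (φ-injective (trans φx≡ (sym eq))) x∈S)

    σ : Fin m → Fin m
    σ = proj₁ ∘ image-index

    S-disjoint : ∀ {i j u} → S i u → S j u → i ≡ j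
    S-disjoint {i} {j} u∈i u∈j with refl ← disjoint (inj₂ i) (inj₂ j) u∈i u∈j = refl

    fold-image : ∀ t j → Image (λ x → fold x φ t) (S j) ≐ S (fold j σ t)
    fold-image zero    j = (λ { (x , x∈ , refl) → x∈ }) , λ {x} x∈ → x , x∈ , refl
    fold-image (suc t) j = into , onto
      where
      into : ∀ {y} → Image (λ x → fold x φ (suc t)) (S j) y → S (fold j σ (suc t)) y
      into (x , x∈ , eq) = proj₁ (proj₂ (image-index (fold j σ t)))
          (fold x φ t , proj₁ (fold-image t j) (x , x∈ , refl) , eq)

      onto : ∀ {y} → S (fold j σ (suc t)) y → Image (λ x → fold x φ (suc t)) (S j) y
      onto y∈ = go (proj₂ (proj₂ (image-index (fold j σ t))) y∈)
        where
        go : ∀ {y} → Image φ (S (fold j σ t)) y → Image (λ x → fold x φ (suc t)) (S j) y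
        go (z , z∈ , refl) = lift (proj₂ (fold-image t j) z∈)
          where
          lift : Image (λ x → fold x φ t) (S j) z → Image (λ x → fold x φ (suc t)) (S j) (φ z)
          lift (x , x∈ , eq) = x , x∈ , cong φ eq

    fold-∈ : ∀ t {j x} → S j x → S (fold j σ t) (fold x φ t)
    fold-∈ t {j} {x} x∈ = proj₁ (fold-image t j) (x , x∈ , refl)

    member : ∀ j → ∃ (S j)
    member j with sixtuples j
    ... | a , _ , _ , S≐ = a , proj₂ S≐ (here refl)

    -- φ^M fixes any member of the block, and a member lies in only one block.
    σ-order : ∀ j → fold j σ M ≡ j
    σ-order j = go (member j)
      where
      go : ∃ (S j) → fold j σ M ≡ j
      go (x , x∈) = S-disjoint (fold-∈ M x∈) (subst (S j) (sym (φ-order x)) x∈)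

    fold-φ-+ : ∀ t x y → fold (x + y) φ t ≡ fold x φ t + fold y φ t
    fold-φ-+ zero    x y = refl
    fold-φ-+ (suc t) x y = trans (cong φ (fold-φ-+ t x y)) (φ-+ (fold x φ t) (fold y φ t))

    -- The power φ^s preserves the sixtuple and inherits the exponent `M`, so the result on signed
    -- permutations applies to it.
    stabiliser-fixes : ∀ s {r x} → fold r σ s ≡ r → S r x → fold x φ s ≡ x
    stabiliser-fixes s {r} {x} σ^s≡r x∈ = go (sixtuples r)
      where
      g : R → R
      g y = fold y φ s

      g-order : ∀ y → fold y g M ≡ y
      g-order y = begin
        fold y g M            ≡⟨ fold-* φ M s y ⟩
        fold y φ (M ℕ.* s)  ≡⟨ cong (fold y φ) (ℕ.*-comm M s) ⟩
        fold y φ (s ℕ.* M)  ≡⟨ fold-period φ s M (φ-order y) ⟩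
        y  ∎

      go : (∃₂ λ a b → Unique (sixtuple a b) × S r ≐ (_∈ sixtuple a b)) → g x ≡ x
      go (a , b , _ , S≐) = SignedPermutation.fixes g (fold-φ-+ s) k g-order
        (λ {u} u∈ → proj₁ S≐ (subst (λ r → S r (g u)) σ^s≡r (fold-∈ s (proj₂ S≐ u∈))))
        (proj₁ S≐ x∈)

    -- The time t - t′ stabilises the index `r`, so it fixes `x`. Hence transport between two
    -- sixtuples of an orbit does not depend on the number of steps taken.
    same-endpoint : ∀ t t′ {r x} → S r x → fold r σ t ≡ fold r σ t′ → fold x φ t ≡ fold x φ t′
    same-endpoint t t′ {r} {x} x∈ eq = begin
      fold x φ t                        ≡⟨ go φ φ-order x ⟨
      fold x φ (t′ ℕ.+ s)               ≡⟨ fold-+ x φ t′ ⟩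
      fold (fold x φ s) φ t′  ≡⟨ cong (λ y → fold y φ t′) (stabiliser-fixes s σ^s≡r x∈) ⟩
      fold x φ t′  ∎
      where
      s : ℕ
      -- As K = M - 1 acts as -1 in exponents modulo M, this is t - t′ without truncated
      -- subtraction.
      s = t ℕ.+ t′ ℕ.* K

      go : ∀ {A : Set} (f : A → A) → (∀ y → fold y f M ≡ y) → ∀ y → fold y f (t′ ℕ.+ s) ≡ fold y f t
      go f f-order y = begin
        fold y f (t′ ℕ.+ (t ℕ.+ t′ ℕ.* K))
          ≡⟨ cong (fold y f) (trans (sym (ℕ.+-assoc t′ t (t′ ℕ.* K)))
              (trans (cong (ℕ._+ t′ ℕ.* K) (ℕ.+-comm t′ t)) (ℕ.+-assoc t t′ (t′ ℕ.* K)))) ⟩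
        fold y f (t ℕ.+ (t′ ℕ.+ t′ ℕ.* K))  ≡⟨ cong (λ l → fold y f (t ℕ.+ l)) (ℕ.*-suc t′ K) ⟨
        fold y f (t ℕ.+ t′ ℕ.* M)  ≡⟨ fold-+ y f t ⟩
        fold (fold y f (t′ ℕ.* M)) f t  ≡⟨ cong (λ z → fold z f t) (fold-period f t′ M (f-order y)) ⟩
        fold y f t  ∎

      σ^s≡r : fold r σ s ≡ r
      σ^s≡r = fold-injective σ (order⇒injective σ K σ-order) t′ (begin
        fold (fold r σ s) σ t′    ≡⟨ fold-+ r σ t′ ⟨
        fold r σ (t′ ℕ.+ s)       ≡⟨ go σ σ-order r ⟩
        fold r σ t                ≡⟨ eq ⟩
        fold r σ t′  ∎)

    Reaches : Fin m → Fin m → Set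
    Reaches i j = ∃ λ (t : Fin M) → fold i σ (toℕ t) ≡ j

    reaches? : ∀ j i → Dec (Reaches i j)
    reaches? j i = Fin.any? λ t → fold i σ (toℕ t) Fin.≟ j

    reaches : ∀ {i j} t → fold i σ t ≡ j → Reaches i j
    reaches {i} {j} t eq = fromℕ< (m%n<n t M) , (begin
      fold i σ (toℕ (fromℕ< (m%n<n t M)))  ≡⟨ cong (fold i σ) (Fin.toℕ-fromℕ< (m%n<n t M)) ⟩
      fold i σ (t % M)
        ≡⟨ cong (λ r → fold r σ (t % M)) (fold-period σ (t / M) M (σ-order i)) ⟨
      fold (fold i σ (t / M ℕ.* M)) σ (t % M)  ≡⟨ fold-+ i σ (t % M) ⟨
      fold i σ (t % M ℕ.+ t / M ℕ.* M)  ≡⟨ cong (fold i σ) (m≡m%n+[m/n]*n t M) ⟨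
      fold i σ t                                     ≡⟨ eq ⟩
      j  ∎)

    reaches-σ : ∀ {i j} → Reaches i j → Reaches i (σ j)
    reaches-σ (t , eq) = reaches (suc (toℕ t)) (cong σ eq)

    reaches-σ⁻ : ∀ {i j} → Reaches i (σ j) → Reaches i j
    -- `K` further steps undo one application of σ.
    reaches-σ⁻ {i} {j} (t , eq) = reaches (K ℕ.+ toℕ t) (begin
      fold i σ (K ℕ.+ toℕ t)        ≡⟨ fold-+ i σ K ⟩
      fold (fold i σ (toℕ t)) σ K  ≡⟨ cong (λ l → fold l σ K) eq ⟩
      fold (σ j) σ K                ≡⟨ fold-suc σ K j ⟩
      fold j σ M                    ≡⟨ σ-order j ⟩
      j  ∎)

    -- The least index of the orbit of j under σ.
    representative : ∀ j → ∃ λ i → Reaches i j × head (filter (reaches? j) (allFin m)) ≡ just i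
    representative j = firstWitness (reaches? j) (j , zero , refl)

    rep : Fin m → Fin m
    rep j = proj₁ (representative j)

    time : Fin m → ℕ
    time j = toℕ (proj₁ (proj₁ (proj₂ (representative j))))

    rep-reaches : ∀ j → fold (rep j) σ (time j) ≡ j
    rep-reaches j = proj₂ (proj₁ (proj₂ (representative j)))

    -- `j` and `σ j` are reached from the same indices, so the two filtered lists coincide, heads
    -- included.
    rep-σ : ∀ j → rep (σ j) ≡ rep j
    rep-σ j = just-injective (begin
      just (rep (σ j))  ≡⟨ proj₂ (proj₂ (representative (σ j))) ⟨
      head (filter (reaches? (σ j)) (allFin m))
        ≡⟨ cong head (filter-≐ (reaches? (σ j)) (reaches? j) (reaches-σ⁻ , reaches-σ) (allFin m)) ⟩
      head (filter (reaches? j) (allFin m))  ≡⟨ proj₂ (proj₂ (representative j)) ⟩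
      just (rep j)  ∎)

    P₀ : Fin m → R × R
    P₀ j = proj₁ (sixtuples j) , proj₁ (proj₂ (sixtuples j))

    P₀-choice : Choice S P₀
    P₀-choice j = proj₂ (proj₂ (proj₂ (sixtuples j)))

    equivariant : Fin m → R × R
    equivariant j = fold (proj₁ (P₀ (rep j))) φ (time j) , fold (proj₂ (P₀ (rep j))) φ (time j)

    equivariant-choice : Choice S equivariant
    equivariant-choice j = subst (λ l → S l ≐ (_∈ uncurry sixtuple (equivariant j))) (rep-reaches j)
      (image-unique (fold-image t r) (Image-cong f (swap (P₀-choice r)) ((λ u∈ → u∈) , λ u∈ → u∈) images))
      where
      r : Fin m
      r = rep j

      t : ℕ
      t = time j

      f : R → R
      f x = fold x φ t

      images : Image f (_∈ uncurry sixtuple (P₀ r)) ≐ (_∈ uncurry sixtuple (equivariant j))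
      images = image-list f (map-sixtuple f (fold-φ-+ t) (proj₁ (P₀ r)) (proj₂ (P₀ r)))

    -- The recorded time of `σ j` need not be one more than that of `j`, but both lead from the
    -- common representative to `σ j`, so they transport its pair identically.
    equivariant-σ : ∀ j → equivariant (σ j) ≡ (φ (proj₁ (equivariant j)) , φ (proj₂ (equivariant j)))
    equivariant-σ j = cong₂ _,_ (moved proj₁ λ r → here refl) (moved proj₂ λ r → there (there (here refl)))
      where
      moved : (pr : R × R → R) → (∀ r → pr (P₀ r) ∈ uncurry sixtuple (P₀ r)) →
              fold (pr (P₀ (rep (σ j)))) φ (time (σ j)) ≡ φ (fold (pr (P₀ (rep j))) φ (time j))
      moved pr pr∈ = trans (cong (λ r → fold (pr (P₀ r)) φ (time (σ j))) (rep-σ j))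
        (same-endpoint (time (σ j)) (suc (time j)) (proj₂ (P₀-choice (rep j)) (pr∈ (rep j))) (begin
          fold (rep j) σ (time (σ j))  ≡⟨ cong (λ r → fold r σ (time (σ j))) (rep-σ j) ⟨
          fold (rep (σ j)) σ (time (σ j))  ≡⟨ rep-reaches (σ j) ⟩
          σ j  ≡⟨ cong σ (rep-reaches j) ⟨
          σ (fold (rep j) σ (time j))  ∎))

    equivariant-columns : ∀ {h} → IsColumnFunction equivariant h →
                          Image φ (λ r → ∃ λ i → h i ≡ r) ≐ (λ r → ∃ λ i → h i ≡ r)
    equivariant-columns {h} columns = (λ { (_ , (i , refl) , refl) → into (locate {m} {n} i) })
                                    , λ { (i , refl) → onto (locate {m} {n} i) }
      where
      open IsColumnFunction columns

      into : ∀ {i} → Position {m} {n} i → ∃ λ l → h l ≡ φ (h i)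
      into (first j)  = position₀ (σ j) , trans (h-first (σ j))
          (trans (cong proj₁ (equivariant-σ j)) (cong φ (sym (h-first j))))
      into (second j) = position₁ (σ j) , trans (h-second (σ j))
          (trans (cong proj₂ (equivariant-σ j)) (cong φ (sym (h-second j))))
      into (right i)  = position {m} (proj₁ (φ-power i)) , trans (h-right (proj₁ (φ-power i)))
        (trans (sym (proj₂ (φ-power i))) (cong φ (sym (h-right i))))

      onto : ∀ {i} → Position {m} {n} i → Image φ (λ r → ∃ λ i → h i ≡ r) (h i)
      onto (first j)  = h (position₀ l) , (position₀ l , refl) , (begin
        φ (h (position₀ l))          ≡⟨ cong φ (h-first l) ⟩
        φ (proj₁ (equivariant l))  ≡⟨ cong proj₁ (equivariant-σ l) ⟨
        proj₁ (equivariant (σ l))  ≡⟨ cong (proj₁ ∘ equivariant) (σ-order j) ⟩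
        proj₁ (equivariant j)        ≡⟨ h-first j ⟨
        h (position₀ j)  ∎)
        where
        l : Fin m
        -- The preimage of `j` under σ, because one more step completes `M`.
        l = fold j σ K
      onto (second j) = h (position₁ l) , (position₁ l , refl) , (begin
        φ (h (position₁ l))          ≡⟨ cong φ (h-second l) ⟩
        φ (proj₂ (equivariant l))  ≡⟨ cong proj₂ (equivariant-σ l) ⟨
        proj₂ (equivariant (σ l))  ≡⟨ cong (proj₂ ∘ equivariant) (σ-order j) ⟩
        proj₂ (equivariant j)        ≡⟨ h-second j ⟨
        h (position₁ j)  ∎)
        where
        l : Fin m
        l = fold j σ K
      onto (right i)  = h (position {m} l) , (position {m} l , refl) , (begin
        φ (h (position {m} l))       ≡⟨ cong φ (h-right l) ⟩
        φ (power l)  ≡⟨ proj₂ (power-preimage i) ⟩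
        power i                      ≡⟨ h-right i ⟨
        h (position {m} i)  ∎)
        where
        l : Fin n
        l = proj₁ (power-preimage i)

-- Squares modulo 12.

module _ where

  open +-*-Solver using (solve; _:=_; _:+_; _:*_; con)

  odd⇒1+2* : ∀ Δ → 2 ∤ Δ → ∃ λ e → Δ ≡ suc (e ℕ.* 2)
  odd⇒1+2* Δ 2∤Δ = go (Δ % 2) (m%n<n Δ 2) (m≡m%n+[m/n]*n Δ 2)
    where
    go : ∀ r → r < 2 → Δ ≡ r ℕ.+ Δ / 2 ℕ.* 2 → ∃ λ e → Δ ≡ suc (e ℕ.* 2)
    go 0 _ eq = contradiction (divides (Δ / 2) eq) 2∤Δ
    go 1 _ eq = Δ / 2 , eq
    go (suc (suc _)) (s≤s (s≤s ())) _

  4^≡1+3* : ∀ e → ∃ λ w → 2 ℕ.^ (e ℕ.* 2) ≡ 1 ℕ.+ 3 ℕ.* w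
  4^≡1+3* zero    = 0 , refl
  4^≡1+3* (suc e) with w , eq ← 4^≡1+3* e = 1 ℕ.+ 4 ℕ.* w ,
    trans (cong (λ x → 2 ℕ.* (2 ℕ.* x)) eq)
      (solve 1 (λ w → con 2 :* (con 2 :* (con 1 :+ con 3 :* w)) :=
          con 1 :+ con 3 :* (con 1 :+ con 4 :* w)) refl w)

  -- 2^Δ − 1 is prime to 6 for odd Δ, so its square is 1 modulo 12.
  [2^Δ∸1]² : ∀ Δ → 2 ∤ Δ → ∃ λ k → (2 ℕ.^ Δ ∸ 1) ℕ.* (2 ℕ.^ Δ ∸ 1) ≡ suc (k ℕ.* 12)
  [2^Δ∸1]² Δ 2∤Δ = go (odd⇒1+2* Δ 2∤Δ)
    where
    open ≡-Reasoning

    go : (∃ λ e → Δ ≡ suc (e ℕ.* 2)) → ∃ λ k → (2 ℕ.^ Δ ∸ 1) ℕ.* (2 ℕ.^ Δ ∸ 1) ≡ suc (k ℕ.* 12)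
    go (e , refl) = w ℕ.+ 3 ℕ.* (w ℕ.* w) , (begin
      N ℕ.* N
        ≡⟨ cong (λ x → x ℕ.* x) N≡ ⟩
      (1 ℕ.+ 6 ℕ.* w) ℕ.* (1 ℕ.+ 6 ℕ.* w)
        ≡⟨ solve 1 (λ w → (con 1 :+ con 6 :* w) :* (con 1 :+ con 6 :* w) :=
            con 1 :+ (w :+ con 3 :* (w :* w)) :* con 12) refl w ⟩
      suc ((w ℕ.+ 3 ℕ.* (w ℕ.* w)) ℕ.* 12) ∎)
      where
      N w : ℕ
      N = 2 ℕ.^ suc (e ℕ.* 2) ∸ 1
      w = proj₁ (4^≡1+3* e)

      N≡ : N ≡ 1 ℕ.+ 6 ℕ.* w
      N≡ = cong (_∸ 1) (trans (cong (2 ℕ.*_) (proj₂ (4^≡1+3* e)))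
        (solve 1 (λ w → con 2 :* (con 1 :+ con 3 :* w) := con 2 :+ con 6 :* w) refl w))

  -- The residues prime to 12 are 1, 5, 7 and 11, each with square 1 modulo 12; every other residue
  -- forces a factor 2 or 3 of Δ.
  square-mod-12 : ∀ Δ → 2 ∤ Δ → 3 ∤ Δ → ∃ λ k → Δ ℕ.* Δ ≡ suc (k ℕ.* 12)
  square-mod-12 Δ 2∤Δ 3∤Δ = go (Δ % 12) (m%n<n Δ 12) (m≡m%n+[m/n]*n Δ 12)
    where
    t : ℕ
    t = Δ / 12

    even : ∀ s → Δ ≡ s ℕ.* 2 ℕ.+ t ℕ.* 12 → ∃ λ k → Δ ℕ.* Δ ≡ suc (k ℕ.* 12)
    even s eq = contradiction (divides (s ℕ.+ t ℕ.* 6) (trans eq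
      (solve 2 (λ s t → s :* con 2 :+ t :* con 12 := (s :+ t :* con 6) :* con 2) refl s t))) 2∤Δ

    threefold : ∀ s → Δ ≡ s ℕ.* 3 ℕ.+ t ℕ.* 12 → ∃ λ k → Δ ℕ.* Δ ≡ suc (k ℕ.* 12)
    threefold s eq = contradiction (divides (s ℕ.+ t ℕ.* 4) (trans eq
      (solve 2 (λ s t → s :* con 3 :+ t :* con 12 := (s :+ t :* con 4) :* con 3) refl s t))) 3∤Δ

    coprime : ∀ r c → r ℕ.* r ≡ suc (c ℕ.* 12) → Δ ≡ r ℕ.+ t ℕ.* 12 → ∃ λ k → Δ ℕ.* Δ ≡ suc (k ℕ.* 12)
    coprime r c r² eq = c ℕ.+ (r ℕ.* t ℕ.* 2 ℕ.+ t ℕ.* t ℕ.* 12) , (begin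
      Δ ℕ.* Δ
        ≡⟨ cong₂ ℕ._*_ eq eq ⟩
      (r ℕ.+ t ℕ.* 12) ℕ.* (r ℕ.+ t ℕ.* 12)
        ≡⟨ solve 2 (λ r t → (r :+ t :* con 12) :* (r :+ t :* con 12) :=
            r :* r :+ (r :* t :* con 2 :+ t :* t :* con 12) :* con 12) refl r t ⟩
      r ℕ.* r ℕ.+ (r ℕ.* t ℕ.* 2 ℕ.+ t ℕ.* t ℕ.* 12) ℕ.* 12
        ≡⟨ cong (ℕ._+ (r ℕ.* t ℕ.* 2 ℕ.+ t ℕ.* t ℕ.* 12) ℕ.* 12) r² ⟩
      suc (c ℕ.* 12) ℕ.+ (r ℕ.* t ℕ.* 2 ℕ.+ t ℕ.* t ℕ.* 12) ℕ.* 12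
        ≡⟨ cong suc (ℕ.*-distribʳ-+ 12 c (r ℕ.* t ℕ.* 2 ℕ.+ t ℕ.* t ℕ.* 12)) ⟨
      suc ((c ℕ.+ (r ℕ.* t ℕ.* 2 ℕ.+ t ℕ.* t ℕ.* 12)) ℕ.* 12) ∎)
      where open ≡-Reasoning

    go : ∀ r → r < 12 → Δ ≡ r ℕ.+ t ℕ.* 12 → ∃ λ k → Δ ℕ.* Δ ≡ suc (k ℕ.* 12)
    go 0  _ = even 0
    go 1  _ = coprime 1 0 refl
    go 2  _ = even 1
    go 3  _ = threefold 1
    go 4  _ = even 2
    go 5  _ = coprime 5 2 refl
    go 6  _ = even 3
    go 7  _ = coprime 7 4 refl
    go 8  _ = even 4
    go 9  _ = threefold 3
    go 10 _ = even 5
    go 11 _ = coprime 11 10 refl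
    go (suc (suc (suc (suc (suc (suc (suc (suc (suc (suc (suc (suc _))))))))))))
       (s≤s (s≤s (s≤s (s≤s (s≤s (s≤s (s≤s (s≤s (s≤s (s≤s (s≤s (s≤s ()))))))))))))

-- GR(4^Δ) itself: existence of the partition, perfection and automorphisms.

module Corollary (Δ : ℕ) (2∤Δ : 2 ∤ Δ) (h : Poly 4) (basic : IsBasicPrimitive Δ h) where

  open Galois Δ h
  module Q = QuotientRing Δ h
  open ≡-Reasoning

  0<Δ : 0 < Δ
  0<Δ = ℕ.n≢0⇒n>0 λ { refl → 2∤Δ (divides 0 refl) }

  0<2^Δ : 0 < 2 ℕ.^ Δ
  0<2^Δ = ℕ.m^n>0 2 Δ

  1+n≡2^Δ : suc n ≡ 2 ℕ.^ Δ
  1+n≡2^Δ = ℕ.m+[n∸m]≡n 0<2^Δ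

  q : ℕ
  q = 2 ℕ.^ (Δ ∸ 1)

  2^Δ≡q+q : 2 ℕ.^ Δ ≡ q ℕ.+ q
  2^Δ≡q+q = trans (cong (2 ℕ.^_) (sym (ℕ.m+[n∸m]≡n 0<Δ))) (cong (q ℕ.+_) (ℕ.+-identityʳ q))

  galoisRing : GaloisRing n q
  galoisRing = record
    { isCommutativeRing = CommutativeRing.isCommutativeRing Q.commutativeRing
    ; _≟_               = Vec.≡-dec Fin._≟_
    ; 4·≡0              = Q.4·≡𝟎
    ; 2·1≢0             = Q.2·𝟏≢𝟎 0<Δ
    ; halve             = Q.halve
    ; residue           = Fin.cast (sym 1+n≡2^Δ) ∘ Q.residue
    ; residue-injective = λ {x} {y} eq → Q.residue-injective (Fin.toℕ-injective (trans
        (sym (Fin.toℕ-cast (sym 1+n≡2^Δ) (Q.residue x)))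
            (trans (cong toℕ eq) (Fin.toℕ-cast (sym 1+n≡2^Δ) (Q.residue y)))))
    ; ξ                 = ξ
    ; 0<n               = proj₁ order
    ; ξ^n≡1             = proj₁ (proj₂ order)
    ; ξ-minimal         = proj₂ (proj₂ order)
    ; 1+n≡q+q           = trans 1+n≡2^Δ 2^Δ≡q+q
    }
    where open IsBasicPrimitive basic using (order)

  private module G = GaloisRingTheory galoisRing
  open TeichmüllerDifferences galoisRing using (LineSystem; lineSystem; Six-unique)
  open TeichmüllerPartition galoisRing using (blockOf; module Blocks)
  open Syndromes galoisRing
  open PerfectCode galoisRing
  open Symmetries galoisRing
  open EquivariantChoice galoisRing
  open SumProperties (CommutativeRing.+-commutativeMonoid ℤ₄-commutativeRing) using ()
    renaming (sum to sum₄; sum-cong-≗ to sum₄-cong)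
  module Roots = RootCounting galoisRing

  coordinates : ∀ v → ∃ λ (cs : Vec ℕ Δ) → Roots.evaluate cs ξ ≡ v
  coordinates v = Vec.map toℕ v , trans (go v) (Q.act-𝟏 v)
    where
    go : ∀ {d} (p : Vec ℤ₄ d) → Roots.evaluate (Vec.map toℕ p) ξ ≡ Q.act (toList p) Q.𝟏
    go []      = refl
    go (a ∷ p) = cong₂ G._+_ (sym (Q.•≡· a Q.𝟏)) (trans (cong (ξ G.*_) (go p)) (Q.ξ⊛ _))

  module RingAutomorphism (φ : R → R) (iso : IsRingAutomorphism φ) where
    open RingMorphisms.IsRingIsomorphism iso public
      using (injective; +-homo; *-homo; 0#-homo; 1#-homo; -‿homo)
    open Roots.Automorphism φ +-homo *-homo 0#-homo 1#-homo public

    unit-homo : ∀ x → G.Unit₂ x → G.Unit₂ (φ x)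
    unit-homo x unit 2φx≡0 = unit (injective (trans (+-homo x x) (trans 2φx≡0 (sym 0#-homo))))

    φ-order : ∀ x → fold x φ Δ ≡ x
    φ-order = φ^Δ≡id Δ 1+n≡2^Δ coordinates

  -- The number of lines is known through six times its value, and exact division identifies it with
  -- the prescribed number of sixtuples.
  lines : LineSystem m
  lines = go lineSystem
    where
    go : (∃ λ m′ → LineSystem m′ × m′ ℕ.* 6 ≡ n ℕ.* (n ∸ 1)) → LineSystem m
    go (m′ , L , count) = subst LineSystem (begin
      m′  ≡⟨ m*n/n≡m m′ 6 ⟨
      (m′ ℕ.* 6) / 6  ≡⟨ cong (_/ 6) count ⟩
      (n ℕ.* (n ∸ 1)) / 6
          ≡⟨ cong (λ k → (n ℕ.* k) / 6) (ℕ.∸-+-assoc (2 ℕ.^ Δ) 1 1) ⟩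
      (n ℕ.* (2 ℕ.^ Δ ∸ 2)) / 6  ∎) L

  blocks : ∀ S k → block S k ≐ blockOf S k
  blocks S (inj₁ i) = (λ u∈ → u∈) , λ u∈ → u∈
  blocks S (inj₂ j) = (λ u∈ → u∈) , λ u∈ → u∈

  linePartition : ∃ λ S → IsPartition S
  linePartition = S , record
    { sixtuples   = λ j → _ , _ , Six-unique (independent j) , (λ u∈ → u∈) , (λ u∈ → u∈)
    ; nonzero     = λ k u u∈ → block-nonzero k u (proj₁ (blocks S k) u∈)
    ; covers-once = λ u u≢0 → once (block-exists u u≢0)
    ; ξ-invariant = convert (invariant mulξ (η G.*_)
        (G.distribˡ ξ) mulξ-neg (G.distribˡ η) η-unit mulξ-square mulξ-power)
    ; automorphism-invariant = λ _ φ iso → let open RingAutomorphism φ iso in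
        convert (invariant φ φ +-homo -‿homo +-homo unit-homo (λ x → *-homo x x) φ-power)
    }
    where
    open LineSystem lines using (independent)
    open Blocks lines

    once : ∀ {u} → (∃ λ k → blockOf S k u) → ∃! _≡_ λ k → block S k u
    once (k , u∈k) = k , proj₂ (blocks S k) u∈k , λ {l} u∈l → block-unique k l u∈k (proj₁ (blocks S l) u∈l)

    convert : ∀ {φ : R → R} → (∀ k → ∃ λ l → Image φ (blockOf S k) ≐ blockOf S l) → IsInvariant S φ
    convert {φ} inv k = proj₁ (inv k) ,
      Image-cong φ (swap (blocks S k)) (swap (blocks S (proj₁ (inv k)))) (proj₂ (inv k))

    -- A square root of `ξ`: multiplying the points of a line by it multiplies their squares by `ξ`.
    -- The exponent has the shape produced by `square-root`.
    η : R
    η = ξ G.^ (1 ℕ.* q)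

    η²≡ξ : η G.* η ≡ ξ
    η²≡ξ = trans (G.square-root 1) (G.*-identityʳ ξ)

    η-unit : ∀ x → G.Unit₂ x → G.Unit₂ (η G.* x)
    η-unit x unit 2ηx≡0 = unit (G.*-cancel-≋0 {η} {x} (G.ξ^-unit (1 ℕ.* q)) 2ηx≡0)

    mulξ-square : ∀ x → mulξ (x G.* x) ≡ (η G.* x) G.* (η G.* x)
    mulξ-square x = trans (cong (G._* (x G.* x)) (sym η²≡ξ)) (G.*-interchange η η x x)

    mulξ-neg : ∀ x → mulξ (G.- x) ≡ G.- mulξ x
    mulξ-neg = additive⇒neg mulξ (G.distribˡ ξ)

    mulξ-power : ∀ i → ∃ λ i′ → mulξ (G.power i) ≡ G.power i′
    mulξ-power i = G.ξ^-power (suc (toℕ i))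

  lookup-sum : ∀ {k} (f : Fin k → R) i → Vec.lookup (sum f) i ≡ sum₄ (λ l → Vec.lookup (f l) i)
  lookup-sum {zero}  f i = Q.lookup-𝟎 i
  lookup-sum {suc k} f i = trans (Q.lookup-⊕ (f zero) (sum (f ∘ suc)) i)
    (cong (Vec.lookup (f zero) i ℤ₄.+_) (lookup-sum (f ∘ suc) i))

  lookup-syndrome : ∀ {N} (g : Fin N → R) (c : Vec ℤ₄ N) i →
    Vec.lookup (syndrome g c) i ≡ sum₄ (λ l → Vec.lookup (g l) i ℤ₄.* Vec.lookup c l)
  lookup-syndrome g c i = trans (lookup-sum (λ l → Vec.lookup c l • g l) i) (sum₄-cong λ l → (begin
    Vec.lookup (Vec.lookup c l • g l) i
      ≡⟨ cong (λ v → Vec.lookup v i) (Q.•≡· (Vec.lookup c l) (g l)) ⟨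
    Vec.lookup (Vec.lookup c l Q.• g l) i  ≡⟨ Q.lookup-• (Vec.lookup c l) (g l) i ⟩
    Vec.lookup c l ℤ₄.* Vec.lookup (g l) i  ≡⟨ ℤ₄.*-comm (Vec.lookup c l) (Vec.lookup (g l) i) ⟩
    Vec.lookup (g l) i ℤ₄.* Vec.lookup c l  ∎))

  code⇒syndrome : ∀ P c → Code (checkMatrix P) c → syndrome (column P) c ≡ Q.𝟎
  code⇒syndrome P c c∈C = Q.lookup-ext λ i →
    trans (lookup-syndrome (column P) c i) (trans (c∈C i) (sym (Q.lookup-𝟎 i)))

  syndrome⇒code : ∀ P c → syndrome (column P) c ≡ Q.𝟎 → Code (checkMatrix P) c
  syndrome⇒code P c s≡0 i = trans (sym (lookup-syndrome (column P) c i))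
    (trans (cong (λ v → Vec.lookup v i) s≡0) (Q.lookup-𝟎 i))

  columnFunction : ∀ P → IsColumnFunction P (column P)
  columnFunction P = record { h-first = h-first ; h-second = h-second ; h-right = h-right }
    where
    h-first : ∀ j → column P (position₀ {m} {n} j) ≡ proj₁ (P j)
    h-first j rewrite Fin.splitAt-↑ˡ (m ℕ.* 2) (Fin.combine {m} {2} j 0F) n
                  | Fin.remQuot-combine {m} {2} j 0F = refl

    h-second : ∀ j → column P (position₁ {m} {n} j) ≡ proj₂ (P j)
    h-second j rewrite Fin.splitAt-↑ˡ (m ℕ.* 2) (Fin.combine {m} {2} j 1F) n
                  | Fin.remQuot-combine {m} {2} j 1F = refl

    h-right : ∀ i → column P (position {m} {n} i) ≡ G.power i
    h-right i rewrite Fin.splitAt-↑ʳ (m ℕ.* 2) n i = refl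

  module _ (S : Sixtuples) (isPartition : IsPartition S) where

    open IsPartition isPartition

    partition : Partition S
    partition = record
      { sixtuples = sixtuples
      ; nonzero   = λ k u u∈ → nonzero k u (proj₂ (blocks S k) u∈)
      ; covers    = λ u u≢0 → block-of u (covers-once u u≢0)
      ; disjoint  = λ k l {u} u∈k u∈l → unique k l (proj₂ (blocks S k) u∈k) (proj₂ (blocks S l) u∈l)
      }
      where
      block-of : ∀ u → (∃! _≡_ λ k → block S k u) → ∃ λ k → blockOf S k u
      block-of u (k , u∈k , _) = k , proj₁ (blocks S k) u∈k

      unique : ∀ k l {u} → block S k u → block S l u → k ≡ l
      unique k l {u} u∈k u∈l = trans (sym (only u∈k)) (only u∈l)
        where
        u≢0 : u ≢ Q.𝟎
        u≢0 = nonzero k u u∈k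

        only : ∀ {k} → block S k u → proj₁ (covers-once u u≢0) ≡ k
        only = proj₂ (proj₂ (covers-once u u≢0))

    invariantOf : ∀ {φ : R → R} → IsInvariant S φ → ∀ k → ∃ λ l → Image φ (blockOf S k) ≐ blockOf S l
    invariantOf {φ} inv k = proj₁ (inv k) ,
      Image-cong φ (blocks S k) (blocks S (proj₁ (inv k))) (proj₂ (inv k))

    perfectCode : ∀ P → IsChoice S P → IsPerfect₁ (D m n) (Code (checkMatrix P))
    perfectCode P choice v = go
        (perfect P (choice⇒partitioned partition choice) (column P) (columnFunction P) v)
      where
      go : (∃! _≡_ λ c → syndrome (column P) c ≡ Q.𝟎 × DistanceAtMost (D m n) 1 v c) →
           ∃! _≡_ λ c → Code (checkMatrix P) c × DistanceAtMost (D m n) 1 v c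
      go (c , (s≡0 , close) , unique) = c , (syndrome⇒code P c s≡0 , close) ,
        λ {c′} (c′∈C , close′) → unique (code⇒syndrome P c′ c′∈C , close′)

    actsOnCode : ∀ {φ} → Symmetry S φ → ActsOnCode S φ
    actsOnCode {φ} symmetry =
      (P , equivariant-choice partition symmetry ,
       equivariant-columns partition symmetry (columnFunction P)) ,
      λ P choice maps → let injective = column-injective (choice⇒partitioned partition choice) (columnFunction P) in
        permutation (column P) injective φ φ-+ φ-injective maps ,
        λ π corresponds → transfer P π (automorphism (column P) injective φ φ-+ φ-injective π corresponds)
      where
      open Symmetry symmetry

      P : Pairs
      P = equivariant partition symmetry

      transfer : ∀ P π → IsAutomorphism (λ c → syndrome (column P) c ≡ Q.𝟎) π →
                 IsAutomorphism (Code (checkMatrix P)) π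
      transfer P π = Image-cong (permute π) code code
        where
        code : (λ c → syndrome (column P) c ≡ Q.𝟎) ≐ Code (checkMatrix P)
        code = (λ {c} → syndrome⇒code P c) , λ {c} → code⇒syndrome P c

    mulξ-symmetry : Symmetry S mulξ
    mulξ-symmetry = record
      { φ-+       = G.distribˡ ξ
      ; φ-power   = λ i → G.ξ^-power (suc (toℕ i))
      ; invariant = invariantOf ξ-invariant
      ; k         = proj₁ ([2^Δ∸1]² Δ 2∤Δ)
      -- Already n steps give the identity; n · n steps are counted because that exponent is 1
      -- modulo 12.
      ; φ-order   = λ x → subst (λ t → fold x mulξ t ≡ x) (proj₂ ([2^Δ∸1]² Δ 2∤Δ)) (begin
          fold x mulξ (n ℕ.* n)  ≡⟨ fold-mulξ x (n ℕ.* n) ⟩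
          ξ G.^ (n ℕ.* n) G.* x  ≡⟨ cong (G._* x) (G.ξ^-* n) ⟩
          G.1# G.* x                 ≡⟨ G.*-identityˡ x ⟩
          x  ∎)
      }
      where
      fold-mulξ : ∀ x t → fold x mulξ t ≡ ξ G.^ t G.* x
      fold-mulξ x zero    = sym (G.*-identityˡ x)
      fold-mulξ x (suc t) = trans (cong mulξ (fold-mulξ x t)) (sym (G.*-assoc ξ (ξ G.^ t) x))

    automorphism-symmetry : 3 ∤ Δ → ∀ φ → IsRingAutomorphism φ → Symmetry S φ
    automorphism-symmetry 3∤Δ φ iso = record
      { φ-+       = +-homo
      ; φ-power   = φ-power
      ; invariant = invariantOf (automorphism-invariant 3∤Δ φ iso)
      ; k         = proj₁ (square-mod-12 Δ 2∤Δ 3∤Δ)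
      -- Likewise Δ steps suffice for the identity, and Δ · Δ is 1 modulo 12.
      ; φ-order   = λ x → subst (λ t → fold x φ t ≡ x) (proj₂ (square-mod-12 Δ 2∤Δ 3∤Δ))
          (fold-period φ Δ Δ (φ-order x))
      }
      where open RingAutomorphism φ iso

corollary1 : (Δ : ℕ) → 2 ∤ Δ →
    (h : Poly 4) → IsBasicPrimitive Δ h →
    let open Galois Δ h in
    (∃ λ (S : Sixtuples) → IsPartition S) ×
    ((S : Sixtuples) → IsPartition S →
    ((P : Pairs) → IsChoice S P → IsPerfect₁ (D m n) (Code (checkMatrix P)))
    × ActsOnCode S mulξ
    × (3 ∤ Δ → (φ : R → R) → IsRingAutomorphism φ → ActsOnCode S φ))
corollary1 Δ 2∤Δ h basic = linePartition , λ S isPartition →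
  perfectCode S isPartition ,
  actsOnCode S isPartition (mulξ-symmetry S isPartition) ,
  λ 3∤Δ φ iso → actsOnCode S isPartition (automorphism-symmetry S isPartition 3∤Δ φ iso)
  where open Corollary Δ 2∤Δ h basic
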